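{- For each integer $n\ge1$, let $M_n=\{\{(0,k),(1,k)\}\mid 1\le k\le n\}$, let $\Gamma_n$ be the set of graphs $G\subseteq\{\{(0,k),(1,l)\}\mid 1\le k,l\le 2n\}$ that have $M_n$ as a maximum cardinality matching, and let $\Pi_n=\mathcal S(\{(1,k)\mid 1\le k\le 2n\})$. Let $$Q_n=\min_{(G,\pi)\in\Gamma_n\times\Pi_n}\frac{\mathbb{E}_{R\sim\mathrm{RANKING}(G,\pi)}\bigl[|R|\bigr]}{|M_n|},$$ where the offline vertex set used by RANKING is $V_n=\{(0,k)\mid 1\le k\le 2n\}$. If the sequence $(Q_n)_n$ converges, then $Q_n$ tends to $1-1/e$ as $n\to\infty$.
   Context: An edge is a set of exactly two vertices; a graph $G$ is a set of edges; $\mathcal V(G)=\bigcup_{e\in G}e$ and $N_G(v)=\{u\mid\{v,u\}\in G\}$. A matching is a set of pairwise disjoint edges; a matching $M\subseteq G$ is a maximum cardinality matching with respect to $G$ if no matching contained in $G$ has larger cardinality. A permutation of a finite set $A$ is a list of distinct elements whose elements are exactly those of $A$; $\mathcal S(A)$ is the set of permutations of $A$. For a list $\sigma$ of distinct elements, $\sigma(v)$ is the rank (position, starting at 1) of $v$ in $\sigma$. The procedure online-match$(G,\pi,\sigma)$: start with $R=\emptyset$; process the vertices $u$ of $\pi$ in order; if $N_G(u)\setminus\mathcal V(R)\neq\emptyset$, add to $R$ the edge $\{v,u\}$, where $v$ is the vertex of $N_G(u)\setminus\mathcal V(R)$ with minimum rank $\sigma(v)$; otherwise leave $R$ unchanged.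 The output is the final $R$. $\mathrm{RANKING}(G,\pi)$, with offline vertex set $V$, is the probability distribution of online-match$(G,\pi,\sigma)$ when $\sigma$ is drawn uniformly at random from $\mathcal S(V)$. -}

module Defs where

open import Data.Bool.Base using (Bool)
open import Data.Fin.Base as Fin using (Fin; zero; suc; combine; _↑ˡ_)
import Data.Fin.Properties as Fin
open import Data.Fin.Subset as Subset using (Subset; ⁅_⁆; _∪_; _∩_; _─_; ⋃; Empty)
import Data.Fin.Subset.Properties as Subset
open import Data.Integer.Base as ℤ using (+_; -[1+_])
import Data.Integer.Properties as ℤ
open import Data.List.Base as List
  using (List; []; _∷_; _++_; map; filter; foldl; foldr; length; allFin;
         cartesianProduct; cartesianProductWith; deduplicate)
import Data.List.Extrema as Extrema
import Data.List.Membership.DecPropositional as DecMembership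
open import Data.List.Membership.Propositional using (_∈_)
open import Data.List.Membership.Propositional.Properties
  using (∈-map⁺; ∈-map⁻; ∈-++⁺ˡ; ∈-++⁺ʳ; ∈-filter⁺; ∈-filter⁻; ∈-allFin; ∈-lookup;
         ∈-cartesianProduct⁺; ∈-cartesianProductWith⁺; ∈-deduplicate⁺; ∈-deduplicate⁻; ∈-++⁻)
open import Data.List.NonEmpty as List⁺ using (List⁺; _∷_)
open import Data.List.Relation.Binary.Subset.Propositional using (_⊆_)
import Data.List.Relation.Binary.Subset.DecPropositional as DecSubset
open import Data.List.Relation.Unary.All as All using (All)
open import Data.List.Relation.Unary.AllPairs as AllPairs using (AllPairs; allPairs?)
import Data.List.Relation.Unary.AllPairs.Properties as AllPairs
open import Data.List.Relation.Unary.Any as Any using (here; there)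
open import Data.List.Relation.Unary.Any.Properties using (lookup-index)
open import Data.List.Relation.Unary.Unique.Propositional using (Unique)
import Data.List.Relation.Unary.Unique.Propositional.Properties as Unique
import Data.List.Relation.Unary.Unique.DecPropositional as DecUnique
import Data.List.Relation.Unary.Unique.DecPropositional.Properties as DecUnique
open import Data.Nat.Base as ℕ using (ℕ; zero; suc; NonZero; _!)
open import Data.Nat.Coprimality using (Coprime)
import Data.Nat.Properties as ℕ
import Data.Nat.Solver as ℕSolver
open import Data.Product using (_×_; _,_; ∃; proj₁; proj₂; uncurry)
open import Data.Rational as ℚ using (ℚ; 0ℚ; 1ℚ; ½; _/_; 1/_; _⊔_; _⊓_)
import Data.Rational.Properties as ℚ
import Data.Rational.Unnormalised.Base as ℚᵘ
import Data.Rational.Unnormalised.Properties as ℚᵘ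
open import Data.Rational.Solver using (module +-*-Solver)
open import Data.Sum.Base using (inj₁; inj₂)
open import Data.Vec.Base using (tabulate)
open import Data.Vec.Properties using (≡-dec)
import Data.Bool.Properties as Bool
open import Function.Base using (_∘_)
open import Relation.Binary.Definitions using (DecidableEquality)
open import Relation.Binary.PropositionalEquality
open import Relation.Nullary
open import Relation.Nullary.Decidable using (map′)

private
  variable
    A : Set
    N : ℕ

-- Sets of vertices are (extensional) subsets of `Fin N`.  A finite set of
-- edges is a duplicate-free list of vertex sets, so that its cardinality is
-- its length.  The type does not force the members to have exactly two vertices;
-- the graphs quantified over below are sublists of `allEdges`, whose members
-- join an offline vertex to an online one.

Graph : ℕ → Set
Graph N = List (Subset N)

edge : Fin N → Fin N → Subset N
edge u v = ⁅ u ⁆ ∪ ⁅ v ⁆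

_≟ˢ_ : DecidableEquality (Subset N)
_≟ˢ_ = ≡-dec Bool._≟_

_∈ᴳ?_ : (e : Subset N) (G : Graph N) → Dec (e ∈ G)
_∈ᴳ?_ = DecMembership._∈?_ _≟ˢ_

𝒱 : Graph N → Subset N
𝒱 = ⋃

neighbours : Graph N → Fin N → Subset N
neighbours G v = tabulate λ u → does (edge v u ∈ᴳ? G)

-- Uniqueness makes the list a set; `AllPairs` then ranges over the pairs of
-- distinct members of that set.
IsMatching : Graph N → Set
IsMatching M = Unique M × AllPairs (λ e f → Empty (e ∩ f)) M

IsMaximumMatching : Graph N → Graph N → Set
IsMaximumMatching M G =
  IsMatching M × M ⊆ G × (∀ M′ → IsMatching M′ → M′ ⊆ G → length M′ ℕ.≤ length M)

-- All sublists; for a duplicate-free list these are its subsets, each once.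
subsets : List A → List (List A)
subsets []       = [] ∷ []
subsets (x ∷ xs) = map (x ∷_) (subsets xs) ++ subsets xs

filter∈subsets : ∀ {P : A → Set} (P? : ∀ x → Dec (P x)) xs → filter P? xs ∈ subsets xs
filter∈subsets P? []       = here refl
filter∈subsets P? (x ∷ xs) with does (P? x)
... | Bool.true  = ∈-++⁺ˡ (∈-map⁺ (x ∷_) (filter∈subsets P? xs))
... | Bool.false = ∈-++⁺ʳ (map (x ∷_) (subsets xs)) (filter∈subsets P? xs)

subsets-⊆ : ∀ (xs : List A) {ys} → ys ∈ subsets xs → ys ⊆ xs
subsets-⊆ []       (here refl) ()
subsets-⊆ (x ∷ xs) ys∈ z∈ with ∈-++⁻ (map (x ∷_) (subsets xs)) ys∈
... | inj₂ ys∈′ = there (subsets-⊆ xs ys∈′ z∈)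
... | inj₁ ys∈′ with ∈-map⁻ (x ∷_) ys∈′ | z∈
...   | zs , zs∈ , refl | here refl = here refl
...   | zs , zs∈ , refl | there z∈′ = there (subsets-⊆ xs zs∈ z∈′)

lookup-injective : ∀ {xs : List A} → Unique xs →
                   ∀ i j → List.lookup xs i ≡ List.lookup xs j → i ≡ j
lookup-injective (_   AllPairs.∷ _)  zero    zero    _  = refl
lookup-injective (x∉  AllPairs.∷ _)  zero    (suc j) eq =
  contradiction eq (All.lookup x∉ (∈-lookup j))
lookup-injective (x∉  AllPairs.∷ _)  (suc i) zero    eq =
  contradiction (sym eq) (All.lookup x∉ (∈-lookup i))
lookup-injective (_   AllPairs.∷ u)  (suc i) (suc j) eq =
  cong suc (lookup-injective u i j eq)

unique-⊆⇒length≤ : ∀ {xs ys : List A} → Unique xs → xs ⊆ ys → length xs ℕ.≤ length ys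
unique-⊆⇒length≤ {xs = xs} {ys} uxs xs⊆ys = Fin.injective⇒≤ {f = position} position-injective
  where
  position : Fin (length xs) → Fin (length ys)
  position i = Any.index (xs⊆ys (∈-lookup i))

  position-injective : ∀ {i j} → position i ≡ position j → i ≡ j
  position-injective {i} {j} eq = lookup-injective uxs i j (trans
    (lookup-index (xs⊆ys (∈-lookup i)))
    (trans (cong (List.lookup ys) eq) (sym (lookup-index (xs⊆ys (∈-lookup j))))))

isMatching? : (M : Graph N) → Dec (IsMatching M)
isMatching? M =
  DecUnique.unique? _≟ˢ_ M
    ×-dec allPairs? (λ e f → ¬? (Subset.nonempty? (e ∩ f))) M

isMaximumMatching? : (M G : Graph N) → Dec (IsMaximumMatching M G)
isMaximumMatching? M G =
  isMatching? M ×-dec DecSubset._⊆?_ _≟ˢ_ M G ×-dec map′ to from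
    (All.all? (λ M′ → isMatching? M′ →-dec (length M′ ℕ.≤? length M)) (subsets G₁))
  where
  G₁ = deduplicate _≟ˢ_ G
  Bounded = λ M′ → IsMatching M′ → length M′ ℕ.≤ length M

  disjoint : ∀ {M′} → IsMatching M′ → ∀ {e f} → e ∈ M′ → f ∈ M′ → e ≢ f → Empty (e ∩ f)
  disjoint (_ , ds) = go ds
    where
    go : ∀ {M′} → AllPairs (λ e f → Empty (e ∩ f)) M′ →
         ∀ {e f} → e ∈ M′ → f ∈ M′ → e ≢ f → Empty (e ∩ f)
    go (_  AllPairs.∷ _)  (here refl) (here refl) e≢f = contradiction refl e≢f
    go (d  AllPairs.∷ _)  (here refl) (there f∈)  e≢f = All.lookup d f∈
    go (d  AllPairs.∷ _)  {e} {f} (there e∈)  (here refl) e≢f =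
      subst Empty (Subset.∩-comm f e) (All.lookup d e∈)
    go (_  AllPairs.∷ ds) (there e∈)  (there f∈)  e≢f = go ds e∈ f∈ e≢f

  to : All Bounded (subsets G₁) → ∀ M′ → IsMatching M′ → M′ ⊆ G → length M′ ℕ.≤ length M
  to bounded M′ m′ M′⊆G =
    ℕ.≤-trans
      (unique-⊆⇒length≤ (proj₁ m′) λ e∈ →
        ∈-filter⁺ (_∈ᴳ? M′) (∈-deduplicate⁺ _≟ˢ_ (M′⊆G e∈)) e∈)
      (All.lookup bounded (filter∈subsets (_∈ᴳ? M′) G₁) (uniq , pairs uniq inM′))
    where
    M″ = filter (_∈ᴳ? M′) G₁

    uniq : Unique M″
    uniq = Unique.filter⁺ (_∈ᴳ? M′) (DecUnique.deduplicate-! _≟ˢ_ G)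

    inM′ : M″ ⊆ M′
    inM′ = proj₂ ∘ ∈-filter⁻ (_∈ᴳ? M′) {xs = G₁}

    pairs : ∀ {L} → Unique L → L ⊆ M′ → AllPairs (λ e f → Empty (e ∩ f)) L
    pairs AllPairs.[]         _  = AllPairs.[]
    pairs (e≢ AllPairs.∷ uL) L⊆ =
      All.tabulate (λ f∈ → disjoint m′ (L⊆ (here refl)) (L⊆ (there f∈)) (All.lookup e≢ f∈))
        AllPairs.∷ pairs uL (L⊆ ∘ there)

  from : (∀ M′ → IsMatching M′ → M′ ⊆ G → length M′ ℕ.≤ length M) → All Bounded (subsets G₁)
  from maximal = All.tabulate λ {M′} M′∈ m′ →
    maximal M′ m′ (∈-deduplicate⁻ _≟ˢ_ G ∘ subsets-⊆ G₁ M′∈)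

insertions : A → List A → List⁺ (List A)
insertions x []       = (x ∷ []) ∷ []
insertions x (y ∷ ys) = (x ∷ y ∷ ys) ∷ map (y ∷_) (List⁺.toList (insertions x ys))

-- For a duplicate-free list, lists each permutation of its elements once.
permutations : List A → List⁺ (List A)
permutations []       = [] ∷ []
permutations (x ∷ xs) = List⁺.concatMap (insertions x) (permutations xs)

-- A finite distribution with rational weights, given by a nonempty list of
-- equally likely outcomes (with multiplicity).
Distribution : Set → Set
Distribution = List⁺

𝔼 : Distribution A → (A → ℚ) → ℚ
𝔼 d f = foldr ℚ._+_ 0ℚ (map f (List⁺.toList d)) ℚ.* (+ 1 / List⁺.length d)

-- Positions count from 1.  The value at vertices not in the list is irrelevant.
rank : List (Fin N) → Fin N → ℕ
rank []      v = 1
rank (x ∷ σ) v with x Fin.≟ v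
... | yes _ = 1
... | no  _ = suc (rank σ v)

elements : Subset N → List (Fin N)
elements {N} p = filter (Subset._∈? p) (allFin N)

-- The chosen edge has a vertex outside `𝒱 R`, so it is never already in R and
-- R stays duplicate-free.
step : Graph N → List (Fin N) → Graph N → Fin N → Graph N
step G σ R u with elements (neighbours G u ─ 𝒱 R)
... | []     = R
... | v ∷ vs = edge (Extrema.argmin ℕ.≤-totalOrder (rank σ) v vs) u ∷ R

online-match : Graph N → List (Fin N) → List (Fin N) → Graph N
online-match G π σ = foldl (step G σ) [] π

-- The offline vertex set is V.
RANKING : List (Fin N) → Graph N → List (Fin N) → Distribution (Graph N)
RANKING V G π = List⁺.map (online-match G π) (permutations V)

module _ (n : ℕ) where

  Vertex : Set
  Vertex = Fin (2 ℕ.* (2 ℕ.* n))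

  -- `vertex i k` is the pair (i , k + 1): indices 1, …, 2n become Fin (2n).
  vertex : Fin 2 → Fin (2 ℕ.* n) → Vertex
  vertex = combine

  crossEdge : Fin (2 ℕ.* n) → Fin (2 ℕ.* n) → Subset (2 ℕ.* (2 ℕ.* n))
  crossEdge k l = edge (vertex zero k) (vertex (suc zero) l)

  offline online : List Vertex
  offline = map (vertex zero) (allFin (2 ℕ.* n))
  online  = map (vertex (suc zero)) (allFin (2 ℕ.* n))

  allEdges : Graph (2 ℕ.* (2 ℕ.* n))
  allEdges = cartesianProductWith crossEdge (allFin (2 ℕ.* n)) (allFin (2 ℕ.* n))

  M : Graph (2 ℕ.* (2 ℕ.* n))
  M = map (λ k → crossEdge (k ↑ˡ _) (k ↑ˡ _)) (allFin n)

  Γ : List (Graph (2 ℕ.* (2 ℕ.* n)))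
  Γ = filter (isMaximumMatching? M) (subsets allEdges)

  Π : List (List Vertex)
  Π = List⁺.toList (permutations online)

  crossEdge-disjoint : ∀ {k k′ l l′} → k ≢ k′ → l ≢ l′ → Empty (crossEdge k l ∩ crossEdge k′ l′)
  crossEdge-disjoint k≢k′ l≢l′ (x , x∈) with Subset.x∈p∩q⁻ _ _ x∈
  ... | x∈₁ , x∈₂ with Subset.x∈p∪q⁻ _ _ x∈₁ | Subset.x∈p∪q⁻ _ _ x∈₂
  ...   | inj₁ a | inj₁ b =
    k≢k′ (proj₂ (Fin.combine-injective {2} zero _ zero _
      (trans (sym (Subset.x∈⁅y⁆⇒x≡y _ a)) (Subset.x∈⁅y⁆⇒x≡y _ b))))
  ...   | inj₂ a | inj₂ b =
    l≢l′ (proj₂ (Fin.combine-injective {2} (suc zero) _ (suc zero) _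
      (trans (sym (Subset.x∈⁅y⁆⇒x≡y _ a)) (Subset.x∈⁅y⁆⇒x≡y _ b))))
  ...   | inj₁ a | inj₂ b with proj₁ (Fin.combine-injective {2} zero _ (suc zero) _
      (trans (sym (Subset.x∈⁅y⁆⇒x≡y _ a)) (Subset.x∈⁅y⁆⇒x≡y _ b)))
  ...     | ()
  crossEdge-disjoint k≢k′ l≢l′ (x , x∈) | x∈₁ , x∈₂ | inj₂ a | inj₁ b
    with proj₁ (Fin.combine-injective {2} (suc zero) _ zero _
      (trans (sym (Subset.x∈⁅y⁆⇒x≡y _ a)) (Subset.x∈⁅y⁆⇒x≡y _ b)))
  ... | ()

  M-isMatching : IsMatching M
  M-isMatching =
    AllPairs.map⁺ (AllPairs.map distinct (Unique.allFin⁺ n)) ,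
    AllPairs.map⁺ (AllPairs.map
      (λ k≢l → crossEdge-disjoint (↑ˡ-≢ k≢l) (↑ˡ-≢ k≢l)) (Unique.allFin⁺ n))
    where
    ↑ˡ-≢ : ∀ {m} {k l : Fin n} → k ≢ l → k ↑ˡ m ≢ l ↑ˡ m
    ↑ˡ-≢ k≢l = k≢l ∘ Fin.↑ˡ-injective _ _ _

    distinct : ∀ {k l} → k ≢ l →
               crossEdge (k ↑ˡ _) (k ↑ˡ _) ≢ crossEdge (l ↑ˡ _) (l ↑ˡ _)
    distinct {k} {l} k≢l eq =
      crossEdge-disjoint (↑ˡ-≢ k≢l) (↑ˡ-≢ k≢l)
        (vertex zero (k ↑ˡ _) , Subset.x∈p∩q⁺ (v∈ , subst (_ Subset.∈_) eq v∈))
      where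
      v∈ : vertex zero (k ↑ˡ _) Subset.∈ crossEdge (k ↑ˡ _) (k ↑ˡ _)
      v∈ = Subset.x∈p∪q⁺ (inj₁ (Subset.x∈⁅x⁆ _))

  M-graph∈Γ : filter (_∈ᴳ? M) allEdges ∈ Γ
  M-graph∈Γ = ∈-filter⁺ (isMaximumMatching? M) (filter∈subsets (_∈ᴳ? M) allEdges)
    ( M-isMatching
    , (λ e∈ → ∈-filter⁺ (_∈ᴳ? M) (M⊆allEdges e∈) e∈)
    , λ M′ m′ M′⊆ → unique-⊆⇒length≤ (proj₁ m′)
        (proj₂ ∘ ∈-filter⁻ (_∈ᴳ? M) {xs = allEdges} ∘ M′⊆))
    where
    M⊆allEdges : M ⊆ allEdges
    M⊆allEdges e∈ with ∈-map⁻ _ e∈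
    ... | k , _ , refl = ∈-cartesianProductWith⁺ crossEdge (∈-allFin _) (∈-allFin _)

minimum : ∀ {q} (qs : List ℚ) → q ∈ qs → ℚ
minimum (q ∷ qs) _ = foldr _⊓_ q qs

ratio : (n : ℕ) .{{_ : NonZero n}} → Graph (2 ℕ.* (2 ℕ.* n)) → List (Vertex n) → ℚ
ratio n@(suc _) G π =
  𝔼 (RANKING (offline n) G π) (λ R → + length R / 1) ℚ.* (+ 1 / length (M n))

-- The last argument records that Γ n × Π n is nonempty.
Q : (n : ℕ) .{{_ : NonZero n}} → ℚ
Q n = minimum (map (uncurry (ratio n)) (cartesianProduct (Γ n) (Π n)))
  (∈-map⁺ (uncurry (ratio n)) (∈-cartesianProduct⁺ (M-graph∈Γ n) (here refl)))

∣p-q∣-sym : ∀ p q → ℚ.∣ p ℚ.- q ∣ ≡ ℚ.∣ q ℚ.- p ∣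
∣p-q∣-sym p q = trans (sym (ℚ.∣-p∣≡∣p∣ (p ℚ.- q)))
  (cong ℚ.∣_∣ (solve 2 (λ p q → :- (p :- q) := q :- p) refl p q))
  where open +-*-Solver

p-q≤r : ∀ {p q r} → p ℚ.≤ q ℚ.+ r → p ℚ.- q ℚ.≤ r
p-q≤r {p} {q} {r} p≤q+r = subst (p ℚ.- q ℚ.≤_)
  (solve 2 (λ q r → q :+ r :- q := r) refl q r) (ℚ.+-monoˡ-≤ (ℚ.- q) p≤q+r)
  where open +-*-Solver

∣p-q∣≤r : ∀ {p q r} → p ℚ.≤ q ℚ.+ r → q ℚ.≤ p ℚ.+ r → ℚ.∣ p ℚ.- q ∣ ℚ.≤ r
∣p-q∣≤r {p} {q} {r} p≤q+r q≤p+r with ℚ.∣p∣≡p∨∣p∣≡-p (p ℚ.- q)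
... | inj₁ eq = subst (ℚ._≤ r) (sym eq) (p-q≤r p≤q+r)
... | inj₂ eq = subst (ℚ._≤ r)
  (sym (trans eq (solve 2 (λ p q → :- (p :- q) := q :- p) refl p q))) (p-q≤r q≤p+r)
  where open +-*-Solver

p≤∣p∣ : ∀ p → p ℚ.≤ ℚ.∣ p ∣
p≤∣p∣ p with ℚ.≤-total 0ℚ p
... | inj₁ 0≤p = ℚ.≤-reflexive (sym (ℚ.0≤p⇒∣p∣≡p 0≤p))
... | inj₂ p≤0 = ℚ.≤-trans p≤0 (ℚ.0≤∣p∣ p)

p≤q+∣p-q∣ : ∀ p q → p ℚ.≤ q ℚ.+ ℚ.∣ p ℚ.- q ∣
p≤q+∣p-q∣ p q = subst (ℚ._≤ q ℚ.+ ℚ.∣ p ℚ.- q ∣)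
  (solve 2 (λ p q → q :+ (p :- q) := p) refl p q) (ℚ.+-monoʳ-≤ q (p≤∣p∣ (p ℚ.- q)))
  where open +-*-Solver

q≤p+∣p-q∣ : ∀ p q → q ℚ.≤ p ℚ.+ ℚ.∣ p ℚ.- q ∣
q≤p+∣p-q∣ p q = subst (λ d → q ℚ.≤ p ℚ.+ d) (∣p-q∣-sym q p) (p≤q+∣p-q∣ q p)

record ℝ : Set where
  field
    seq    : ℕ → ℚ
    cauchy : ∀ ε → 0ℚ ℚ.< ε →
             ∃ λ K → ∀ m n → K ℕ.≤ m → K ℕ.≤ n → ℚ.∣ seq m ℚ.- seq n ∣ ℚ.< ε

open ℝ

fromℚ : ℚ → ℝ
fromℚ q .seq _ = q
fromℚ q .cauchy ε 0<ε = 0 , λ _ _ _ _ → subst (ℚ._< ε) (sym (cong ℚ.∣_∣ (ℚ.+-inverseʳ q))) 0<ε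

halves : ∀ ε → ½ ℚ.* ε ℚ.+ ½ ℚ.* ε ≡ ε
halves = solve 1 (λ ε → con ½ :* ε :+ con ½ :* ε := ε) refl
  where open +-*-Solver

0<½ε : ∀ {ε} → 0ℚ ℚ.< ε → 0ℚ ℚ.< ½ ℚ.* ε
0<½ε 0<ε = ℚ.*-monoʳ-<-pos ½ 0<ε

infixl 6 _-_
infix  4 _<_

_-_ : ℝ → ℝ → ℝ
(x - y) .seq n = seq x n ℚ.- seq y n
(x - y) .cauchy ε 0<ε with cauchy x (½ ℚ.* ε) (0<½ε 0<ε) | cauchy y (½ ℚ.* ε) (0<½ε 0<ε)
... | J , xs | K , ys = J ℕ.⊔ K , λ m n J⊔K≤m J⊔K≤n → begin-strict
    ℚ.∣ (seq x m ℚ.- seq y m) ℚ.- (seq x n ℚ.- seq y n) ∣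
      ≡⟨ cong ℚ.∣_∣ (solve 4 (λ a b c d → (a :- b) :- (c :- d) := (a :- c) :- (b :- d))
           refl (seq x m) (seq y m) (seq x n) (seq y n)) ⟩
    ℚ.∣ (seq x m ℚ.- seq x n) ℚ.- (seq y m ℚ.- seq y n) ∣
      ≤⟨ ℚ.∣p-q∣≤∣p∣+∣q∣ (seq x m ℚ.- seq x n) (seq y m ℚ.- seq y n) ⟩
    ℚ.∣ seq x m ℚ.- seq x n ∣ ℚ.+ ℚ.∣ seq y m ℚ.- seq y n ∣
      <⟨ ℚ.+-mono-< (xs m n (ℕ.m⊔n≤o⇒m≤o J K J⊔K≤m) (ℕ.m⊔n≤o⇒m≤o J K J⊔K≤n))
                    (ys m n (ℕ.m⊔n≤o⇒n≤o J K J⊔K≤m) (ℕ.m⊔n≤o⇒n≤o J K J⊔K≤n)) ⟩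
    ½ ℚ.* ε ℚ.+ ½ ℚ.* ε
      ≡⟨ halves ε ⟩
    ε ∎
  where
  open ℚ.≤-Reasoning
  open +-*-Solver

∣_∣ : ℝ → ℝ
∣ x ∣ .seq n = ℚ.∣ seq x n ∣
∣ x ∣ .cauchy ε 0<ε with cauchy x ε 0<ε
... | K , xs = K , λ m n K≤m K≤n → ℚ.≤-<-trans
  (∣p-q∣≤r (reverse-triangle (seq x m) (seq x n))
    (subst (λ d → ℚ.∣ seq x n ∣ ℚ.≤ ℚ.∣ seq x m ∣ ℚ.+ d) (∣p-q∣-sym (seq x n) (seq x m))
      (reverse-triangle (seq x n) (seq x m))))
  (xs m n K≤m K≤n)
  where
  reverse-triangle : ∀ p q → ℚ.∣ p ∣ ℚ.≤ ℚ.∣ q ∣ ℚ.+ ℚ.∣ p ℚ.- q ∣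
  reverse-triangle p q = subst (λ z → ℚ.∣ z ∣ ℚ.≤ ℚ.∣ q ∣ ℚ.+ ℚ.∣ p ℚ.- q ∣)
    (solve 2 (λ p q → q :+ (p :- q) := p) refl p q) (ℚ.∣p+q∣≤∣p∣+∣q∣ q (p ℚ.- q))
    where open +-*-Solver

_<_ : ℝ → ℝ → Set
x < y = ∃ λ δ → 0ℚ ℚ.< δ × ∃ λ K → ∀ n → K ℕ.≤ n → seq x n ℚ.+ δ ℚ.≤ seq y n

0ℝ 1ℝ : ℝ
0ℝ = fromℚ 0ℚ
1ℝ = fromℚ 1ℚ

-- The n-th approximation is inverted after replacing it by its maximum with the
-- eventual lower bound δ of x, which changes only finitely many terms.
reciprocal : (x : ℝ) → 0ℝ < x → ℝ
reciprocal x (δ , 0<δ , _) = record { seq = inv ; cauchy = inv-cauchy }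
  where
  y : ℕ → ℚ
  y n = seq x n ⊔ δ

  0<y : ∀ n → 0ℚ ℚ.< y n
  0<y n = ℚ.<-≤-trans 0<δ (ℚ.p≤q⊔p (seq x n) δ)

  instance
    y-pos : ∀ {n} → ℚ.Positive (y n)
    y-pos {n} = ℚ.positive (0<y n)

    δ-pos : ℚ.Positive δ
    δ-pos = ℚ.positive 0<δ

    δ-nonNeg : ℚ.NonNegative δ
    δ-nonNeg = ℚ.pos⇒nonNeg δ

  inv : ℕ → ℚ
  inv n = (1/ y n) {{ℚ.pos⇒nonZero (y n)}}

  y-lipschitz : ∀ m n → ℚ.∣ y m ℚ.- y n ∣ ℚ.≤ ℚ.∣ seq x m ℚ.- seq x n ∣
  y-lipschitz m n = ∣p-q∣≤r
    (bound (seq x n) (p≤q+∣p-q∣ (seq x m) (seq x n)))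
    (bound (seq x m) (q≤p+∣p-q∣ (seq x m) (seq x n)))
    where
    d = ℚ.∣ seq x m ℚ.- seq x n ∣
    bound : ∀ {a} b → a ℚ.≤ b ℚ.+ d → a ⊔ δ ℚ.≤ (b ⊔ δ) ℚ.+ d
    bound b a≤b+d = ℚ.⊔-lub
      (ℚ.≤-trans a≤b+d (ℚ.+-monoˡ-≤ d (ℚ.p≤p⊔q b δ)))
      (subst (ℚ._≤ (b ⊔ δ) ℚ.+ d) (ℚ.+-identityʳ δ)
        (ℚ.+-mono-≤ (ℚ.p≤q⊔p b δ) (ℚ.0≤∣p∣ (seq x m ℚ.- seq x n))))

  cleared : ∀ m n → y m ℚ.* (y n ℚ.* ℚ.∣ inv m ℚ.- inv n ∣) ≡ ℚ.∣ y m ℚ.- y n ∣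
  cleared m n = begin
    y m ℚ.* (y n ℚ.* ℚ.∣ inv m ℚ.- inv n ∣)
      ≡⟨ cong₂ (λ a b → a ℚ.* (b ℚ.* ℚ.∣ inv m ℚ.- inv n ∣)) (abs-y m) (abs-y n) ⟨
    ℚ.∣ y m ∣ ℚ.* (ℚ.∣ y n ∣ ℚ.* ℚ.∣ inv m ℚ.- inv n ∣)
      ≡⟨ cong (ℚ.∣ y m ∣ ℚ.*_) (ℚ.∣p*q∣≡∣p∣*∣q∣ (y n) _) ⟨
    ℚ.∣ y m ∣ ℚ.* ℚ.∣ y n ℚ.* (inv m ℚ.- inv n) ∣
      ≡⟨ ℚ.∣p*q∣≡∣p∣*∣q∣ (y m) _ ⟨
    ℚ.∣ y m ℚ.* (y n ℚ.* (inv m ℚ.- inv n)) ∣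
      ≡⟨ cong ℚ.∣_∣ (solve 4 (λ a b i j → a :* (b :* (i :- j)) := (a :* i) :* b :- (b :* j) :* a)
           refl (y m) (y n) (inv m) (inv n)) ⟩
    ℚ.∣ (y m ℚ.* inv m) ℚ.* y n ℚ.- (y n ℚ.* inv n) ℚ.* y m ∣
      ≡⟨ cong₂ (λ a b → ℚ.∣ a ℚ.* y n ℚ.- b ℚ.* y m ∣) (y*inv m) (y*inv n) ⟩
    ℚ.∣ 1ℚ ℚ.* y n ℚ.- 1ℚ ℚ.* y m ∣
      ≡⟨ cong₂ (λ a b → ℚ.∣ a ℚ.- b ∣) (ℚ.*-identityˡ (y n)) (ℚ.*-identityˡ (y m)) ⟩
    ℚ.∣ y n ℚ.- y m ∣
      ≡⟨ ∣p-q∣-sym (y n) (y m) ⟩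
    ℚ.∣ y m ℚ.- y n ∣ ∎
    where
    open ≡-Reasoning
    open +-*-Solver
    abs-y : ∀ n → ℚ.∣ y n ∣ ≡ y n
    abs-y n = ℚ.0≤p⇒∣p∣≡p (ℚ.<⇒≤ (0<y n))
    y*inv : ∀ n → y n ℚ.* inv n ≡ 1ℚ
    y*inv n = ℚ.*-inverseʳ (y n) {{ℚ.pos⇒nonZero (y n)}}

  0<δδε : ∀ {ε} → 0ℚ ℚ.< ε → 0ℚ ℚ.< δ ℚ.* (δ ℚ.* ε)
  0<δδε {ε} 0<ε = scale (scale 0<ε)
    where
    scale : ∀ {q} → 0ℚ ℚ.< q → 0ℚ ℚ.< δ ℚ.* q
    scale {q} 0<q = subst (ℚ._< δ ℚ.* q) (ℚ.*-zeroʳ δ) (ℚ.*-monoʳ-<-pos δ 0<q)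

  inv-cauchy : ∀ ε → 0ℚ ℚ.< ε →
               ∃ λ K → ∀ m n → K ℕ.≤ m → K ℕ.≤ n → ℚ.∣ inv m ℚ.- inv n ∣ ℚ.< ε
  inv-cauchy ε 0<ε with cauchy x (δ ℚ.* (δ ℚ.* ε)) (0<δδε 0<ε)
  ... | K , xs = K , λ m n K≤m K≤n →
    let d = ℚ.∣ inv m ℚ.- inv n ∣
        instance
          d-nonNeg : ℚ.NonNegative d
          d-nonNeg = ℚ.∣-∣-nonNeg (inv m ℚ.- inv n)
          ynd-nonNeg : ℚ.NonNegative (y n ℚ.* d)
          ynd-nonNeg = ℚ.nonNegative (subst (ℚ._≤ y n ℚ.* d) (ℚ.*-zeroʳ (y n))
            (ℚ.*-monoˡ-≤-nonNeg (y n) {{ℚ.pos⇒nonNeg (y n)}} (ℚ.nonNegative⁻¹ d)))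
    in ℚ.*-cancelˡ-<-nonNeg δ (ℚ.*-cancelˡ-<-nonNeg δ (begin-strict
      δ ℚ.* (δ ℚ.* d)       ≤⟨ ℚ.*-monoˡ-≤-nonNeg δ (ℚ.*-monoʳ-≤-nonNeg d (ℚ.p≤q⊔p (seq x n) δ)) ⟩
      δ ℚ.* (y n ℚ.* d)     ≤⟨ ℚ.*-monoʳ-≤-nonNeg (y n ℚ.* d) (ℚ.p≤q⊔p (seq x m) δ) ⟩
      y m ℚ.* (y n ℚ.* d)   ≡⟨ cleared m n ⟩
      ℚ.∣ y m ℚ.- y n ∣     ≤⟨ y-lipschitz m n ⟩
      ℚ.∣ seq x m ℚ.- seq x n ∣ <⟨ xs m n K≤m K≤n ⟩
      δ ℚ.* (δ ℚ.* ε)       ∎))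
    where open ℚ.≤-Reasoning

infix 4 _⟶_

_⟶_ : (ℕ → ℚ) → ℝ → Set
a ⟶ x = ∀ ε → 0ℚ ℚ.< ε → ∃ λ K → ∀ n → K ℕ.≤ n → ∣ fromℚ (a n) - x ∣ < fromℚ ε

Convergent : (ℕ → ℚ) → Set
Convergent a = ∃ λ x → a ⟶ x

inv! : ℕ → ℚ
inv! n = (+ 1 / (n !)) {{n ℕ.!≢0}}

-- The partial sum of 1/k! over 0 ≤ k ≤ n.
e-seq : ℕ → ℚ
e-seq zero    = inv! 0
e-seq (suc n) = e-seq n ℚ.+ inv! (suc n)

0≤1/! : ∀ n → 0ℚ ℚ.≤ inv! n
0≤1/! n = ℚ.nonNegative⁻¹ (inv! n) {{ℚ.normalize-nonNeg 1 (n !) {{n ℕ.!≢0}}}}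

1/a+1/a≤1/b : ∀ a b .{{_ : NonZero a}} .{{_ : NonZero b}} →
              2 ℕ.* b ℕ.≤ a → + 1 / a ℚ.+ + 1 / a ℚ.≤ + 1 / b
1/a+1/a≤1/b (suc a) (suc b) 2b≤a = ℚ.toℚᵘ-cancel-≤ (begin
  ℚ.toℚᵘ (+ 1 / suc a ℚ.+ + 1 / suc a)
    ≃⟨ ℚ.toℚᵘ-homo-+ (+ 1 / suc a) (+ 1 / suc a) ⟩
  ℚ.toℚᵘ (+ 1 / suc a) ℚᵘ.+ ℚ.toℚᵘ (+ 1 / suc a)
    ≃⟨ ℚᵘ.+-cong (ℚ.toℚᵘ-fromℚᵘ 1/a) (ℚ.toℚᵘ-fromℚᵘ 1/a) ⟩
  1/a ℚᵘ.+ 1/a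
    ≤⟨ ℚᵘ.*≤* (ℤ.+≤+ bound) ⟩
  1/b
    ≃⟨ ℚ.toℚᵘ-fromℚᵘ 1/b ⟨
  ℚ.toℚᵘ (+ 1 / suc b) ∎)
  where
  open ℚᵘ.≤-Reasoning
  1/a = ℚᵘ.mkℚᵘ (+ 1) a
  1/b = ℚᵘ.mkℚᵘ (+ 1) b
  bound : (1 ℕ.* suc a ℕ.+ 1 ℕ.* suc a) ℕ.* suc b ℕ.≤ 1 ℕ.* (suc a ℕ.* suc a)
  bound = subst₂ ℕ._≤_
    (solve 2 (λ a b → a :* (con 2 :* b) := (con 1 :* a :+ con 1 :* a) :* b) refl (suc a) (suc b))
    (solve 1 (λ a → a :* a := con 1 :* (a :* a)) refl (suc a))
    (ℕ.*-monoʳ-≤ (suc a) 2b≤a)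
    where open ℕSolver.+-*-Solver

e-seq-suc : ∀ n → e-seq n ℚ.≤ e-seq (suc n)
e-seq-suc n = subst (ℚ._≤ e-seq (suc n)) (ℚ.+-identityʳ (e-seq n))
  (ℚ.+-monoʳ-≤ (e-seq n) (0≤1/! (suc n)))

e-seq-upper : ∀ n → 1 ℕ.≤ n → e-seq (suc n) ℚ.+ inv! (suc n) ℚ.≤ e-seq n ℚ.+ inv! n
e-seq-upper n 1≤n = subst (ℚ._≤ e-seq n ℚ.+ inv! n)
  (sym (ℚ.+-assoc (e-seq n) (inv! (suc n)) (inv! (suc n))))
  (ℚ.+-monoʳ-≤ (e-seq n)
    (1/a+1/a≤1/b (suc n !) (n !) {{suc n ℕ.!≢0}} {{n ℕ.!≢0}} (ℕ.*-monoˡ-≤ (n !) (ℕ.s≤s 1≤n))))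

e-seq-bounds : ∀ K j → 1 ℕ.≤ K →
  e-seq K ℚ.≤ e-seq (j ℕ.+ K) × e-seq (j ℕ.+ K) ℚ.+ inv! (j ℕ.+ K) ℚ.≤ e-seq K ℚ.+ inv! K
e-seq-bounds K zero    1≤K = ℚ.≤-refl , ℚ.≤-refl
e-seq-bounds K (suc j) 1≤K with e-seq-bounds K j 1≤K
... | lower , upper =
  ℚ.≤-trans lower (e-seq-suc (j ℕ.+ K)) ,
  ℚ.≤-trans (e-seq-upper (j ℕ.+ K) (ℕ.≤-trans 1≤K (ℕ.m≤n+m K j))) upper

e-seq-range : ∀ K n → 1 ℕ.≤ K → K ℕ.≤ n →
              e-seq K ℚ.≤ e-seq n × e-seq n ℚ.≤ e-seq K ℚ.+ inv! K
e-seq-range K n 1≤K K≤n with e-seq-bounds K (n ℕ.∸ K) 1≤K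
... | lower , upper rewrite ℕ.m∸n+n≡m K≤n =
  lower , ℚ.≤-trans
    (subst (ℚ._≤ e-seq n ℚ.+ inv! n) (ℚ.+-identityʳ (e-seq n)) (ℚ.+-monoʳ-≤ (e-seq n) (0≤1/! n)))
    upper

n≤n! : ∀ n → n ℕ.≤ n !
n≤n! zero    = ℕ.z≤n
n≤n! (suc n) = subst (ℕ._≤ suc n !) (ℕ.*-identityʳ (suc n))
  (ℕ.*-monoʳ-≤ (suc n) (ℕ.>-nonZero⁻¹ (n !) {{n ℕ.!≢0}}))

1/a<p : ∀ a d p .{{_ : NonZero a}} .(c : Coprime (suc p) (suc d)) →
        suc d ℕ.< a → + 1 / a ℚ.< ℚ.mkℚ (+ suc p) d c
1/a<p (suc a) d p c d<a = ℚ.toℚᵘ-cancel-< (ℚᵘ.<-respˡ-≃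
  (ℚᵘ.≃-sym (ℚ.toℚᵘ-fromℚᵘ (ℚᵘ.mkℚᵘ (+ 1) a)))
  (ℚᵘ.*<* (ℤ.+<+ (ℕ.<-≤-trans
    (subst (ℕ._< suc a) (sym (ℕ.*-identityˡ (suc d))) d<a)
    (ℕ.m≤m+n (suc a) (p ℕ.* suc a))))))

1/!<ε : ∀ ε → 0ℚ ℚ.< ε → ∃ λ K → 1 ℕ.≤ K × inv! K ℚ.< ε
1/!<ε (ℚ.mkℚ (+ suc p)  d c) _   =
  suc (suc d) , ℕ.s≤s ℕ.z≤n ,
  1/a<p (suc (suc d) !) d p {{suc (suc d) ℕ.!≢0}} c (n≤n! (suc (suc d)))
1/!<ε (ℚ.mkℚ (+ zero)   d _) 0<ε = contradiction (ℚ.positive 0<ε) λ ()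
1/!<ε (ℚ.mkℚ (-[1+ p ]) d _) 0<ε = contradiction (ℚ.positive 0<ε) λ ()

e : ℝ
e .seq = e-seq
e .cauchy ε 0<ε with 1/!<ε ε 0<ε
... | K , 1≤K , 1/K!<ε = K , λ m n K≤m K≤n → ℚ.≤-<-trans
  (∣p-q∣≤r (close m n K≤m K≤n) (close n m K≤n K≤m)) 1/K!<ε
  where
  close : ∀ m n → K ℕ.≤ m → K ℕ.≤ n → e-seq m ℚ.≤ e-seq n ℚ.+ inv! K
  close m n K≤m K≤n = ℚ.≤-trans (proj₂ (e-seq-range K m 1≤K K≤m))
    (ℚ.+-monoˡ-≤ (inv! K) (proj₁ (e-seq-range K n 1≤K K≤n)))

0<e : 0ℝ < e
0<e = 1ℚ , ℚ.positive⁻¹ 1ℚ , 0 , λ n _ → subst (ℚ._≤ e-seq n) (sym (ℚ.+-identityˡ 1ℚ)) (1≤e n)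
  where
  1≤e : ∀ n → 1ℚ ℚ.≤ e-seq n
  1≤e zero    = ℚ.≤-refl
  1≤e (suc n) = ℚ.≤-trans (1≤e n) (e-seq-suc n)

{-# OPTIONS --safe #-}
module Submission where

-- Lower bound.  Let v be the partner of u, let τ be an order of the other N − 1
-- offline vertices, N = 2n, and insert v behind the first t vertices of τ.  If v
-- is then not matched, u is served by the first t vertices of τ alone, and
-- hence, for every place at which v is inserted into τ, by the first t + 1
-- vertices of the resulting order.  With Y_t the number of vertices matched by
-- the first t offline vertices, summed over all N! orders, summation over v and τ
-- gives n N! + N Y_t ≤ (N + 1) Y_{t+1}, so that Q_n ≥ 1 − (N / (N + 1)) ^ N.
--
-- Upper bound.  In the triangular graph (k ≤ l < n, online vertices arriving in
-- decreasing order) the vertex l is, by symmetry, matched equally often to each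
-- of the offline vertices 0, …, l, say y_l times among N! orders.  Offline vertex
-- 0 is matched at most once per order, so ∑ y_l ≤ N!, and (l + 1) y_l ≤ N!.  The
-- linear program maximising the total ∑ (l + 1) y_l under these constraints gives
-- Q_n ≤ 1 − (k / (k + 1)) ^ (k + 1) for n = (k + 1) ^ k.

open import Defs
open import Data.Nat.Base using (suc)
open import Data.Bool.Base using (Bool; true; false; if_then_else_; _∧_)
open import Data.Fin.Base using (Fin; zero; suc; toℕ; _↑ˡ_)
import Data.Fin.Properties as Fin
open import Data.Fin.Subset as Subset using (Subset; ⁅_⁆; _∩_; _─_; inside; outside)
import Data.Fin.Subset.Properties as Subset
open import Data.Integer.Base as ℤ using () renaming (+_ to pos)
import Data.Integer.Properties as ℤ
open import Data.List.Base as List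
  using (List; []; _∷_; [_]; _++_; map; filter; foldr; length; take; drop; reverse;
         allFin; tabulate; upTo; downFrom; cartesianProduct)
import Data.List.Extrema as Extrema
import Data.List.Membership.DecPropositional as DecMembership
open import Data.List.Membership.Propositional using (_∈_; _∉_)
import Data.List.Membership.Propositional.Properties as Mem
open import Data.List.NonEmpty as List⁺ using (toList)
import Data.List.NonEmpty.Properties as List⁺
import Data.List.Properties as List
open import Data.List.Relation.Binary.Permutation.Propositional as Perm using (_↭_)
import Data.List.Relation.Binary.Permutation.Propositional.Properties as Perm
import Data.List.Relation.Binary.Permutation.Setoid.Properties as PermSetoid
open import Data.List.Relation.Binary.Subset.Propositional using (_⊆_)
open import Data.List.Relation.Unary.All as All using (All; []; _∷_)
import Data.List.Relation.Unary.All.Properties as All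
open import Data.List.Relation.Unary.AllPairs as AllPairs using (AllPairs)
open import Data.List.Relation.Unary.Any as Any using (here; there)
open import Data.List.Relation.Unary.Unique.Propositional using (Unique)
import Data.List.Relation.Unary.Unique.Propositional.Properties as Unique
open import Data.Nat.Base as ℕ using (ℕ; zero; _+_; _*_; _∸_; _^_; _≤_; _!; z≤n; s≤s; NonZero)
open import Data.Nat.Properties as ℕ
  using (+-comm; +-assoc; *-comm; *-assoc; +-mono-≤; +-monoʳ-≤; +-monoˡ-≤; ≤-refl; ≤-trans;
         ≤-reflexive; _≟_; _≤?_)
open import Data.Nat.Tactic.RingSolver using (solve-∀)
open import Data.Product using (_×_; _,_; ∃; proj₁; proj₂; uncurry)
open import Data.Rational as ℚ using (ℚ; 0ℚ; 1ℚ; ½; _/_; _⊓_; _⊔_)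
import Data.Rational.Properties as ℚ
open import Data.Rational.Solver using (module +-*-Solver)
import Data.Rational.Unnormalised.Base as ℚᵘ
import Data.Rational.Unnormalised.Properties as ℚᵘ
open import Data.Sum.Base using (_⊎_; inj₁; inj₂)
open import Data.Vec.Base using (_∷_; here; there)
import Data.Vec.Properties as Vec
open import Function.Base using (_∘_; id; case_of_)
open import Relation.Binary.Definitions using (DecidableEquality)
open import Relation.Binary.PropositionalEquality hiding ([_])
open import Relation.Nullary
open import Relation.Nullary.Decidable using (dec-true; dec-false; ⌊_⌋)

-- Vertices behind place t have no influence on which online vertices the first t places serve, so
-- Y_t is the size of a complete greedy run on a truncated order. The question whether v stays
-- unmatched thus becomes a comparison of two runs whose lists of offline vertices differ in one
-- entry.
--
-- The exact dual of the linear program would need c close to n / e, with the sum of 1 / (l + 1)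
-- over c ≤ l < n close to 1, and hence logarithms. Geometrically spaced end points replace them:
-- the block from k d to (k + 1) d contributes at least d / ((k + 1) d) = 1 / (k + 1) to that sum,
-- and k blocks give k / (k + 1). This is the factor that raises the exponent from k to k + 1. The
-- price is a bound for n = (k + 1) ^ k only, which is where the hypothesis of convergence enters.
--
-- Both estimates meet at 1 / e through (1 + 1 / N) ^ N ≤ e ≤ (1 + 1 / N) ^ (N + 1), proved for
-- partial sums of the series.

private
  variable
    A B C D : Set
    ν : ℕ


-- Finite sums over lists.

∑ : List A → (A → ℕ) → ℕ
∑ []       f = 0
∑ (x ∷ xs) f = f x + ∑ xs f

∑-cong-∈ : ∀ (xs : List A) {f g} → (∀ {x} → x ∈ xs → f x ≡ g x) → ∑ xs f ≡ ∑ xs g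
∑-cong-∈ []       f≗g = refl
∑-cong-∈ (x ∷ xs) f≗g = cong₂ _+_ (f≗g (here refl)) (∑-cong-∈ xs (f≗g ∘ there))

∑-cong : ∀ (xs : List A) {f g} → (∀ x → f x ≡ g x) → ∑ xs f ≡ ∑ xs g
∑-cong xs f≗g = ∑-cong-∈ xs (λ {x} _ → f≗g x)

∑-mono-∈ : ∀ (xs : List A) {f g} → (∀ {x} → x ∈ xs → f x ≤ g x) → ∑ xs f ≤ ∑ xs g
∑-mono-∈ []       f≤g = z≤n
∑-mono-∈ (x ∷ xs) f≤g = +-mono-≤ (f≤g (here refl)) (∑-mono-∈ xs (f≤g ∘ there))

∑-mono : ∀ (xs : List A) {f g} → (∀ x → f x ≤ g x) → ∑ xs f ≤ ∑ xs g
∑-mono xs f≤g = ∑-mono-∈ xs (λ {x} _ → f≤g x)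

∑-++ : ∀ (xs ys : List A) f → ∑ (xs ++ ys) f ≡ ∑ xs f + ∑ ys f
∑-++ []       ys f = refl
∑-++ (x ∷ xs) ys f = trans (cong (f x +_) (∑-++ xs ys f)) (sym (+-assoc (f x) (∑ xs f) (∑ ys f)))

∑-map : ∀ (h : A → B) xs f → ∑ (map h xs) f ≡ ∑ xs (f ∘ h)
∑-map h []       f = refl
∑-map h (x ∷ xs) f = cong (f (h x) +_) (∑-map h xs f)

∑-distrib-+ : ∀ (xs : List A) f g → ∑ xs (λ x → f x + g x) ≡ ∑ xs f + ∑ xs g
∑-distrib-+ []       f g = refl
∑-distrib-+ (x ∷ xs) f g = trans (cong (f x + g x +_) (∑-distrib-+ xs f g))
  (lemma (f x) (g x) (∑ xs f) (∑ xs g))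
  where
  lemma : ∀ a b c d → a + b + (c + d) ≡ a + c + (b + d)
  lemma = solve-∀

∑-distribˡ-* : ∀ (xs : List A) c f → ∑ xs (λ x → c * f x) ≡ c * ∑ xs f
∑-distribˡ-* []       c f = sym (ℕ.*-zeroʳ c)
∑-distribˡ-* (x ∷ xs) c f =
  trans (cong (c * f x +_) (∑-distribˡ-* xs c f)) (sym (ℕ.*-distribˡ-+ c (f x) (∑ xs f)))

∑-const : ∀ (xs : List A) c → ∑ xs (λ _ → c) ≡ length xs * c
∑-const []       c = refl
∑-const (x ∷ xs) c = cong (c +_) (∑-const xs c)

length-≡-∑ : ∀ (xs : List A) → length xs ≡ ∑ xs (λ _ → 1)
length-≡-∑ xs = sym (trans (∑-const xs 1) (ℕ.*-identityʳ (length xs)))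

∑-swap : ∀ (xs : List A) (ys : List B) (f : A → B → ℕ) →
         ∑ xs (λ x → ∑ ys (f x)) ≡ ∑ ys (λ y → ∑ xs (λ x → f x y))
∑-swap []       ys f = sym (trans (∑-const ys 0) (ℕ.*-zeroʳ (length ys)))
∑-swap (x ∷ xs) ys f = trans (cong (∑ ys (f x) +_) (∑-swap xs ys f))
  (sym (∑-distrib-+ ys (f x) (λ y → ∑ xs (λ x → f x y))))

∑-concatMap : ∀ (xs : List A) (g : A → List B) f →
              ∑ (List.concatMap g xs) f ≡ ∑ xs (λ x → ∑ (g x) f)
∑-concatMap []       g f = refl
∑-concatMap (x ∷ xs) g f = trans (∑-++ (g x) (List.concatMap g xs) f)
  (cong (∑ (g x) f +_) (∑-concatMap xs g f))

∑-member : ∀ {xs : List A} {x} f → x ∈ xs → f x ≤ ∑ xs f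
∑-member {xs = x ∷ xs} f (here refl) = ℕ.m≤m+n (f x) (∑ xs f)
∑-member {xs = y ∷ xs} f (there x∈)  = ≤-trans (∑-member f x∈) (ℕ.m≤n+m (∑ xs f) (f y))

-- Sums over the permutations of a list

-- `insertions` and `permutations` with plain lists in place of `List⁺`, so that sums over them
-- unfold by recursion on the list.
placements : A → List A → List (List A)
placements x []      = (x ∷ []) ∷ []
placements x (a ∷ τ) = (x ∷ a ∷ τ) ∷ map (a ∷_) (placements x τ)

perms : List A → List (List A)
perms []       = [] ∷ []
perms (x ∷ xs) = List.concatMap (placements x) (perms xs)

toList-insertions : ∀ (x : A) τ → toList (insertions x τ) ≡ placements x τ
toList-insertions x []      = refl
toList-insertions x (a ∷ τ) = cong (λ ρ → (x ∷ a ∷ τ) ∷ map (a ∷_) ρ) (toList-insertions x τ)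

toList-permutations : ∀ (xs : List A) → toList (permutations xs) ≡ perms xs
toList-permutations []       = refl
toList-permutations (x ∷ xs) = begin
  toList (permutations (x ∷ xs))
    ≡⟨ List⁺.toList->>= (insertions x) (permutations xs) ⟨
  List.concatMap (toList ∘ insertions x) (toList (permutations xs))
    ≡⟨ List.concatMap-cong (toList-insertions x) (toList (permutations xs)) ⟩
  List.concatMap (placements x) (toList (permutations xs))
    ≡⟨ cong (List.concatMap (placements x)) (toList-permutations xs) ⟩
  perms (x ∷ xs) ∎
  where open ≡-Reasoning

∑-perms-∷ : ∀ (x : A) xs f → ∑ (perms (x ∷ xs)) f ≡ ∑ (perms xs) (λ τ → ∑ (placements x τ) f)
∑-perms-∷ x xs f = ∑-concatMap (perms xs) (placements x) f

∑-placements-∷ : ∀ (x a : A) zs f →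
  ∑ (placements x (a ∷ zs)) f ≡ f (x ∷ a ∷ zs) + ∑ (placements x zs) (f ∘ (a ∷_))
∑-placements-∷ x a zs f = cong (f (x ∷ a ∷ zs) +_) (∑-map (a ∷_) (placements x zs) f)

-- Both sides run over all lists that contain x and y in addition to zs; only the order of insertion
-- differs. The induction sorts these lists by which of x and y stand in front of a: both, one or
-- neither, the last class being the induction hypothesis.
∑-placements-swap : ∀ (x y : A) zs f →
  ∑ (placements y zs) (λ τ → ∑ (placements x τ) f) ≡ ∑ (placements x zs) (λ τ → ∑ (placements y τ) f)
∑-placements-swap x y []       f = lemma (f (x ∷ y ∷ [])) (f (y ∷ x ∷ []))
  where
  lemma : ∀ a b → a + (b + 0) + 0 ≡ b + (a + 0) + 0
  lemma = solve-∀
∑-placements-swap x y (a ∷ zs) f = begin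
  ∑ (placements y (a ∷ zs)) (λ τ → ∑ (placements x τ) f)
    ≡⟨ expand x y ⟩
  f (x ∷ y ∷ a ∷ zs) + (f (y ∷ x ∷ a ∷ zs) + I x y)
    + (I y x + ∑ (placements y zs) (λ τ → ∑ (placements x τ) (f ∘ (a ∷_))))
    ≡⟨ cong (λ s → f (x ∷ y ∷ a ∷ zs) + (f (y ∷ x ∷ a ∷ zs) + I x y) + (I y x + s))
         (∑-placements-swap x y zs (f ∘ (a ∷_))) ⟩
  f (x ∷ y ∷ a ∷ zs) + (f (y ∷ x ∷ a ∷ zs) + I x y)
    + (I y x + ∑ (placements x zs) (λ τ → ∑ (placements y τ) (f ∘ (a ∷_))))
    ≡⟨ lemma (f (x ∷ y ∷ a ∷ zs)) (f (y ∷ x ∷ a ∷ zs)) (I x y) (I y x) _ ⟩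
  f (y ∷ x ∷ a ∷ zs) + (f (x ∷ y ∷ a ∷ zs) + I y x)
    + (I x y + ∑ (placements x zs) (λ τ → ∑ (placements y τ) (f ∘ (a ∷_))))
    ≡⟨ expand y x ⟨
  ∑ (placements x (a ∷ zs)) (λ τ → ∑ (placements y τ) f) ∎
  where
  open ≡-Reasoning
  I : _ → _ → ℕ
  I x y = ∑ (placements x zs) (λ τ → f (y ∷ a ∷ τ))
  lemma : ∀ p q r s t → p + (q + r) + (s + t) ≡ q + (p + s) + (r + t)
  lemma = solve-∀
  expand : ∀ x y → ∑ (placements y (a ∷ zs)) (λ τ → ∑ (placements x τ) f) ≡
    f (x ∷ y ∷ a ∷ zs) + (f (y ∷ x ∷ a ∷ zs) + I x y)
      + (I y x + ∑ (placements y zs) (λ τ → ∑ (placements x τ) (f ∘ (a ∷_))))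
  expand x y = begin
    ∑ (placements y (a ∷ zs)) (λ τ → ∑ (placements x τ) f)
      ≡⟨ ∑-placements-∷ y a zs _ ⟩
    ∑ (placements x (y ∷ a ∷ zs)) f + ∑ (placements y zs) (λ τ → ∑ (placements x (a ∷ τ)) f)
      ≡⟨ cong₂ _+_
           (trans (∑-placements-∷ x y (a ∷ zs) f)
             (cong (f (x ∷ y ∷ a ∷ zs) +_) (∑-placements-∷ x a zs (f ∘ (y ∷_)))))
           (trans (∑-cong (placements y zs) (λ τ → ∑-placements-∷ x a τ f))
             (∑-distrib-+ (placements y zs) (λ τ → f (x ∷ a ∷ τ)) _)) ⟩
    f (x ∷ y ∷ a ∷ zs) + (f (y ∷ x ∷ a ∷ zs) + I x y)
      + (I y x + ∑ (placements y zs) (λ τ → ∑ (placements x τ) (f ∘ (a ∷_)))) ∎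

-- A swap of neighbours only changes which of the two is inserted last. The lemma lets any chosen
-- vertex be moved to the head, where `∑-perms-∷` inserts it last; it is also the source of the
-- symmetry in the triangular graph.
∑-perms-↭ : ∀ {xs ys : List A} → xs ↭ ys → ∀ f → ∑ (perms xs) f ≡ ∑ (perms ys) f
∑-perms-↭ Perm.refl f = refl
∑-perms-↭ {xs = x ∷ xs} {x ∷ ys} (Perm.prep x p) f =
  trans (∑-perms-∷ x xs f) (trans (∑-perms-↭ p _) (sym (∑-perms-∷ x ys f)))
∑-perms-↭ {xs = x ∷ y ∷ xs} {y ∷ x ∷ ys} (Perm.swap x y p) f = begin
  ∑ (perms (x ∷ y ∷ xs)) f                              ≡⟨ twice x y xs ⟩
  ∑ (perms xs) (λ τ → ∑ (placements y τ) λ σ → ∑ (placements x σ) f)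
    ≡⟨ ∑-perms-↭ p _ ⟩
  ∑ (perms ys) (λ τ → ∑ (placements y τ) λ σ → ∑ (placements x σ) f)
    ≡⟨ ∑-cong (perms ys) (λ τ → ∑-placements-swap x y τ f) ⟩
  ∑ (perms ys) (λ τ → ∑ (placements x τ) λ σ → ∑ (placements y σ) f)
    ≡⟨ twice y x ys ⟨
  ∑ (perms (y ∷ x ∷ ys)) f ∎
  where
  open ≡-Reasoning
  twice : ∀ x y xs → ∑ (perms (x ∷ y ∷ xs)) f ≡
          ∑ (perms xs) (λ τ → ∑ (placements y τ) λ σ → ∑ (placements x σ) f)
  twice x y xs = trans (∑-perms-∷ x (y ∷ xs) f) (∑-perms-∷ y xs _)
∑-perms-↭ (Perm.trans p q) f = trans (∑-perms-↭ p f) (∑-perms-↭ q f)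

∑-placements-map : ∀ (h : A → B) x τ f →
  ∑ (placements (h x) (map h τ)) f ≡ ∑ (placements x τ) (f ∘ map h)
∑-placements-map h x []      f = refl
∑-placements-map h x (a ∷ τ) f = begin
  ∑ (placements (h x) (h a ∷ map h τ)) f
    ≡⟨ ∑-placements-∷ (h x) (h a) (map h τ) f ⟩
  f (h x ∷ h a ∷ map h τ) + ∑ (placements (h x) (map h τ)) (f ∘ (h a ∷_))
    ≡⟨ cong (f (h x ∷ h a ∷ map h τ) +_) (∑-placements-map h x τ _) ⟩
  f (h x ∷ h a ∷ map h τ) + ∑ (placements x τ) (f ∘ map h ∘ (a ∷_))
    ≡⟨ ∑-placements-∷ x a τ (f ∘ map h) ⟨
  ∑ (placements x (a ∷ τ)) (f ∘ map h) ∎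
  where open ≡-Reasoning

∑-perms-map : ∀ (h : A → B) xs f → ∑ (perms (map h xs)) f ≡ ∑ (perms xs) (f ∘ map h)
∑-perms-map h []       f = refl
∑-perms-map h (x ∷ xs) f = begin
  ∑ (perms (h x ∷ map h xs)) f
    ≡⟨ ∑-perms-∷ (h x) (map h xs) f ⟩
  ∑ (perms (map h xs)) (λ τ → ∑ (placements (h x) τ) f)
    ≡⟨ ∑-perms-map h xs _ ⟩
  ∑ (perms xs) (λ τ → ∑ (placements (h x) (map h τ)) f)
    ≡⟨ ∑-cong (perms xs) (λ τ → ∑-placements-map h x τ f) ⟩
  ∑ (perms xs) (λ τ → ∑ (placements x τ) (f ∘ map h))
    ≡⟨ ∑-perms-∷ x xs (f ∘ map h) ⟨
  ∑ (perms (x ∷ xs)) (f ∘ map h) ∎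
  where open ≡-Reasoning

module _ {P : List A → Set} where

  All-concatMap : ∀ {g : C → List (List A)} (xs : List C) → (∀ {x} → x ∈ xs → All P (g x)) →
                 All P (List.concatMap g xs)
  All-concatMap []       h = []
  All-concatMap (x ∷ xs) h = All.++⁺ (h (here refl)) (All-concatMap xs (h ∘ there))

placements-↭ : ∀ (x : A) τ → All (_↭ x ∷ τ) (placements x τ)
placements-↭ x []      = Perm.refl ∷ []
placements-↭ x (a ∷ τ) = Perm.refl ∷ All.map⁺
  (All.map (λ p → Perm.trans (Perm.prep a p) (Perm.swap a x Perm.refl)) (placements-↭ x τ))

perms-↭ : ∀ (xs : List A) → All (_↭ xs) (perms xs)
perms-↭ []       = Perm.refl ∷ []
perms-↭ (x ∷ xs) = All-concatMap (perms xs) λ {τ} τ∈ →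
  All.map (λ p → Perm.trans p (Perm.prep x (All.lookup (perms-↭ xs) τ∈))) (placements-↭ x τ)

length-placements : ∀ (x : A) τ → length (placements x τ) ≡ suc (length τ)
length-placements x []      = refl
length-placements x (a ∷ τ) = cong suc
  (trans (List.length-map (a ∷_) (placements x τ)) (length-placements x τ))

length-perms : ∀ (xs : List A) → length (perms xs) ≡ length xs !
length-perms []       = refl
length-perms (x ∷ xs) = begin
  length (perms (x ∷ xs))                              ≡⟨ length-≡-∑ (perms (x ∷ xs)) ⟩
  ∑ (perms (x ∷ xs)) (λ _ → 1)                         ≡⟨ ∑-perms-∷ x xs _ ⟩
  ∑ (perms xs) (λ τ → ∑ (placements x τ) (λ _ → 1))
    ≡⟨ ∑-cong-∈ (perms xs) (λ {τ} τ∈ → trans (sym (length-≡-∑ (placements x τ)))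
         (trans (length-placements x τ) (cong suc (Perm.↭-length (All.lookup (perms-↭ xs) τ∈))))) ⟩
  ∑ (perms xs) (λ _ → suc (length xs))                 ≡⟨ ∑-const (perms xs) _ ⟩
  length (perms xs) * suc (length xs)                  ≡⟨ cong (_* suc (length xs)) (length-perms xs) ⟩
  (length xs !) * suc (length xs)                      ≡⟨ *-comm (length xs !) (suc (length xs)) ⟩
  suc (length xs) !                                    ∎
  where
  open ≡-Reasoning

-- Inserting each head at the far end reverses the list. This admits the decreasing arrival order of
-- the triangular graph.
reverse∈perms : ∀ (xs : List A) → List.reverse xs ∈ perms xs
reverse∈perms []       = here refl
reverse∈perms (x ∷ xs) = subst (_∈ perms (x ∷ xs)) (sym (List.unfold-reverse x xs))
  (∈-concatMap (reverse∈perms xs) (∷ʳ∈placements (List.reverse xs)))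
  where
  ∷ʳ∈placements : ∀ τ → τ List.∷ʳ x ∈ placements x τ
  ∷ʳ∈placements []      = here refl
  ∷ʳ∈placements (a ∷ τ) = there (Mem.∈-map⁺ (a ∷_) (∷ʳ∈placements τ))
  ∈-concatMap : ∀ {ρ τ xss} → τ ∈ xss → ρ ∈ placements x τ → ρ ∈ List.concatMap (placements x) xss
  ∈-concatMap τ∈ ρ∈ = Mem.∈-concatMap⁺ (placements x) (Any.map (λ {refl → ρ∈}) τ∈)

-- The greedy run behind RANKING

-- A list of at most one entry in place of a `Maybe`: sums and lengths over `matches` then split
-- along `++` without a case distinction.
choose : (A → Bool) → List A → List A
choose p []       = []
choose p (w ∷ ws) = if p w then [ w ] else choose p ws

remaining : (A → Bool) → List A → List A
remaining p []       = []
remaining p (w ∷ ws) = if p w then ws else w ∷ remaining p ws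

-- The free offline vertices are kept in rank order, so that the vertex of
-- minimum rank satisfying a condition is the first one.
matches : (B → A → Bool) → List B → List A → List (B × A)
matches adj []       ws = []
matches adj (u ∷ us) ws = map (u ,_) (choose (adj u) ws) ++ matches adj us (remaining (adj u) ws)

served : (B → A → Bool) → List B → List A → List B
served adj us ws = map proj₁ (matches adj us ws)

length-served : ∀ (adj : B → A → Bool) us ws → length (served adj us ws) ≡ length (matches adj us ws)
length-served adj us ws = List.length-map proj₁ (matches adj us ws)

length-choose≤1 : ∀ (p : A → Bool) ws → length (choose p ws) ≤ 1
length-choose≤1 p []       = z≤n
length-choose≤1 p (w ∷ ws) with p w
... | true  = ≤-refl
... | false = length-choose≤1 p ws

∑-choose-remaining : ∀ (p : A → Bool) ws ψ → ∑ (choose p ws) ψ + ∑ (remaining p ws) ψ ≡ ∑ ws ψ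
∑-choose-remaining p []       ψ = refl
∑-choose-remaining p (w ∷ ws) ψ with p w
... | true  = cong (_+ ∑ ws ψ) (ℕ.+-identityʳ (ψ w))
... | false = begin
  ∑ (choose p ws) ψ + (ψ w + ∑ (remaining p ws) ψ)
    ≡⟨ +-assoc (∑ (choose p ws) ψ) (ψ w) _ ⟨
  ∑ (choose p ws) ψ + ψ w + ∑ (remaining p ws) ψ
    ≡⟨ cong (_+ ∑ (remaining p ws) ψ) (+-comm (∑ (choose p ws) ψ) (ψ w)) ⟩
  ψ w + ∑ (choose p ws) ψ + ∑ (remaining p ws) ψ
    ≡⟨ +-assoc (ψ w) (∑ (choose p ws) ψ) _ ⟩
  ψ w + (∑ (choose p ws) ψ + ∑ (remaining p ws) ψ)
    ≡⟨ cong (ψ w +_) (∑-choose-remaining p ws ψ) ⟩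
  ψ w + ∑ ws ψ ∎
  where open ≡-Reasoning

∑-matches-∷ : ∀ (adj : B → A → Bool) u us ws φ →
  ∑ (matches adj (u ∷ us) ws) φ ≡
  ∑ (choose (adj u) ws) (λ w → φ (u , w)) + ∑ (matches adj us (remaining (adj u) ws)) φ
∑-matches-∷ adj u us ws φ = trans
  (∑-++ (map (u ,_) (choose (adj u) ws)) (matches adj us (remaining (adj u) ws)) φ)
  (cong (_+ ∑ (matches adj us (remaining (adj u) ws)) φ) (∑-map (u ,_) (choose (adj u) ws) φ))

∑-matches-offline≤ : ∀ (adj : B → A → Bool) us ws ψ → ∑ (matches adj us ws) (ψ ∘ proj₂) ≤ ∑ ws ψ
∑-matches-offline≤ adj []       ws ψ = z≤n
∑-matches-offline≤ adj (u ∷ us) ws ψ = begin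
  ∑ (matches adj (u ∷ us) ws) (ψ ∘ proj₂)
    ≡⟨ ∑-matches-∷ adj u us ws (ψ ∘ proj₂) ⟩
  ∑ (choose (adj u) ws) ψ + ∑ (matches adj us (remaining (adj u) ws)) (ψ ∘ proj₂)
    ≤⟨ +-monoʳ-≤ _ (∑-matches-offline≤ adj us (remaining (adj u) ws) ψ) ⟩
  ∑ (choose (adj u) ws) ψ + ∑ (remaining (adj u) ws) ψ
    ≡⟨ ∑-choose-remaining (adj u) ws ψ ⟩
  ∑ ws ψ ∎
  where open ℕ.≤-Reasoning

∑-matches-online≤ : ∀ (adj : B → A → Bool) us ws ψ → ∑ (matches adj us ws) (ψ ∘ proj₁) ≤ ∑ us ψ
∑-matches-online≤ adj []       ws ψ = z≤n
∑-matches-online≤ adj (u ∷ us) ws ψ = begin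
  ∑ (matches adj (u ∷ us) ws) (ψ ∘ proj₁)
    ≡⟨ ∑-matches-∷ adj u us ws (ψ ∘ proj₁) ⟩
  ∑ (choose (adj u) ws) (λ _ → ψ u) + ∑ (matches adj us (remaining (adj u) ws)) (ψ ∘ proj₁)
    ≡⟨ cong (_+ ∑ (matches adj us (remaining (adj u) ws)) (ψ ∘ proj₁))
         (∑-const (choose (adj u) ws) (ψ u)) ⟩
  length (choose (adj u) ws) * ψ u + ∑ (matches adj us (remaining (adj u) ws)) (ψ ∘ proj₁)
    ≤⟨ +-mono-≤ (ℕ.*-monoˡ-≤ (ψ u) (length-choose≤1 (adj u) ws))
         (∑-matches-online≤ adj us (remaining (adj u) ws) ψ) ⟩
  1 * ψ u + ∑ us ψ
    ≡⟨ cong (_+ ∑ us ψ) (ℕ.*-identityˡ (ψ u)) ⟩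
  ψ u + ∑ us ψ ∎
  where open ℕ.≤-Reasoning

choose-map : ∀ (h : C → A) (p : A → Bool) (q : C → Bool) ws → (∀ {w} → w ∈ ws → p (h w) ≡ q w) →
             choose p (map h ws) ≡ map h (choose q ws)
choose-map h p q []       p≗q = refl
choose-map h p q (w ∷ ws) p≗q rewrite p≗q (here refl) with q w
... | true  = refl
... | false = choose-map h p q ws (p≗q ∘ there)

remaining-map : ∀ (h : C → A) (p : A → Bool) (q : C → Bool) ws → (∀ {w} → w ∈ ws → p (h w) ≡ q w) →
                remaining p (map h ws) ≡ map h (remaining q ws)
remaining-map h p q []       p≗q = refl
remaining-map h p q (w ∷ ws) p≗q rewrite p≗q (here refl) with q w
... | true  = refl
... | false = cong (h w ∷_) (remaining-map h p q ws (p≗q ∘ there))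

remaining-⊆ : ∀ (p : A → Bool) ws → remaining p ws ⊆ ws
remaining-⊆ p (w ∷ ws) x∈ with p w
remaining-⊆ p (w ∷ ws) x∈           | true  = there x∈
remaining-⊆ p (w ∷ ws) (here refl)  | false = here refl
remaining-⊆ p (w ∷ ws) (there x∈)   | false = there (remaining-⊆ p ws x∈)

choose-⊆ : ∀ (p : A → Bool) ws → choose p ws ⊆ ws
choose-⊆ p (w ∷ ws) x∈ with p w
choose-⊆ p (w ∷ ws) (here refl) | true  = here refl
choose-⊆ p (w ∷ ws) x∈          | false = there (choose-⊆ p ws x∈)

choose-satisfies : ∀ (p : A → Bool) ws {w} → w ∈ choose p ws → p w ≡ true
choose-satisfies p (x ∷ ws) w∈ with p x in px
choose-satisfies p (x ∷ ws) (here refl) | true  = px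
choose-satisfies p (x ∷ ws) w∈          | false = choose-satisfies p ws w∈

matches-map : ∀ (g : D → B) (h : C → A) (adj : B → A → Bool) (adj′ : D → C → Bool) us ws →
  (∀ {u w} → u ∈ us → w ∈ ws → adj (g u) (h w) ≡ adj′ u w) →
  matches adj (map g us) (map h ws) ≡ map (λ (u , w) → g u , h w) (matches adj′ us ws)
matches-map g h adj adj′ []       ws eq = refl
matches-map g h adj adj′ (u ∷ us) ws eq = begin
  map (g u ,_) (choose (adj (g u)) (map h ws)) ++
  matches adj (map g us) (remaining (adj (g u)) (map h ws))
    ≡⟨ cong₂ (λ cs rs → map (g u ,_) cs ++ matches adj (map g us) rs)
         (choose-map h (adj (g u)) (adj′ u) ws (eq (here refl)))
         (remaining-map h (adj (g u)) (adj′ u) ws (eq (here refl))) ⟩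
  map (g u ,_) (map h cs) ++ matches adj (map g us) (map h rs)
    ≡⟨ cong₂ _++_ (trans (sym (List.map-∘ cs)) (List.map-∘ cs))
         (matches-map g h adj adj′ us rs λ u∈ w∈ → eq (there u∈) (remaining-⊆ (adj′ u) ws w∈)) ⟩
  map gh (map (u ,_) cs) ++ map gh (matches adj′ us rs)
    ≡⟨ List.map-++ gh (map (u ,_) cs) (matches adj′ us rs) ⟨
  map gh (map (u ,_) cs ++ matches adj′ us rs) ∎
  where
  open ≡-Reasoning
  gh = λ (u , w) → g u , h w
  cs = choose (adj′ u) ws
  rs = remaining (adj′ u) ws

matches-sound : ∀ (adj : B → A → Bool) us ws →
  All (λ (u , w) → u ∈ us × w ∈ ws × adj u w ≡ true) (matches adj us ws)
matches-sound adj []       ws = []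
matches-sound adj (u ∷ us) ws = All.++⁺
  (All.map⁺ (All.tabulate λ w∈ →
    here refl , choose-⊆ (adj u) ws w∈ , choose-satisfies (adj u) ws w∈))
  (All.map (λ (u∈ , w∈ , a) → there u∈ , remaining-⊆ (adj u) ws w∈ , a)
    (matches-sound adj us (remaining (adj u) ws)))

-- Greedy runs whose lists of free vertices differ in at most one entry.

infix 4 _⋖_

-- At most one entry is missing on the left. Two parallel runs keep this relation: when the right
-- one takes its extra vertex, the left one takes another vertex, which becomes the new extra one,
-- or takes none, and the lists agree from then on. This is the alternating path argument.
data _⋖_ {A : Set} : List A → List A → Set where
  same  : ∀ {ws} → ws ⋖ ws
  extra : ∀ {z ws} → ws ⋖ z ∷ ws
  cons  : ∀ {w ws ws′} → ws ⋖ ws′ → w ∷ ws ⋖ w ∷ ws′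

remaining-⋖ : ∀ (p : A → Bool) ws → remaining p ws ⋖ ws
remaining-⋖ p []       = same
remaining-⋖ p (w ∷ ws) with p w
... | true  = extra
... | false = cons (remaining-⋖ p ws)

⋖-remaining : ∀ (p : A → Bool) {ws ws′} → ws ⋖ ws′ → remaining p ws ⋖ remaining p ws′
⋖-remaining p same = same
⋖-remaining p (extra {z} {ws}) with p z
... | true  = remaining-⋖ p ws
... | false = extra
⋖-remaining p (cons {w} ws⋖) with p w
... | true  = ws⋖
... | false = cons (⋖-remaining p ws⋖)

⋖-length-choose : ∀ (p : A → Bool) {ws ws′} → ws ⋖ ws′ →
                  length (choose p ws) ≤ length (choose p ws′)
⋖-length-choose p same = ≤-refl
⋖-length-choose p (extra {z} {ws}) with p z
... | true  = length-choose≤1 p ws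
... | false = ≤-refl
⋖-length-choose p (cons {w} ws⋖) with p w
... | true  = ≤-refl
... | false = ⋖-length-choose p ws⋖

length-matches-∷ : ∀ (adj : B → A → Bool) u us ws → length (matches adj (u ∷ us) ws) ≡
  length (choose (adj u) ws) + length (matches adj us (remaining (adj u) ws))
length-matches-∷ adj u us ws = trans
  (List.length-++ (map (u ,_) (choose (adj u) ws)))
  (cong (_+ length (matches adj us (remaining (adj u) ws))) (List.length-map (u ,_) (choose (adj u) ws)))

⋖-length-matches : ∀ (adj : B → A → Bool) us {ws ws′} → ws ⋖ ws′ →
                   length (matches adj us ws) ≤ length (matches adj us ws′)
⋖-length-matches adj []       ws⋖ = z≤n
⋖-length-matches adj (u ∷ us) {ws} {ws′} ws⋖ = subst₂ _≤_
  (sym (length-matches-∷ adj u us ws)) (sym (length-matches-∷ adj u us ws′))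
  (+-mono-≤ (⋖-length-choose (adj u) ws⋖) (⋖-length-matches adj us (⋖-remaining (adj u) ws⋖)))

served-∷ : ∀ (adj : B → A → Bool) u us ws →
  served adj (u ∷ us) ws ≡ map (λ _ → u) (choose (adj u) ws) ++ served adj us (remaining (adj u) ws)
served-∷ adj u us ws = trans
  (List.map-++ proj₁ (map (u ,_) (choose (adj u) ws)) (matches adj us (remaining (adj u) ws)))
  (cong (_++ served adj us (remaining (adj u) ws)) (sym (List.map-∘ (choose (adj u) ws))))

⋖-served : ∀ (adj : B → A → Bool) us {ws ws′} → ws ⋖ ws′ → served adj us ws ⊆ served adj us ws′
⋖-served adj (u ∷ us) {ws} {ws′} ws⋖ {x} x∈
  with Mem.∈-++⁻ (map (λ _ → u) (choose (adj u) ws)) (subst (x ∈_) (served-∷ adj u us ws) x∈)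
... | inj₁ x∈₁ = subst (x ∈_) (sym (served-∷ adj u us ws′))
  (Mem.∈-++⁺ˡ (grow (choose (adj u) ws) (choose (adj u) ws′) (⋖-length-choose (adj u) ws⋖) x∈₁))
  where
  -- Both lists consist of copies of u, so inclusion is a matter of length.
  grow : ∀ (xs ys : List C) → length xs ≤ length ys → map (λ _ → u) xs ⊆ map (λ _ → u) ys
  grow (_ ∷ _)  (_ ∷ _)  _       (here refl) = here refl
  grow (_ ∷ xs) (_ ∷ ys) (s≤s l) (there y∈)  = there (grow xs ys l y∈)
... | inj₂ x∈₂ = subst (x ∈_) (sym (served-∷ adj u us ws′))
  (Mem.∈-++⁺ʳ (map (λ _ → u) (choose (adj u) ws′)) (⋖-served adj us (⋖-remaining (adj u) ws⋖) x∈₂))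

-- Insertion moves each entry of τ back by at most one place. The extra entry of the longer prefix
-- is v if v lands there, and the next entry of τ otherwise.
take-placements : ∀ (v : A) t τ → All (λ σ → take t τ ⋖ take (suc t) σ) (placements v τ)
take-placements v zero    []      = extra ∷ []
take-placements v (suc t) []      = extra ∷ []
take-placements v zero    (a ∷ τ) = extra ∷ All.map⁺ (All.map (λ _ → extra) (take-placements v zero τ))
take-placements v (suc t) (a ∷ τ) = extra ∷ All.map⁺ (All.map cons (take-placements v t τ))

-- The entry of last rank is taken only if no other entry qualifies. So appending v either leaves
-- the choice as it was, or makes v the choice, after which the two runs have the same free
-- vertices.
remaining-∷ʳ : ∀ (p : A → Bool) ws v →
  (choose p (ws ++ [ v ]) ≡ choose p ws × remaining p (ws ++ [ v ]) ≡ remaining p ws ++ [ v ]) ⊎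
  (choose p ws ≡ [] × choose p (ws ++ [ v ]) ≡ [ v ] × remaining p (ws ++ [ v ]) ≡ remaining p ws × p v ≡ true)
remaining-∷ʳ p []       v with p v
... | true  = inj₂ (refl , refl , refl , refl)
... | false = inj₁ (refl , refl)
remaining-∷ʳ p (w ∷ ws) v with p w
... | true  = inj₁ (refl , refl)
... | false with remaining-∷ʳ p ws v
...   | inj₁ (c , r)          = inj₁ (c , cong (w ∷_) r)
...   | inj₂ (c₀ , c , r , a) = inj₂ (c₀ , c , cong (w ∷_) r , a)

choose≡[] : ∀ (p : A → Bool) ws v → choose p (ws ++ [ v ]) ≡ choose p ws → p v ≡ true → choose p ws ≢ []
choose≡[] p []       v eq pv c rewrite pv with eq
... | ()
choose≡[] p (w ∷ ws) v eq pv c with p w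
choose≡[] p (w ∷ ws) v eq pv () | true
... | false = choose≡[] p ws v eq pv c

-- If u has not been served by the time it has passed, then v was still free
-- and adjacent to u, so it has been taken: appending v enlarges the matching.
length-matches-∷ʳ : ∀ (adj : B → A → Bool) {u} us ws v → u ∈ us → adj u v ≡ true → u ∉ served adj us ws →
                    suc (length (matches adj us ws)) ≤ length (matches adj us (ws ++ [ v ]))
length-matches-∷ʳ adj (x ∷ us) ws v u∈ uv u∉ with remaining-∷ʳ (adj x) ws v
... | inj₂ (c₀ , c , r , _) = ≤-reflexive (sym (trans (length-matches-∷ adj x us (ws ++ [ v ]))
  (trans (cong₂ (λ cs rs → length cs + length (matches adj us rs)) c r)
    (cong suc (sym (trans (length-matches-∷ adj x us ws)
      (cong (λ cs → length cs + length (matches adj us (remaining (adj x) ws))) c₀)))))))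
... | inj₁ (c , r) = begin
  suc (length (matches adj (x ∷ us) ws))
    ≡⟨ cong suc (length-matches-∷ adj x us ws) ⟩
  suc (length (choose (adj x) ws) + length (matches adj us (remaining (adj x) ws)))
    ≡⟨ ℕ.+-suc (length (choose (adj x) ws)) _ ⟨
  length (choose (adj x) ws) + suc (length (matches adj us (remaining (adj x) ws)))
    ≤⟨ +-monoʳ-≤ (length (choose (adj x) ws))
         (length-matches-∷ʳ adj us (remaining (adj x) ws) v (later u∈ uv u∉) uv
           (u∉ ∘ subst (_ ∈_) (sym (served-∷ adj x us ws)) ∘ Mem.∈-++⁺ʳ _)) ⟩
  length (choose (adj x) ws) + length (matches adj us (remaining (adj x) ws ++ [ v ]))
    ≡⟨ cong₂ (λ cs rs → length cs + length (matches adj us rs)) c r ⟨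
  length (choose (adj x) (ws ++ [ v ])) + length (matches adj us (remaining (adj x) (ws ++ [ v ])))
    ≡⟨ length-matches-∷ adj x us (ws ++ [ v ]) ⟨
  length (matches adj (x ∷ us) (ws ++ [ v ])) ∎
  where
  open ℕ.≤-Reasoning
  served-head : ∀ {xs : List C} {y : D} {zs} → xs ≢ [] → y ∈ map (λ _ → y) xs ++ zs
  served-head {xs = []}    xs≢ = contradiction refl xs≢
  served-head {xs = _ ∷ _} xs≢ = here refl
  later : ∀ {u} → u ∈ x ∷ us → adj u v ≡ true → u ∉ served adj (x ∷ us) ws → u ∈ us
  later (there u∈)  _  _  = u∈
  later (here refl) uv u∉ = contradiction
    (subst (x ∈_) (sym (served-∷ adj x us ws)) (served-head (choose≡[] (adj x) ws v c uv))) u∉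

-- Indicators, insertion at a given place, and the lower bound.

𝟙 : {P : Set} → Dec P → ℕ
𝟙 P? = if does P? then 1 else 0

𝟙-yes : ∀ {P : Set} (P? : Dec P) → P → 𝟙 P? ≡ 1
𝟙-yes P? p = cong (if_then 1 else 0) (dec-true P? p)

∑-𝟙 : ∀ {P : A → Set} (P? : ∀ x → Dec (P x)) xs → ∑ xs (𝟙 ∘ P?) ≡ length (List.filter P? xs)
∑-𝟙 P? []       = refl
∑-𝟙 P? (x ∷ xs) with does (P? x)
... | true  = cong suc (∑-𝟙 P? xs)
... | false = ∑-𝟙 P? xs

∑-𝟙≤length : ∀ {P : A → Set} (P? : ∀ x → Dec (P x)) {xs} → Unique xs →
             ∀ ys → (∀ {x} → P x → x ∈ ys) → ∑ xs (𝟙 ∘ P?) ≤ length ys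
∑-𝟙≤length P? {xs} uniq ys P⇒∈ = subst (_≤ length ys) (sym (∑-𝟙 P? xs))
  (unique-⊆⇒length≤ (Unique.filter⁺ P? uniq) (P⇒∈ ∘ proj₂ ∘ Mem.∈-filter⁻ P? {xs = xs}))

∈⇒↭∷ : ∀ {x : A} {xs} → x ∈ xs → ∃ λ ys → xs ↭ x ∷ ys
∈⇒↭∷ {x = x} x∈ with Mem.∈-∃++ x∈
... | as , bs , refl = as ++ bs , Perm.shift x as bs

insertAt : ℕ → A → List A → List A
insertAt t v τ = take t τ ++ v ∷ drop t τ

insertAt∈placements : ∀ t (v : A) τ → insertAt t v τ ∈ placements v τ
insertAt∈placements zero    v []      = here refl
insertAt∈placements zero    v (a ∷ τ) = here refl
insertAt∈placements (suc t) v []      = here refl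
insertAt∈placements (suc t) v (a ∷ τ) = there (Mem.∈-map⁺ (a ∷_) (insertAt∈placements t v τ))

take-insertAt : ∀ t (v : A) τ → t ≤ length τ → take t (insertAt t v τ) ≡ take t τ
take-insertAt zero    v τ       _       = refl
take-insertAt (suc t) v (a ∷ τ) (s≤s l) = cong (a ∷_) (take-insertAt t v τ l)

take-suc-insertAt : ∀ t (v : A) τ → t ≤ length τ → take (suc t) (insertAt t v τ) ≡ take t τ ++ [ v ]
take-suc-insertAt zero    v τ       _       = refl
take-suc-insertAt (suc t) v (a ∷ τ) (s≤s l) = cong (a ∷_) (take-suc-insertAt t v τ l)

drop-insertAt : ∀ t (v : A) τ → t ≤ length τ → drop t (insertAt t v τ) ≡ v ∷ drop t τ
drop-insertAt zero    v τ       _       = refl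
drop-insertAt (suc t) v (a ∷ τ) (s≤s l) = drop-insertAt t v τ l

take-⋖ : ∀ t (σ : List A) → take t σ ⋖ take (suc t) σ
take-⋖ zero    []      = same
take-⋖ zero    (x ∷ σ) = extra
take-⋖ (suc t) []      = same
take-⋖ (suc t) (x ∷ σ) = cons (take-⋖ t σ)

-- Offline and online vertices take their names from one type, and partners share a name. Thus v in
-- `hit ws v` is the online partner of the offline vertex v in `occupies t σ v`.
module LowerBound
  (_≟_ : DecidableEquality A) (adj : A → A → Bool) (us V vs : List A)
  (vs-unique : Unique vs) (vs⊆V : vs ⊆ V) (vs⊆us : vs ⊆ us)
  (matching : ∀ {v} → v ∈ vs → adj v v ≡ true)
  where

  open DecMembership _≟_ using (_∈?_)

  N F : ℕ
  N = length V
  F = length (perms V)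

  size : List A → ℕ
  size ws = length (matches adj us ws)

  gain : ℕ → List A → ℕ
  gain t σ = size (take (suc t) σ) ∸ size (take t σ)

  -- Places count from 0 here. The sum over at most one entry gives the value 0 when σ has no place
  -- t.
  occupies : ℕ → List A → A → ℕ
  occupies t σ v = ∑ (take 1 (drop t σ)) (λ w → 𝟙 (v ≟ w))

  hit : List A → A → ℕ
  hit ws u = 𝟙 (u ∈? served adj us ws)

  -- The weights balance the two cases of `N≤∑-charge`. If the partner of v is served by the first t
  -- entries of τ, each of the N placements of v is charged 1 through `hit`; otherwise the single
  -- placement at t is charged N, because there v enlarges the matching.
  charge : ℕ → A → List A → ℕ
  charge t v σ = N * (occupies t σ v * gain t σ) + hit (take (suc t) σ) v

  N≤∑-charge : ∀ t {v τ} → v ∈ vs → N ≡ suc (length τ) → t ≤ length τ →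
               N ≤ ∑ (placements v τ) (charge t v)
  N≤∑-charge t {v} {τ} v∈ N≡ t≤ with v ∈? served adj us (take t τ)
  ... | yes v∈served = begin
    N                                      ≡⟨ trans N≡ (sym (length-placements v τ)) ⟩
    length (placements v τ)                ≡⟨ length-≡-∑ (placements v τ) ⟩
    ∑ (placements v τ) (λ _ → 1)
      ≤⟨ ∑-mono-∈ (placements v τ) (λ {σ} σ∈ → ≤-trans
           (≤-reflexive (sym (𝟙-yes (v ∈? served adj us (take (suc t) σ))
             (⋖-served adj us (All.lookup (take-placements v t τ) σ∈) v∈served))))
           (ℕ.m≤n+m _ (N * (occupies t σ v * gain t σ)))) ⟩
    ∑ (placements v τ) (charge t v)        ∎
    where open ℕ.≤-Reasoning
  ... | no  v∉served = begin
    N                                      ≡⟨ ℕ.*-identityʳ N ⟨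
    N * (1 * 1)                            ≤⟨ ℕ.*-monoʳ-≤ N (ℕ.*-mono-≤ 1≤occupies 1≤gain) ⟩
    N * (occupies t σ v * gain t σ)        ≤⟨ ℕ.m≤m+n _ (hit (take (suc t) σ) v) ⟩
    charge t v σ                           ≤⟨ ∑-member (charge t v) (insertAt∈placements t v τ) ⟩
    ∑ (placements v τ) (charge t v)        ∎
    where
    open ℕ.≤-Reasoning
    σ = insertAt t v τ
    1≤occupies : 1 ≤ occupies t σ v
    1≤occupies rewrite drop-insertAt t v τ t≤ | 𝟙-yes (v ≟ v) refl = s≤s z≤n
    1≤gain : 1 ≤ gain t σ
    1≤gain rewrite take-suc-insertAt t v τ t≤ | take-insertAt t v τ t≤ =
      ℕ.m<n⇒0<n∸m (length-matches-∷ʳ adj us (take t τ) v (vs⊆us v∈) (matching v∈) v∉served)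

  F≤∑-charge : ∀ t {v} → v ∈ vs → t ℕ.< N → F ≤ ∑ (perms V) (charge t v)
  -- With v at the head, the orders fall into groups of N: the placements of v into one order τ of
  -- the other vertices.
  F≤∑-charge t {v} v∈ t<N with ∈⇒↭∷ (vs⊆V v∈)
  ... | V′ , V↭ = begin
    F                                      ≡⟨ trans (length-≡-∑ (perms V)) (∑-perms-↭ V↭ _) ⟩
    ∑ (perms (v ∷ V′)) (λ _ → 1)           ≡⟨ ∑-perms-∷ v V′ _ ⟩
    ∑ (perms V′) (λ τ → ∑ (placements v τ) (λ _ → 1))
      ≤⟨ ∑-mono-∈ (perms V′) (λ {τ} τ∈ → bound τ (Perm.↭-length (All.lookup (perms-↭ V′) τ∈))) ⟩
    ∑ (perms V′) (λ τ → ∑ (placements v τ) (charge t v))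
      ≡⟨ ∑-perms-∷ v V′ _ ⟨
    ∑ (perms (v ∷ V′)) (charge t v)        ≡⟨ ∑-perms-↭ V↭ _ ⟨
    ∑ (perms V) (charge t v)               ∎
    where
    open ℕ.≤-Reasoning
    N≡ : N ≡ suc (length V′)
    N≡ = Perm.↭-length V↭
    bound : ∀ τ → length τ ≡ length V′ →
            ∑ (placements v τ) (λ _ → 1) ≤ ∑ (placements v τ) (charge t v)
    bound τ |τ| = subst (_≤ ∑ (placements v τ) (charge t v))
      (trans N≡τ (trans (sym (length-placements v τ)) (length-≡-∑ (placements v τ))))
      (N≤∑-charge t {τ = τ} v∈ N≡τ (ℕ.s≤s⁻¹ (subst (suc t ≤_) N≡τ t<N)))
      where
      N≡τ : N ≡ suc (length τ)
      N≡τ = trans N≡ (cong suc (sym |τ|))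

  ∑-occupies≤1 : ∀ t σ → ∑ vs (occupies t σ) ≤ 1
  ∑-occupies≤1 t σ = begin
    ∑ vs (λ v → ∑ ws (λ w → 𝟙 (v ≟ w)))    ≡⟨ ∑-swap vs ws _ ⟩
    ∑ ws (λ w → ∑ vs (λ v → 𝟙 (v ≟ w)))
      ≤⟨ ∑-mono ws (λ w → ∑-𝟙≤length (_≟ w) vs-unique [ w ] (λ {refl → here refl})) ⟩
    ∑ ws (λ _ → 1)                         ≡⟨ length-≡-∑ ws ⟨
    length ws                              ≡⟨ List.length-take 1 (drop t σ) ⟩
    1 ℕ.⊓ length (drop t σ)                ≤⟨ ℕ.m⊓n≤m 1 _ ⟩
    1                                      ∎
    where
    open ℕ.≤-Reasoning
    ws = take 1 (drop t σ)

  ∑-hit≤size : ∀ ws → ∑ vs (hit ws) ≤ size ws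
  ∑-hit≤size ws = subst (∑ vs (hit ws) ≤_) (length-served adj us ws)
    (∑-𝟙≤length (_∈? served adj us ws) vs-unique (served adj us ws) id)

  -- In a fixed order at most one vertex stands at place t, so the gain is counted at most once; the
  -- vertices counted by `hit` are distinct and served.
  ∑-charge≤ : ∀ t σ → ∑ vs (λ v → charge t v σ) + N * size (take t σ) ≤ suc N * size (take (suc t) σ)
  ∑-charge≤ t σ = begin
    ∑ vs (λ v → charge t v σ) + N * size (take t σ)
      ≡⟨ cong (_+ N * size (take t σ)) (∑-distrib-+ vs (λ v → N * (occupies t σ v * gain t σ)) _) ⟩
    ∑ vs (λ v → N * (occupies t σ v * gain t σ)) + ∑ vs (hit (take (suc t) σ)) + N * size (take t σ)
      ≤⟨ +-monoˡ-≤ (N * size (take t σ)) (+-mono-≤ occupied (∑-hit≤size (take (suc t) σ))) ⟩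
    N * gain t σ + size (take (suc t) σ) + N * size (take t σ)
      ≡⟨ lemma N (gain t σ) (size (take (suc t) σ)) (size (take t σ)) ⟩
    size (take (suc t) σ) + N * (gain t σ + size (take t σ))
      -- The truncated subtraction in `gain` is a true one, since a longer prefix never serves fewer
      -- vertices.
      ≡⟨ cong (λ s → size (take (suc t) σ) + N * s)
           (ℕ.m∸n+n≡m (⋖-length-matches adj us (take-⋖ t σ))) ⟩
    suc N * size (take (suc t) σ) ∎
    where
    open ℕ.≤-Reasoning
    lemma : ∀ N g s s₀ → N * g + s + N * s₀ ≡ s + N * (g + s₀)
    lemma = solve-∀
    occupied : ∑ vs (λ v → N * (occupies t σ v * gain t σ)) ≤ N * gain t σ
    occupied = begin
      ∑ vs (λ v → N * (occupies t σ v * gain t σ))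
        ≡⟨ ∑-cong vs (λ v → rearrange N (occupies t σ v) (gain t σ)) ⟩
      ∑ vs (λ v → N * gain t σ * occupies t σ v)
        ≡⟨ ∑-distribˡ-* vs (N * gain t σ) (occupies t σ) ⟩
      N * gain t σ * ∑ vs (occupies t σ)
        ≤⟨ ℕ.*-monoʳ-≤ (N * gain t σ) (∑-occupies≤1 t σ) ⟩
      N * gain t σ * 1
        ≡⟨ ℕ.*-identityʳ (N * gain t σ) ⟩
      N * gain t σ ∎
      where
      rearrange : ∀ N o g → N * (o * g) ≡ N * g * o
      rearrange = solve-∀

  Y : ℕ → ℕ
  Y t = ∑ (perms V) (size ∘ take t)

  Y-recurrence : ∀ t → t ℕ.< N → length vs * F + N * Y t ≤ suc N * Y (suc t)
  Y-recurrence t t<N = begin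
    length vs * F + N * Y t
      ≡⟨ cong (_+ N * Y t) (∑-const vs F) ⟨
    ∑ vs (λ _ → F) + N * Y t
      ≤⟨ +-monoˡ-≤ (N * Y t) (∑-mono-∈ vs (λ v∈ → F≤∑-charge t v∈ t<N)) ⟩
    ∑ vs (λ v → ∑ (perms V) (charge t v)) + N * Y t
      ≡⟨ cong₂ _+_ (∑-swap vs (perms V) (charge t)) (sym (∑-distribˡ-* (perms V) N (size ∘ take t))) ⟩
    ∑ (perms V) (λ σ → ∑ vs (λ v → charge t v σ)) + ∑ (perms V) (λ σ → N * size (take t σ))
      ≡⟨ ∑-distrib-+ (perms V) (λ σ → ∑ vs (λ v → charge t v σ)) _ ⟨
    ∑ (perms V) (λ σ → ∑ vs (λ v → charge t v σ) + N * size (take t σ))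
      ≤⟨ ∑-mono (perms V) (∑-charge≤ t) ⟩
    ∑ (perms V) (λ σ → suc N * size (take (suc t) σ))
      ≡⟨ ∑-distribˡ-* (perms V) (suc N) (size ∘ take (suc t)) ⟩
    suc N * Y (suc t) ∎
    where open ℕ.≤-Reasoning

  -- By `Y-recurrence`, each step multiplies the deficit length vs * F - Y t by at most N / (N + 1),
  -- and at t = 0 it is at most length vs * F. Denominators and subtractions have been cleared.
  Y-lower-bound : ∀ t → t ≤ N →
    suc N ^ t * (length vs * F) ≤ suc N ^ t * Y t + N ^ t * (length vs * F)
  Y-lower-bound zero    _   = ℕ.m≤n+m (1 * (length vs * F)) (1 * Y 0)
  Y-lower-bound (suc t) t<N = begin
    suc N ^ suc t * G
      ≡⟨ lemma₁ N (suc N ^ t) G ⟩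
    N * (suc N ^ t * G) + suc N ^ t * G
      ≤⟨ +-monoˡ-≤ (suc N ^ t * G) (ℕ.*-monoʳ-≤ N (Y-lower-bound t (ℕ.<⇒≤ t<N))) ⟩
    N * (suc N ^ t * Y t + N ^ t * G) + suc N ^ t * G
      ≡⟨ lemma₂ N (suc N ^ t) (Y t) (N ^ t) G ⟩
    suc N ^ t * (G + N * Y t) + N ^ suc t * G
      ≤⟨ +-monoˡ-≤ (N ^ suc t * G) (ℕ.*-monoʳ-≤ (suc N ^ t) (Y-recurrence t t<N)) ⟩
    suc N ^ t * (suc N * Y (suc t)) + N ^ suc t * G
      ≡⟨ cong (_+ N ^ suc t * G) (lemma₃ N (suc N ^ t) (Y (suc t))) ⟩
    suc N ^ suc t * Y (suc t) + N ^ suc t * G ∎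
    where
    open ℕ.≤-Reasoning
    G = length vs * F
    lemma₁ : ∀ N p G → (p + N * p) * G ≡ N * (p * G) + p * G
    lemma₁ = solve-∀
    lemma₂ : ∀ N p y q G → N * (p * y + q * G) + p * G ≡ p * (G + N * y) + N * q * G
    lemma₂ = solve-∀
    lemma₃ : ∀ N p y → p * (y + N * y) ≡ (p + N * p) * y
    lemma₃ = solve-∀

  ∑-size-lower-bound :
    suc N ^ N * (length vs * F) ≤ suc N ^ N * ∑ (perms V) size + N ^ N * (length vs * F)
  ∑-size-lower-bound = ≤-trans (Y-lower-bound N ≤-refl)
    (+-monoˡ-≤ (N ^ N * (length vs * F)) (ℕ.*-monoʳ-≤ (suc N ^ N)
      (∑-mono-∈ (perms V) λ {σ} σ∈ → ≤-reflexive (cong size (List.take-all N σ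
        (≤-reflexive (Perm.↭-length (All.lookup (perms-↭ V) σ∈))))))))

-- The linear program for the upper bound.

∑-upTo-suc : ∀ a f → ∑ (upTo (suc a)) f ≡ ∑ (upTo a) f + f a
∑-upTo-suc a f = trans (cong (λ xs → ∑ xs f) (sym (List.upTo-∷ʳ a)))
  (trans (∑-++ (upTo a) [ a ] f) (cong (∑ (upTo a) f +_) (ℕ.+-identityʳ (f a))))

-- The linear program bounding ∑ (l + 1) y_l: the dual solution gives weight c
-- to ∑ y_l ≤ F and weight 1 − c / (l + 1) to (l + 1) y_l ≤ F for l ≥ c.  With
-- c = k ^ k and n = (k + 1) ^ k the range from c to n consists of k blocks
-- whose end points are in ratio k + 1 : k, and 1 − c / (l + 1) is replaced by its
-- value at the end of the block containing l.
module LinearProgram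
  (n F : ℕ) (y : ℕ → ℕ) (y≤ : ∀ {l} → l ℕ.< n → suc l * y l ≤ F)
  where

  total weighted : ℕ → ℕ
  total a    = ∑ (upTo a) y
  weighted a = ∑ (upTo a) (λ l → suc l * y l)

  -- Put θ = c / b and split (l + 1) y_l into its θ-fold and its (1 - θ)-fold. The bound l + 1 ≤ b
  -- makes the first at most c y_l, and `y≤` makes the second at most (1 - θ) F.
  weight : ∀ {b c l} → c ≤ b → suc l ≤ b → l ℕ.< n →
           b * (suc l * y l) + c * F ≤ b * c * y l + b * F
  weight {b} {c} {l} c≤b l<b l<n with ℕ.m≤n⇒∃[o]m+o≡n c≤b
  ... | h , refl = begin
    (c + h) * (suc l * y l) + c * F
      ≡⟨ lemma₁ c h (suc l) (y l) F ⟩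
    c * y l * suc l + h * (suc l * y l) + c * F
      ≤⟨ +-monoˡ-≤ (c * F) (+-mono-≤ (ℕ.*-monoʳ-≤ (c * y l) l<b) (ℕ.*-monoʳ-≤ h (y≤ l<n))) ⟩
    c * y l * (c + h) + h * F + c * F
      ≡⟨ lemma₂ c h (y l) F ⟩
    (c + h) * c * y l + (c + h) * F ∎
    where
    open ℕ.≤-Reasoning
    lemma₁ : ∀ c h x y F → (c + h) * (x * y) + c * F ≡ c * y * x + h * (x * y) + c * F
    lemma₁ = solve-∀
    lemma₂ : ∀ c h y F → c * y * (c + h) + h * F + c * F ≡ (c + h) * c * y + (c + h) * F
    lemma₂ = solve-∀

  -- `weight` summed over a ≤ l < a + j, with the sums up to a moved across to avoid subtraction.
  steps : ∀ {b c} a j → c ≤ b → a + j ≤ b → b ≤ n →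
    b * weighted (a + j) + j * (c * F) + b * c * total a ≤
    b * weighted a + b * c * total (a + j) + j * (b * F)
  steps {b} {c} a zero c≤b a≤b b≤n rewrite ℕ.+-identityʳ a =
    ≤-reflexive (lemma (b * weighted a) (b * c * total a))
    where
    lemma : ∀ x y → x + 0 + y ≡ x + y + 0
    lemma = solve-∀
  steps {b} {c} a (suc j) c≤b a+j<b b≤n rewrite ℕ.+-suc a j
    | ∑-upTo-suc (a + j) y | ∑-upTo-suc (a + j) (λ l → suc l * y l) = begin
    b * (weighted l + suc l * y l) + (c * F + j * (c * F)) + b * c * total a
      ≡⟨ lemma₁ b (weighted l) (suc l * y l) (c * F) (j * (c * F)) (b * c * total a) ⟩
    (b * weighted l + j * (c * F) + b * c * total a) + (b * (suc l * y l) + c * F)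
      ≤⟨ +-mono-≤ (steps a j c≤b (ℕ.<⇒≤ a+j<b) b≤n) (weight c≤b a+j<b (≤-trans a+j<b b≤n)) ⟩
    (b * weighted a + b * c * total l + j * (b * F)) + (b * c * y l + b * F)
      ≡⟨ lemma₂ (b * weighted a) (b * c) (total l) (y l) (j * (b * F)) (b * F) ⟩
    b * weighted a + b * c * (total l + y l) + (b * F + j * (b * F)) ∎
    where
    open ℕ.≤-Reasoning
    l = a + j
    lemma₁ : ∀ b w x y z s → b * (w + x) + (y + z) + s ≡ (b * w + z + s) + (b * x + y)
    lemma₁ = solve-∀
    lemma₂ : ∀ w c t x y z → (w + c * t + y) + (c * x + z) ≡ w + c * (t + x) + (z + y)
    lemma₂ = solve-∀

  -- The d terms of a block ending at b = (k + 1) d each save (c / b) F, altogether c F / (k + 1).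
  -- This does not depend on d, so every block saves the same.
  block : ∀ {c} k d .{{_ : NonZero d}} → c ≤ d + k * d → d + k * d ≤ n →
    suc k * weighted (d + k * d) + c * F + suc k * c * total (k * d) ≤
    suc k * weighted (k * d) + suc k * c * total (d + k * d) + suc k * d * F
  block {c} k d c≤b b≤n = ℕ.*-cancelˡ-≤ d (begin
    d * (suc k * weighted b + c * F + suc k * c * total a)
      ≡⟨ lemma₁ d k (weighted b) (c * F) c (total a) ⟩
    b * weighted b + d * (c * F) + b * c * total a
      ≡⟨ cong (λ x → b * weighted x + d * (c * F) + b * c * total a) (+-comm d a) ⟩
    b * weighted (a + d) + d * (c * F) + b * c * total a
      ≤⟨ steps a d c≤b (≤-reflexive (+-comm a d)) b≤n ⟩
    b * weighted a + b * c * total (a + d) + d * (b * F)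
      ≡⟨ cong (λ x → b * weighted a + b * c * total x + d * (b * F)) (+-comm a d) ⟩
    b * weighted a + b * c * total b + d * (b * F)
      ≡⟨ lemma₂ d k (weighted a) c (total b) F ⟩
    d * (suc k * weighted a + suc k * c * total b + suc k * d * F) ∎)
    where
    open ℕ.≤-Reasoning
    a = k * d
    b = d + k * d
    lemma₁ : ∀ d k w y c t → d * ((w + k * w) + y + (c + k * c) * t) ≡
             (d + k * d) * w + d * y + (d + k * d) * c * t
    lemma₁ = solve-∀
    lemma₂ : ∀ d k w c t F → (d + k * d) * w + (d + k * d) * c * t + d * ((d + k * d) * F) ≡
             d * ((w + k * w) + (c + k * c) * t + (d + k * d) * F)
    lemma₂ = solve-∀

  -- Each block adds c F / (k + 1) to the saving. The base case uses only l + 1 ≤ c, that is,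
  -- multiplier 0 for the constraints (l + 1) y_l ≤ F. The term `suc k * c * F` on the left is there
  -- to absorb `total n ≤ F` in `weighted-bound`.
  blocks : ∀ k .{{_ : NonZero k}} → suc k ^ k ≡ n → ∀ j r → j + r ≡ k →
    let a = suc k ^ j * k ^ r ; c = k ^ k in
    c ≤ a ×
    suc k * weighted a + suc k * c * F + j * (c * F) ≤ suc k * (c * total a + a * F)
  blocks k n≡ zero r refl rewrite ℕ.+-identityʳ (k ^ k) = ≤-refl , (begin
    suc k * weighted c + suc k * c * F + 0
      ≡⟨ lemma (suc k) (weighted c) c F ⟩
    suc k * (weighted c + c * F)
      ≤⟨ ℕ.*-monoʳ-≤ (suc k) (+-monoˡ-≤ (c * F) weighted≤) ⟩
    suc k * (c * total c + c * F) ∎)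
    where
    open ℕ.≤-Reasoning
    c = k ^ k
    lemma : ∀ k w c F → k * w + k * c * F + 0 ≡ k * (w + c * F)
    lemma = solve-∀
    weighted≤ : weighted c ≤ c * total c
    weighted≤ = ≤-trans (∑-mono-∈ (upTo c) λ {l} l∈ → ℕ.*-monoˡ-≤ (y l) (Mem.∈-upTo⁻ l∈))
      (≤-reflexive (∑-distribˡ-* (upTo c) c y))
  blocks k n≡ (suc j) r j+r≡k with blocks k n≡ j (suc r) (trans (ℕ.+-suc j r) j+r≡k)
  ... | c≤ , ih = subst Claim (sym b≡) (c≤b , ℕ.+-cancelʳ-≤ (suc k * c * total a) _ _ (begin
    suc k * weighted b + suc k * c * F + suc j * (c * F) + suc k * c * total a
      ≡⟨ lemma₁ (suc k * weighted b) (suc k * c * F) (j * (c * F)) (c * F) (suc k * c * total a) ⟩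
    (suc k * weighted b + c * F + suc k * c * total a) + (suc k * c * F + j * (c * F))
      ≤⟨ +-monoˡ-≤ _ (block k d {{d-nonZero}} c≤b b≤n) ⟩
    (suc k * weighted a + suc k * c * total b + suc k * d * F) + (suc k * c * F + j * (c * F))
      ≡⟨ lemma₂ (suc k * weighted a) (suc k * c * total b) (suc k * d * F) (suc k * c * F) (j * (c * F)) ⟩
    (suc k * weighted a + suc k * c * F + j * (c * F)) + (suc k * c * total b + suc k * d * F)
      ≤⟨ +-monoˡ-≤ _ (proj₂ (subst Claim′ a≡ (c≤ , ih))) ⟩
    suc k * (c * total a + a * F) + (suc k * c * total b + suc k * d * F)
      ≡⟨ lemma₃ (suc k) c (total a) a F (total b) d ⟩
    suc k * (c * total b + (d + a) * F) + suc k * c * total a ∎))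
    where
    open ℕ.≤-Reasoning
    c = k ^ k
    -- Starting from c = k ^ k, each block trades one factor k of its end point for k + 1; d is what
    -- both end points share, so they stay integers.
    d = suc k ^ j * k ^ r
    a = k * d
    b = d + k * d
    Claim Claim′ : ℕ → Set
    Claim a  = c ≤ a × suc k * weighted a + suc k * c * F + suc j * (c * F) ≤ suc k * (c * total a + a * F)
    Claim′ a = c ≤ a × suc k * weighted a + suc k * c * F + j * (c * F) ≤ suc k * (c * total a + a * F)
    d-nonZero : NonZero d
    d-nonZero = ℕ.m*n≢0 (suc k ^ j) (k ^ r) {{ℕ.m^n≢0 (suc k) j}} {{ℕ.m^n≢0 k r}}
    a≡ : suc k ^ j * k ^ suc r ≡ a
    a≡ = lemma (suc k ^ j) k (k ^ r)
      where
      lemma : ∀ p k q → p * (k * q) ≡ k * (p * q)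
      lemma = solve-∀
    b≡ : suc k ^ suc j * k ^ r ≡ b
    b≡ = *-assoc (suc k) (suc k ^ j) (k ^ r)
    c≤b : c ≤ b
    c≤b = ≤-trans (subst (c ≤_) a≡ c≤) (ℕ.m≤n+m a d)
    b≤n : b ≤ n
    b≤n = begin
      b                       ≡⟨ b≡ ⟨
      suc k ^ suc j * k ^ r   ≤⟨ ℕ.*-monoʳ-≤ (suc k ^ suc j) (ℕ.^-monoˡ-≤ r (ℕ.n≤1+n k)) ⟩
      suc k ^ suc j * suc k ^ r ≡⟨ ℕ.^-distribˡ-+-* (suc k) (suc j) r ⟨
      suc k ^ (suc j + r)     ≡⟨ trans (cong (suc k ^_) j+r≡k) n≡ ⟩
      n                       ∎
    lemma₁ : ∀ w y z v t → w + y + (v + z) + t ≡ (w + v + t) + (y + z)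
    lemma₁ = solve-∀
    lemma₂ : ∀ w t d y z → (w + t + d) + (y + z) ≡ (w + y + z) + (t + d)
    lemma₂ = solve-∀
    lemma₃ : ∀ k c s a F t d → k * (c * s + a * F) + (k * c * t + k * d * F) ≡
             k * (c * t + (d + a) * F) + k * c * s
    lemma₃ = solve-∀

  weighted-bound : ∀ k .{{_ : NonZero k}} → suc k ^ k ≡ n → total n ≤ F →
                   suc k * weighted n + k * (k ^ k * F) ≤ suc k * (n * F)
  weighted-bound k n≡ total≤F = ℕ.+-cancelˡ-≤ (suc k * c * F) _ _ (begin
    suc k * c * F + (suc k * weighted n + k * (c * F))
      ≡⟨ lemma₁ (suc k * c * F) (suc k * weighted n) (k * (c * F)) ⟩
    suc k * weighted n + suc k * c * F + k * (c * F)
      ≤⟨ subst (λ a → suc k * weighted a + suc k * c * F + k * (c * F) ≤ suc k * (c * total a + a * F))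
           (trans (ℕ.*-identityʳ (suc k ^ k)) n≡) (proj₂ (blocks k n≡ k 0 (ℕ.+-identityʳ k))) ⟩
    suc k * (c * total n + n * F)
      ≤⟨ ℕ.*-monoʳ-≤ (suc k) (+-monoˡ-≤ (n * F) (ℕ.*-monoʳ-≤ c total≤F)) ⟩
    suc k * (c * F + n * F)
      ≡⟨ lemma₂ (suc k) c F n ⟩
    suc k * c * F + suc k * (n * F) ∎)
    where
    open ℕ.≤-Reasoning
    c = k ^ k
    lemma₁ : ∀ x y z → x + (y + z) ≡ y + x + z
    lemma₁ = solve-∀
    lemma₂ : ∀ k c F n → k * (c * F + n * F) ≡ k * c * F + k * (n * F)
    lemma₂ = solve-∀

-- Exchanging two vertices, and the triangular graph.

∑-zero : ∀ (xs : List A) {f} → (∀ {x} → x ∈ xs → f x ≡ 0) → ∑ xs f ≡ 0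
∑-zero []       f≡0 = refl
∑-zero (x ∷ xs) f≡0 = cong₂ _+_ (f≡0 (here refl)) (∑-zero xs (f≡0 ∘ there))

Unique-↭ : ∀ {xs ys : List A} → xs ↭ ys → Unique xs → Unique ys
Unique-↭ {A} p = PermSetoid.Unique-resp-↭ (setoid A) (Perm.↭⇒↭ₛ p)

∑-𝟙-unique≤1 : ∀ {xs : List ℕ} → Unique xs → ∀ y → ∑ xs (λ x → 𝟙 (x ≟ y)) ≤ 1
∑-𝟙-unique≤1 uniq y = ∑-𝟙≤length (_≟ y) uniq [ y ] (λ {refl → here refl})

exchange : ℕ → ℕ → ℕ → ℕ
exchange i j x = if ⌊ x ≟ i ⌋ then j else if ⌊ x ≟ j ⌋ then i else x

exchange-i : ∀ i j → exchange i j i ≡ j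
exchange-i i j with i ≟ i
... | yes _   = refl
... | no  i≢i = contradiction refl i≢i

exchange-j : ∀ i j → exchange i j j ≡ i
exchange-j i j with j ≟ i
... | yes refl = refl
... | no  _ with j ≟ j
...   | yes _   = refl
...   | no  j≢j = contradiction refl j≢j

exchange-other : ∀ {i j x} → x ≢ i → x ≢ j → exchange i j x ≡ x
exchange-other {i} {j} {x} x≢i x≢j with x ≟ i
... | yes x≡i = contradiction x≡i x≢i
... | no  _ with x ≟ j
...   | yes x≡j = contradiction x≡j x≢j
...   | no  _   = refl

exchange-cases : ∀ (P : ℕ → ℕ → Set) {i j} → P i j → P j i → (∀ {x} → x ≢ i → x ≢ j → P x x) →
                 ∀ x → P x (exchange i j x)
exchange-cases P {i} {j} pij pji pxx x with x ≟ i
... | yes refl = pij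
... | no  x≢i with x ≟ j
...   | yes refl = pji
...   | no  x≢j  = pxx x≢i x≢j

map-exchange-↭ : ∀ {i j} {xs} → Unique xs → i ∈ xs → j ∈ xs → map (exchange i j) xs ↭ xs
map-exchange-↭ {i} {j} {xs} uniq i∈ j∈ with ∈⇒↭∷ i∈
... | ys , xs↭ with i ≟ j | Unique-↭ xs↭ uniq
...   | yes refl | _ = Perm.↭-reflexive
  (trans (List.map-cong (exchange-cases (λ x y → y ≡ x) refl refl (λ _ _ → refl)) xs) (List.map-id xs))
...   | no  i≢j  | (i∉ys AllPairs.∷ uniq′) with Perm.∈-resp-↭ xs↭ j∈
...     | here j≡i   = contradiction (sym j≡i) i≢j
...     | there j∈ys with ∈⇒↭∷ j∈ys
...       | zs , ys↭ with Unique-↭ ys↭ uniq′ | Perm.All-resp-↭ ys↭ i∉ys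
...         | j∉zs AllPairs.∷ _ | _ ∷ i∉zs = begin
  map (exchange i j) xs                                       ↭⟨ Perm.map⁺ (exchange i j) xs↭′ ⟩
  exchange i j i ∷ exchange i j j ∷ map (exchange i j) zs     ≡⟨ cong₂ _∷_ (exchange-i i j)
    (cong₂ _∷_ (exchange-j i j) (List.map-id-local (All.tabulate λ x∈ →
      exchange-other (All.lookup i∉zs x∈ ∘ sym) (All.lookup j∉zs x∈ ∘ sym)))) ⟩
  j ∷ i ∷ zs                                                  ↭⟨ Perm.swap j i Perm.refl ⟩
  i ∷ j ∷ zs                                                  ↭⟨ xs↭′ ⟨
  xs                                                          ∎
  where
  open Perm.PermutationReasoning
  xs↭′ : xs ↭ i ∷ j ∷ zs
  xs↭′ = Perm.trans xs↭ (Perm.prep i ys↭)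

module Triangular (n N : ℕ) (n≤N : n ≤ N) where

  -- Vertices from n on are isolated on both sides and pad the vertex sets to size N.
  adj : ℕ → ℕ → Bool
  adj l k = ⌊ k ≤? l ⌋ ∧ ⌊ l ℕ.<? n ⌋

  V us : List ℕ
  V  = upTo N
  us = downFrom N

  F : ℕ
  F = length (perms V)

  -- Summed over a run in which l arrives once, this is φ at the partner of l, and 0 if l stays
  -- unmatched. A general φ is kept because `joins-exchange` composes it with the exchange.
  joins : ℕ → (ℕ → ℕ) → ℕ × ℕ → ℕ
  joins l φ (u , w) = 𝟙 (u ≟ l) * φ w

  adj-true : ∀ {k l} → k ≤ l → adj l k ≡ ⌊ l ℕ.<? n ⌋
  adj-true {k} {l} k≤l with k ≤? l
  ... | yes _   = refl
  ... | no  k≰l = contradiction k≤l k≰l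

  adj-exchange : ∀ {k l m} → k ≤ l → l ≤ m → ∀ x → adj m (exchange k 0 x) ≡ adj m x
  adj-exchange k≤l l≤m = exchange-cases (λ x y → adj _ y ≡ adj _ x)
    (trans (adj-true z≤n) (sym (adj-true (≤-trans k≤l l≤m))))
    (trans (adj-true (≤-trans k≤l l≤m)) (sym (adj-true z≤n)))
    (λ _ _ → refl)

  -- Only vertices below m are still to arrive, and l is not among them.
  joins-early : ∀ {l m} φ ws → m ≤ l → ∑ (matches adj (downFrom m) ws) (joins l φ) ≡ 0
  joins-early {l} {m} φ ws m≤l = ∑-zero (matches adj (downFrom m) ws) λ {(u , w)} uw∈ →
    cong (λ b → (if b then 1 else 0) * φ w) (dec-false (u ≟ l)
      (ℕ.<⇒≢ (ℕ.<-≤-trans (Mem.∈-downFrom⁻ (proj₁ (All.lookup (matches-sound adj (downFrom m) ws) uw∈))) m≤l)))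

  -- Every online vertex u ≥ l has both k and 0 as neighbours, or neither, so the
  -- runs on ws and on ws with 0 and k exchanged agree until l has been served.
  joins-exchange : ∀ {k l} φ → k ≤ l → ∀ m ws →
    ∑ (matches adj (downFrom m) (map (exchange k 0) ws)) (joins l φ) ≡
    ∑ (matches adj (downFrom m) ws) (joins l (φ ∘ exchange k 0))
  joins-exchange φ k≤l zero    ws = refl
  joins-exchange {k} {l} φ k≤l (suc m) ws with l ≤? m
  ... | no  l≰m = trans (joins-early φ (map (exchange k 0) ws) (ℕ.≰⇒> l≰m))
    (sym (joins-early (φ ∘ exchange k 0) ws (ℕ.≰⇒> l≰m)))
  ... | yes l≤m = begin
    ∑ (matches adj (m ∷ downFrom m) (map τ ws)) (joins l φ)
      ≡⟨ ∑-matches-∷ adj m (downFrom m) (map τ ws) (joins l φ) ⟩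
    ∑ (choose (adj m) (map τ ws)) (λ w → joins l φ (m , w)) +
    ∑ (matches adj (downFrom m) (remaining (adj m) (map τ ws))) (joins l φ)
      ≡⟨ cong₂ (λ cs rs → ∑ cs (λ w → joins l φ (m , w)) + ∑ (matches adj (downFrom m) rs) (joins l φ))
           (choose-map τ (adj m) (adj m) ws (λ {w} _ → adj-exchange k≤l l≤m w))
           (remaining-map τ (adj m) (adj m) ws (λ {w} _ → adj-exchange k≤l l≤m w)) ⟩
    ∑ (map τ (choose (adj m) ws)) (λ w → joins l φ (m , w)) +
    ∑ (matches adj (downFrom m) (map τ (remaining (adj m) ws))) (joins l φ)
      ≡⟨ cong₂ _+_ (∑-map τ (choose (adj m) ws) _) (joins-exchange φ k≤l m (remaining (adj m) ws)) ⟩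
    ∑ (choose (adj m) ws) (λ w → joins l (φ ∘ τ) (m , w)) +
    ∑ (matches adj (downFrom m) (remaining (adj m) ws)) (joins l (φ ∘ τ))
      ≡⟨ ∑-matches-∷ adj m (downFrom m) ws (joins l (φ ∘ τ)) ⟨
    ∑ (matches adj (m ∷ downFrom m) ws) (joins l (φ ∘ τ)) ∎
    where
    open ≡-Reasoning
    τ = exchange k 0

  count : ℕ → ℕ → List ℕ → ℕ
  count l k σ = ∑ (matches adj us σ) (joins l (λ w → 𝟙 (w ≟ k)))

  -- Exchanging k and 0 permutes the set of orders and turns those in which l takes k into those in
  -- which l takes 0.
  ∑-count-exchange : ∀ {k l} → k ≤ l → l ℕ.< N →
                     ∑ (perms V) (count l k) ≡ ∑ (perms V) (count l 0)
  ∑-count-exchange {k} {l} k≤l l<N = begin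
    ∑ (perms V) (count l k)
      ≡⟨ ∑-perms-↭ (map-exchange-↭ (Unique.upTo⁺ N) (Mem.∈-upTo⁺ (ℕ.≤-<-trans k≤l l<N))
           (Mem.∈-upTo⁺ (ℕ.≤-<-trans z≤n l<N))) (count l k) ⟨
    ∑ (perms (map (exchange k 0) V)) (count l k)
      ≡⟨ ∑-perms-map (exchange k 0) V (count l k) ⟩
    ∑ (perms V) (count l k ∘ map (exchange k 0))
      ≡⟨ ∑-cong (perms V) (λ σ → trans (joins-exchange (λ w → 𝟙 (w ≟ k)) k≤l N σ)
           (∑-cong (matches adj us σ) λ (u , w) → cong (𝟙 (u ≟ l) *_) (indicator w))) ⟩
    ∑ (perms V) (count l 0) ∎
    where
    open ≡-Reasoning
    indicator : ∀ w → 𝟙 (exchange k 0 w ≟ k) ≡ 𝟙 (w ≟ 0)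
    indicator = exchange-cases (λ x y → 𝟙 (y ≟ k) ≡ 𝟙 (x ≟ 0))
      (𝟙-comm 0 k) (trans (𝟙-yes (k ≟ k) refl) (sym (𝟙-yes (0 ≟ 0) refl)))
      (λ {x} x≢k x≢0 → trans (𝟙-no (x ≟ k) x≢k) (sym (𝟙-no (x ≟ 0) x≢0)))
      where
      𝟙-no : ∀ {P : Set} (P? : Dec P) → ¬ P → 𝟙 P? ≡ 0
      𝟙-no P? ¬p = cong (if_then 1 else 0) (dec-false P? ¬p)
      𝟙-comm : ∀ i j → 𝟙 (i ≟ j) ≡ 𝟙 (j ≟ i)
      𝟙-comm i j with j ≟ i
      ... | yes refl = refl
      ... | no  j≢i  = trans (𝟙-no (i ≟ j) (j≢i ∘ sym)) (sym (𝟙-no (j ≟ i) j≢i))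

  takes₀ : ℕ → ℕ
  takes₀ l = ∑ (perms V) (count l 0)

  perm-unique : ∀ {σ} → σ ∈ perms V → Unique σ
  perm-unique σ∈ = Unique-↭ (Perm.↭-sym (All.lookup (perms-↭ V) σ∈)) (Unique.upTo⁺ N)

  takes₀-degree : ∀ {l} → l ℕ.< n → suc l * takes₀ l ≤ F
  takes₀-degree {l} l<n = begin
    suc l * takes₀ l
      ≡⟨ cong (_* takes₀ l) (List.length-upTo (suc l)) ⟨
    length (upTo (suc l)) * takes₀ l
      ≡⟨ ∑-const (upTo (suc l)) (takes₀ l) ⟨
    ∑ (upTo (suc l)) (λ _ → takes₀ l)
      ≤⟨ ∑-mono-∈ (upTo (suc l)) (λ k∈ → ≤-reflexive
           (sym (∑-count-exchange (ℕ.s≤s⁻¹ (Mem.∈-upTo⁻ k∈)) (ℕ.<-≤-trans l<n n≤N)))) ⟩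
    ∑ (upTo (suc l)) (λ k → ∑ (perms V) (count l k))
      ≡⟨ ∑-swap (upTo (suc l)) (perms V) (count l) ⟩
    ∑ (perms V) (λ σ → ∑ (upTo (suc l)) (λ k → count l k σ))
      ≤⟨ ∑-mono (perms V) bound ⟩
    ∑ (perms V) (λ _ → 1)
      ≡⟨ length-≡-∑ (perms V) ⟨
    F ∎
    where
    open ℕ.≤-Reasoning
    bound : ∀ σ → ∑ (upTo (suc l)) (λ k → count l k σ) ≤ 1
    bound σ = begin
      ∑ (upTo (suc l)) (λ k → count l k σ)
        ≡⟨ ∑-swap (upTo (suc l)) (matches adj us σ) _ ⟩
      ∑ (matches adj us σ) (λ (u , w) → ∑ (upTo (suc l)) (λ k → 𝟙 (u ≟ l) * 𝟙 (w ≟ k)))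
        ≤⟨ ∑-mono (matches adj us σ) (λ (u , w) → begin
             ∑ (upTo (suc l)) (λ k → 𝟙 (u ≟ l) * 𝟙 (w ≟ k))
               ≡⟨ ∑-distribˡ-* (upTo (suc l)) (𝟙 (u ≟ l)) _ ⟩
             𝟙 (u ≟ l) * ∑ (upTo (suc l)) (λ k → 𝟙 (w ≟ k))
               ≤⟨ ℕ.*-monoʳ-≤ (𝟙 (u ≟ l))
                    (∑-𝟙≤length (w ≟_) (Unique.upTo⁺ (suc l)) [ w ] (λ {refl → here refl})) ⟩
             𝟙 (u ≟ l) * 1
               ≡⟨ ℕ.*-identityʳ (𝟙 (u ≟ l)) ⟩
             𝟙 (u ≟ l) ∎) ⟩
      ∑ (matches adj us σ) (λ (u , w) → 𝟙 (u ≟ l))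
        ≤⟨ ∑-matches-online≤ adj us σ (λ u → 𝟙 (u ≟ l)) ⟩
      ∑ us (λ u → 𝟙 (u ≟ l))
        ≤⟨ ∑-𝟙-unique≤1 (Unique.downFrom⁺ N) l ⟩
      1 ∎

  ∑-takes₀≤F : ∑ (upTo n) takes₀ ≤ F
  ∑-takes₀≤F = begin
    ∑ (upTo n) (λ l → ∑ (perms V) (count l 0))
      ≡⟨ ∑-swap (upTo n) (perms V) _ ⟩
    ∑ (perms V) (λ σ → ∑ (upTo n) (λ l → count l 0 σ))
      ≤⟨ ∑-mono-∈ (perms V) (λ σ∈ → bound (perm-unique σ∈)) ⟩
    ∑ (perms V) (λ _ → 1)
      ≡⟨ length-≡-∑ (perms V) ⟨
    F ∎
    where
    open ℕ.≤-Reasoning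
    bound : ∀ {σ} → Unique σ → ∑ (upTo n) (λ l → count l 0 σ) ≤ 1
    bound {σ} uniq = begin
      ∑ (upTo n) (λ l → count l 0 σ)
        ≡⟨ ∑-swap (upTo n) (matches adj us σ) _ ⟩
      ∑ (matches adj us σ) (λ (u , w) → ∑ (upTo n) (λ l → 𝟙 (u ≟ l) * 𝟙 (w ≟ 0)))
        ≤⟨ ∑-mono (matches adj us σ) (λ (u , w) → begin
             ∑ (upTo n) (λ l → 𝟙 (u ≟ l) * 𝟙 (w ≟ 0))
               ≡⟨ ∑-cong (upTo n) (λ l → *-comm (𝟙 (u ≟ l)) (𝟙 (w ≟ 0))) ⟩
             ∑ (upTo n) (λ l → 𝟙 (w ≟ 0) * 𝟙 (u ≟ l))
               ≡⟨ ∑-distribˡ-* (upTo n) (𝟙 (w ≟ 0)) _ ⟩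
             𝟙 (w ≟ 0) * ∑ (upTo n) (λ l → 𝟙 (u ≟ l))
               ≤⟨ ℕ.*-monoʳ-≤ (𝟙 (w ≟ 0))
                    (∑-𝟙≤length (u ≟_) (Unique.upTo⁺ n) [ u ] (λ {refl → here refl})) ⟩
             𝟙 (w ≟ 0) * 1
               ≡⟨ ℕ.*-identityʳ (𝟙 (w ≟ 0)) ⟩
             𝟙 (w ≟ 0) ∎) ⟩
      ∑ (matches adj us σ) (λ (u , w) → 𝟙 (w ≟ 0))
        ≤⟨ ∑-matches-offline≤ adj us σ (λ w → 𝟙 (w ≟ 0)) ⟩
      ∑ σ (λ w → 𝟙 (w ≟ 0))
        ≤⟨ ∑-𝟙-unique≤1 uniq 0 ⟩
      1 ∎

  adj-sound : ∀ {l k} → adj l k ≡ true → k ≤ l × l ℕ.< n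
  adj-sound {l} {k} eq with k ≤? l | l ℕ.<? n
  adj-sound eq | yes k≤l | yes l<n = k≤l , l<n
  adj-sound () | yes _   | no  _
  adj-sound () | no  _   | _

  adj-complete : ∀ {l k} → k ≤ l × l ℕ.< n → adj l k ≡ true
  adj-complete {l} {k} (k≤l , l<n) with k ≤? l | l ℕ.<? n
  ... | yes _   | yes _   = refl
  ... | no  k≰l | _       = contradiction k≤l k≰l
  ... | yes _   | no  l≮n = contradiction l<n l≮n

  -- A matched pair (u, w) is an edge, so w ≤ u < n, and it is found at l = u, k = w.
  size≤∑-count : ∀ σ → length (matches adj us σ) ≤ ∑ (upTo n) (λ l → ∑ (upTo (suc l)) (λ k → count l k σ))
  size≤∑-count σ = begin
    length (matches adj us σ)
      ≡⟨ length-≡-∑ (matches adj us σ) ⟩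
    ∑ (matches adj us σ) (λ _ → 1)
      ≤⟨ ∑-mono-∈ (matches adj us σ) (λ uw∈ →
           found (adj-sound (proj₂ (proj₂ (All.lookup (matches-sound adj us σ) uw∈))))) ⟩
    ∑ (matches adj us σ) (λ uw → ∑ (upTo n) λ l → ∑ (upTo (suc l)) λ k → joins l (λ w → 𝟙 (w ≟ k)) uw)
      ≡⟨ ∑-swap (matches adj us σ) (upTo n) _ ⟩
    ∑ (upTo n) (λ l → ∑ (matches adj us σ) λ uw → ∑ (upTo (suc l)) λ k → joins l (λ w → 𝟙 (w ≟ k)) uw)
      ≡⟨ ∑-cong (upTo n) (λ l → ∑-swap (matches adj us σ) (upTo (suc l)) _) ⟩
    ∑ (upTo n) (λ l → ∑ (upTo (suc l)) (λ k → count l k σ)) ∎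
    where
    open ℕ.≤-Reasoning
    found : ∀ {u w} → w ≤ u × u ℕ.< n →
            1 ≤ ∑ (upTo n) λ l → ∑ (upTo (suc l)) λ k → joins l (λ w → 𝟙 (w ≟ k)) (u , w)
    found {u} {w} (w≤u , u<n) = begin
      1
        ≡⟨ cong₂ _*_ (𝟙-yes (u ≟ u) refl) (𝟙-yes (w ≟ w) refl) ⟨
      𝟙 (u ≟ u) * 𝟙 (w ≟ w)
        ≤⟨ ∑-member (λ k → 𝟙 (u ≟ u) * 𝟙 (w ≟ k)) (Mem.∈-upTo⁺ (s≤s w≤u)) ⟩
      ∑ (upTo (suc u)) (λ k → 𝟙 (u ≟ u) * 𝟙 (w ≟ k))
        ≤⟨ ∑-member (λ l → ∑ (upTo (suc l)) λ k → 𝟙 (u ≟ l) * 𝟙 (w ≟ k)) (Mem.∈-upTo⁺ u<n) ⟩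
      ∑ (upTo n) (λ l → ∑ (upTo (suc l)) λ k → 𝟙 (u ≟ l) * 𝟙 (w ≟ k)) ∎

  ∑-size≤weighted : ∑ (perms V) (λ σ → length (matches adj us σ)) ≤ ∑ (upTo n) (λ l → suc l * takes₀ l)
  ∑-size≤weighted = begin
    ∑ (perms V) (λ σ → length (matches adj us σ))
      ≤⟨ ∑-mono (perms V) size≤∑-count ⟩
    ∑ (perms V) (λ σ → ∑ (upTo n) (λ l → ∑ (upTo (suc l)) (λ k → count l k σ)))
      ≡⟨ ∑-swap (perms V) (upTo n) _ ⟩
    ∑ (upTo n) (λ l → ∑ (perms V) (λ σ → ∑ (upTo (suc l)) (λ k → count l k σ)))
      ≡⟨ ∑-cong (upTo n) (λ l → ∑-swap (perms V) (upTo (suc l)) _) ⟩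
    ∑ (upTo n) (λ l → ∑ (upTo (suc l)) (λ k → ∑ (perms V) (count l k)))
      ≤⟨ ∑-mono-∈ (upTo n) (λ {l} l∈ → ≤-trans
           (∑-mono-∈ (upTo (suc l)) (λ k∈ → ≤-reflexive (∑-count-exchange
             (ℕ.s≤s⁻¹ (Mem.∈-upTo⁻ k∈)) (ℕ.<-≤-trans (Mem.∈-upTo⁻ l∈) n≤N))))
           (≤-reflexive (trans (∑-const (upTo (suc l)) (takes₀ l))
             (cong (_* takes₀ l) (List.length-upTo (suc l)))))) ⟩
    ∑ (upTo n) (λ l → suc l * takes₀ l) ∎
    where open ℕ.≤-Reasoning

  ∑-size-upper-bound : ∀ k .{{_ : NonZero k}} → suc k ^ k ≡ n →
    suc k * ∑ (perms V) (λ σ → length (matches adj us σ)) + k * (k ^ k * F) ≤ suc k * (n * F)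
  ∑-size-upper-bound k n≡ = ≤-trans
    (+-monoˡ-≤ (k * (k ^ k * F)) (ℕ.*-monoʳ-≤ (suc k) ∑-size≤weighted))
    (LinearProgram.weighted-bound n F takes₀ takes₀-degree k n≡ ∑-takes₀≤F)

-- From edge sets to greedy runs

choose-≡[] : ∀ (p : A → Bool) ws → choose p ws ≡ [] → (∀ {w} → w ∈ ws → p w ≢ true) × remaining p ws ≡ ws
choose-≡[] p []       _ = (λ ()) , refl
choose-≡[] p (x ∷ ws) eq with p x in px
choose-≡[] p (x ∷ ws) () | true
... | false with choose-≡[] p ws eq
...   | none , rest =
  (λ { (here refl) px′ → contradiction (trans (sym px) px′) λ () ; (there w∈) → none w∈ }) , cong (x ∷_) rest

module _ {R : A → A → Set} where

  choose-≡∷ : ∀ (p : A → Bool) {ws w cs} → AllPairs R ws → choose p ws ≡ w ∷ cs →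
    cs ≡ [] × (∀ {x} → x ∈ ws → p x ≡ true → x ≡ w ⊎ R w x)
  choose-≡∷ p {x ∷ ws} (x≺ AllPairs.∷ sorted) eq with p x in px
  choose-≡∷ p {x ∷ ws} (x≺ AllPairs.∷ sorted) refl | true  =
    refl , λ { (here refl) _ → inj₁ refl ; (there y∈) _ → inj₂ (All.lookup x≺ y∈) }
  choose-≡∷ p {x ∷ ws} (x≺ AllPairs.∷ sorted) eq   | false with choose-≡∷ p sorted eq
  ... | cs≡ , first = cs≡ , λ where
    (here refl) px′ → contradiction (trans (sym px) px′) λ ()
    (there y∈)  py  → first y∈ py

  remaining-AllPairs : ∀ (p : A → Bool) {ws} → AllPairs R ws → AllPairs R (remaining p ws)
  remaining-AllPairs p {[]}     sorted = sorted
  remaining-AllPairs p {w ∷ ws} (w≺ AllPairs.∷ sorted) with p w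
  ... | true  = sorted
  ... | false = All.tabulate (λ x∈ → All.lookup w≺ (remaining-⊆ p ws x∈)) AllPairs.∷ remaining-AllPairs p sorted

∈-remaining⁺ : ∀ (p : A → Bool) {ws w cs x} → choose p ws ≡ w ∷ cs → x ∈ ws → x ≢ w → x ∈ remaining p ws
∈-remaining⁺ p {y ∷ ws} eq   x∈          x≢w with p y
∈-remaining⁺ p {y ∷ ws} refl (here refl) x≢w | true  = contradiction refl x≢w
∈-remaining⁺ p {y ∷ ws} refl (there x∈)  x≢w | true  = x∈
∈-remaining⁺ p {y ∷ ws} eq   (here refl) x≢w | false = here refl
∈-remaining⁺ p {y ∷ ws} eq   (there x∈)  x≢w | false = there (∈-remaining⁺ p eq x∈ x≢w)

chosen∉remaining : ∀ (p : A → Bool) {ws w cs} → Unique ws → choose p ws ≡ w ∷ cs → w ∉ remaining p ws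
chosen∉remaining p {x ∷ ws} (x∉ AllPairs.∷ uniq) eq   w∈ with p x in px
chosen∉remaining p {x ∷ ws} (x∉ AllPairs.∷ uniq) refl w∈          | true  = All.lookup x∉ w∈ refl
chosen∉remaining p {x ∷ ws} (x∉ AllPairs.∷ uniq) eq   (here refl) | false =
  All.lookup x∉ (choose-⊆ p ws (subst (_ ∈_) (sym eq) (here refl))) refl
chosen∉remaining p {x ∷ ws} (x∉ AllPairs.∷ uniq) eq   (there w∈)  | false = chosen∉remaining p uniq eq w∈

x∈p─q⇒x∉q : ∀ {p q : Subset ν} {x} → x Subset.∈ p ─ q → x Subset.∉ q
x∈p─q⇒x∉q {p = _ ∷ p} {outside ∷ q} here       ()
x∈p─q⇒x∉q {p = _ ∷ p} {outside ∷ q} (there x∈) (there x∈q) = x∈p─q⇒x∉q x∈ x∈q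
x∈p─q⇒x∉q {p = _ ∷ p} {inside  ∷ q} (there x∈) (there x∈q) = x∈p─q⇒x∉q x∈ x∈q

rank≥1 : ∀ (σ : List (Fin ν)) v → 1 ≤ rank σ v
rank≥1 []      v = ≤-refl
rank≥1 (x ∷ σ) v with x Fin.≟ v
... | yes _ = ≤-refl
... | no  _ = s≤s z≤n

rank-sorted : ∀ {σ : List (Fin ν)} → Unique σ → AllPairs (λ v w → rank σ v ℕ.< rank σ w) σ
rank-sorted AllPairs.[] = AllPairs.[]
rank-sorted {σ = x ∷ σ} (x∉ AllPairs.∷ uniq) = All.tabulate first AllPairs.∷
  later (All.tabulate id) (rank-sorted uniq)
  where
  rank-first : rank (x ∷ σ) x ≡ 1
  rank-first with x Fin.≟ x
  ... | yes _   = refl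
  ... | no  x≢x = contradiction refl x≢x
  rank-later : ∀ {w} → w ∈ σ → rank (x ∷ σ) w ≡ suc (rank σ w)
  rank-later {w} w∈ with x Fin.≟ w
  ... | yes x≡w = contradiction x≡w (All.lookup x∉ w∈)
  ... | no  _   = refl
  first : ∀ {w} → w ∈ σ → rank (x ∷ σ) x ℕ.< rank (x ∷ σ) w
  first w∈ rewrite rank-first | rank-later w∈ = s≤s (rank≥1 σ _)
  later : ∀ {ws} → All (_∈ σ) ws → AllPairs (λ v w → rank σ v ℕ.< rank σ w) ws →
          AllPairs (λ v w → rank (x ∷ σ) v ℕ.< rank (x ∷ σ) w) ws
  later []         AllPairs.[] = AllPairs.[]
  later (v∈ ∷ ws∈) (v≺ AllPairs.∷ sorted) =
    All.zipWith (λ (w∈ , v<w) → subst₂ ℕ._<_ (sym (rank-later v∈)) (sym (rank-later w∈)) (s≤s v<w)) (ws∈ , v≺)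
    AllPairs.∷ later ws∈ sorted

adjacent : Graph ν → Fin ν → Fin ν → Bool
adjacent G u w = does (edge u w ∈ᴳ? G)

∈-neighbours⁺ : ∀ (G : Graph ν) {u w} → adjacent G u w ≡ true → w Subset.∈ neighbours G u
∈-neighbours⁺ G {u} {w} a = Vec.lookup⇒[]= w (neighbours G u) (trans (Vec.lookup∘tabulate _ w) a)

∈-neighbours⁻ : ∀ (G : Graph ν) {u w} → w Subset.∈ neighbours G u → adjacent G u w ≡ true
∈-neighbours⁻ G {u} {w} w∈ = trans (sym (Vec.lookup∘tabulate _ w)) (Vec.[]=⇒lookup w∈)

module OnlineMatch (G : Graph ν) {σ : List (Fin ν)} (σ-unique : Unique σ) where

  _≺_ : Fin ν → Fin ν → Set
  v ≺ w = rank σ v ℕ.< rank σ w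

  -- The invariant that ties the run on edge sets to the run on lists. Through `sorted`, the first
  -- admissible entry of ws is the choice of minimum rank.
  record Free (R : Graph ν) (ws : List (Fin ν)) : Set where
    field
      sorted : AllPairs _≺_ ws
      ⊆σ     : ws ⊆ σ
      free   : ∀ {w} → w ∈ ws → w Subset.∉ 𝒱 R
      all    : ∀ {w} → w ∈ σ → w Subset.∉ 𝒱 R → w ∈ ws

  open Free

  available : Graph ν → Fin ν → List (Fin ν)
  available R u = elements (neighbours G u ─ 𝒱 R)

  ∈-available⁺ : ∀ {R ws u w} → Free R ws → w ∈ ws → adjacent G u w ≡ true → w ∈ available R u
  ∈-available⁺ {R} {u = u} {w} F w∈ a = Mem.∈-filter⁺ (Subset._∈? (neighbours G u ─ 𝒱 R)) (Mem.∈-allFin w)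
    (Subset.x∈p∧x∉q⇒x∈p─q (∈-neighbours⁺ G a) (free F w∈))

  module _ {u} (nbrs⊆σ : ∀ {w} → adjacent G u w ≡ true → w ∈ σ) (u∉σ : u ∉ σ) where

    ∈-available⁻ : ∀ {R ws w} → Free R ws → w ∈ available R u → w ∈ ws × adjacent G u w ≡ true
    ∈-available⁻ {R} {w = w} F w∈ = all F (nbrs⊆σ adj-uw) (x∈p─q⇒x∉q w∈─) , adj-uw
      where
      w∈─ : w Subset.∈ neighbours G u ─ 𝒱 R
      w∈─ = proj₂ (Mem.∈-filter⁻ (Subset._∈? (neighbours G u ─ 𝒱 R)) {xs = List.allFin ν} w∈)
      adj-uw : adjacent G u w ≡ true
      adj-uw = ∈-neighbours⁻ G (Subset.p─q⊆p (neighbours G u) (𝒱 R) w∈─)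

    Free-remaining : ∀ {R ws w cs} → Free R ws → choose (adjacent G u) ws ≡ w ∷ cs →
                     Free (edge w u ∷ R) (remaining (adjacent G u) ws)
    Free-remaining {R} {ws} {w} F eq = record
      { sorted = remaining-AllPairs p (sorted F)
      ; ⊆σ     = ⊆σ F ∘ remaining-⊆ p ws
      ; free   = λ {x} x∈ x∈𝒱 → case Subset.x∈p∪q⁻ (edge w u) (𝒱 R) x∈𝒱 of λ where
          (inj₂ x∈R) → free F (remaining-⊆ p ws x∈) x∈R
          (inj₁ x∈e) → case Subset.x∈p∪q⁻ ⁅ w ⁆ ⁅ u ⁆ x∈e of λ where
            (inj₁ x∈w) → chosen∉remaining p (AllPairs.map (λ v<w → ℕ.<⇒≢ v<w ∘ cong (rank σ)) (sorted F)) eq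
              (subst (_∈ remaining p ws) (Subset.x∈⁅y⁆⇒x≡y w x∈w) x∈)
            -- The new edge covers u as well, but u is online, so no free offline vertex is lost
            -- through it.
            (inj₂ x∈u) → u∉σ (subst (_∈ σ) (Subset.x∈⁅y⁆⇒x≡y u x∈u) (⊆σ F (remaining-⊆ p ws x∈)))
      ; all    = λ {x} x∈σ x∉𝒱 → ∈-remaining⁺ p eq
          (all F x∈σ (x∉𝒱 ∘ Subset.x∈p∪q⁺ ∘ inj₂))
          (λ { refl → x∉𝒱 (Subset.x∈p∪q⁺ (inj₁ (Subset.x∈p∪q⁺ (inj₁ (Subset.x∈⁅x⁆ x))))) })
      }
      where p = adjacent G u

    step-correct : ∀ {R ws} → Free R ws →
      length (step G σ R u) ≡ length (choose (adjacent G u) ws) + length R ×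
      Free (step G σ R u) (remaining (adjacent G u) ws)
    step-correct {R} {ws} F with available R u in avail | choose (adjacent G u) ws in chosen
    ... | []     | []     = refl , subst (Free R) (sym (proj₂ (choose-≡[] _ ws chosen))) F
    ... | []     | w ∷ cs = contradiction
      (subst (w ∈_) avail (∈-available⁺ F (choose-⊆ _ ws w∈) (choose-satisfies _ ws w∈))) λ ()
      where
      w∈ : w ∈ choose (adjacent G u) ws
      w∈ = subst (w ∈_) (sym chosen) (here refl)
    ... | v ∷ vs | []     = case ∈-available⁻ F (subst (v ∈_) (sym avail) (here refl)) of λ
      (v∈ , a) → contradiction a (proj₁ (choose-≡[] _ ws chosen) v∈)
    ... | v ∷ vs | w ∷ cs with choose-≡∷ (adjacent G u) (sorted F) chosen
    ...   | refl , first = refl , subst (λ x → Free (edge x u ∷ R) _) (sym best≡w) (Free-remaining F chosen)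
      where
      best = Extrema.argmin ℕ.≤-totalOrder (rank σ) v vs
      best∈ : best ∈ v ∷ vs
      best∈ with Extrema.argmin-sel ℕ.≤-totalOrder (rank σ) v vs
      ... | inj₁ eq = here eq
      ... | inj₂ b∈ = there b∈
      w∈ : w ∈ v ∷ vs
      w∈ = subst (w ∈_) avail (∈-available⁺ F (choose-⊆ _ ws w∈c) (choose-satisfies _ ws w∈c))
        where
        w∈c : w ∈ choose (adjacent G u) ws
        w∈c = subst (w ∈_) (sym chosen) (here refl)
      best≤ : ∀ {x} → x ∈ v ∷ vs → rank σ best ≤ rank σ x
      best≤ (here refl) = Extrema.f[argmin]≤f[⊤] ℕ.≤-totalOrder {f = rank σ} v vs
      best≤ (there x∈)  = All.lookup (Extrema.f[argmin]≤f[xs] ℕ.≤-totalOrder {f = rank σ} v vs) x∈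
      best≡w : best ≡ w
      -- Ranks increase strictly along ws, so any available vertex other than w has a larger rank
      -- than w and cannot be a minimiser.
      best≡w with ∈-available⁻ F (subst (best ∈_) (sym avail) best∈)
      ... | b∈ , a with first b∈ a
      ...   | inj₁ eq  = eq
      ...   | inj₂ w<b = contradiction (best≤ w∈) (ℕ.<⇒≱ w<b)

  foldl-correct : ∀ us → (∀ {u w} → u ∈ us → adjacent G u w ≡ true → w ∈ σ) → (∀ {u} → u ∈ us → u ∉ σ) →
    ∀ {R ws} → Free R ws →
    length (List.foldl (step G σ) R us) ≡ length (matches (adjacent G) us ws) + length R
  foldl-correct []       nbrs⊆σ us∉σ F = refl
  foldl-correct (u ∷ us) nbrs⊆σ us∉σ {R} {ws} F
    with step-correct (nbrs⊆σ (here refl)) (us∉σ (here refl)) F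
  ... | |R′| , F′ = begin
    length (List.foldl (step G σ) (step G σ R u) us)
      ≡⟨ foldl-correct us (nbrs⊆σ ∘ there) (us∉σ ∘ there) F′ ⟩
    length (matches (adjacent G) us (remaining (adjacent G u) ws)) + length (step G σ R u)
      ≡⟨ cong (length (matches (adjacent G) us (remaining (adjacent G u) ws)) +_) |R′| ⟩
    length (matches (adjacent G) us (remaining (adjacent G u) ws)) + (length (choose (adjacent G u) ws) + length R)
      ≡⟨ lemma _ (length (choose (adjacent G u) ws)) (length R) ⟩
    length (choose (adjacent G u) ws) + length (matches (adjacent G) us (remaining (adjacent G u) ws)) + length R
      ≡⟨ cong (_+ length R) (length-matches-∷ (adjacent G) u us ws) ⟨
    length (matches (adjacent G) (u ∷ us) ws) + length R ∎
    where
    open ≡-Reasoning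
    lemma : ∀ a b c → a + (b + c) ≡ b + a + c
    lemma = solve-∀

  length-online-match : ∀ us → (∀ {u w} → u ∈ us → adjacent G u w ≡ true → w ∈ σ) → (∀ {u} → u ∈ us → u ∉ σ) →
    length (online-match G us σ) ≡ length (matches (adjacent G) us σ)
  length-online-match us nbrs⊆σ us∉σ = trans
    (foldl-correct us nbrs⊆σ us∉σ record
      { sorted = rank-sorted σ-unique ; ⊆σ = id ; free = λ _ → Subset.∉⊥ ; all = λ w∈ _ → w∈ })
    (ℕ.+-identityʳ _)

-- The graphs between the offline and the online vertices

-- The vertices `v l` with toℕ l < n cover all edges, and disjoint edges need different cover
-- vertices: the easy half of König's theorem. It bounds the matchings of the triangular graph.
disjoint-length≤ : ∀ {a} (es : List (Subset a)) {b n} (v : Fin b → Fin a) →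
  AllPairs (λ e f → Subset.Empty (e ∩ f)) es →
  All (λ e → ∃ λ l → toℕ l ℕ.< n × v l Subset.∈ e) es → length es ≤ n
disjoint-length≤ {a} es {b} {n} v disjoint covered with labels es disjoint covered
  where
  labels : ∀ es → AllPairs (λ e f → Subset.Empty (e ∩ f)) es →
    All (λ e → ∃ λ l → toℕ l ℕ.< n × v l Subset.∈ e) es →
    ∃ λ ls → length ls ≡ length es × Unique ls ×
      (∀ {l} → l ∈ ls → toℕ l ℕ.< n × ∃ λ e → e ∈ es × v l Subset.∈ e)
  labels []       AllPairs.[] [] = [] , refl , AllPairs.[] , λ ()
  labels (e ∷ es) (e# AllPairs.∷ disjoint) ((l , l<n , l∈e) ∷ covered) with labels es disjoint covered
  ... | ls , len , uniq , sound =
    l ∷ ls , cong suc len ,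
    All.tabulate (λ l′∈ l≡l′ → case proj₂ (sound l′∈) of λ
      (f , f∈ , l′∈f) → All.lookup e# f∈ (v l , Subset.x∈p∩q⁺ (l∈e , subst (λ l → v l Subset.∈ f) (sym l≡l′) l′∈f)))
      AllPairs.∷ uniq ,
    λ where
      (here refl) → l<n , e , here refl , l∈e
      (there l′∈) → case sound l′∈ of λ (l′<n , f , f∈ , l′∈f) → l′<n , f , there f∈ , l′∈f
... | ls , len , uniq , sound = begin
  length es              ≡⟨ trans (sym len) (sym (List.length-map toℕ ls)) ⟩
  length (map toℕ ls)    ≤⟨ unique-⊆⇒length≤ (Unique.map⁺ Fin.toℕ-injective uniq) (λ x∈ → case Mem.∈-map⁻ toℕ x∈ of λ
                              { (l , l∈ , refl) → Mem.∈-upTo⁺ (proj₁ (sound l∈)) }) ⟩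
  length (upTo n)        ≡⟨ List.length-upTo n ⟩
  n                      ∎
  where open ℕ.≤-Reasoning

map-toℕ-allFin : ∀ n → map toℕ (allFin n) ≡ upTo n
map-toℕ-allFin n = trans (List.map-tabulate id toℕ) (tabulate-toℕ id n)
  where
  tabulate-toℕ : ∀ {A : Set} (f : ℕ → A) n → tabulate (f ∘ toℕ {n}) ≡ List.applyUpTo f n
  tabulate-toℕ f zero    = refl
  tabulate-toℕ f (suc n) = cong (f 0 ∷_) (tabulate-toℕ (f ∘ suc) n)

module Crossing (n : ℕ) where

  off on : Fin (2 * n) → Vertex n
  off = vertex n zero
  on  = vertex n (suc zero)

  off≢on : ∀ {k l} → off k ≢ on l
  off≢on {k} {l} eq with Fin.combine-injectiveˡ {2} zero k (suc zero) l eq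
  ... | ()

  off-injective : ∀ {k l} → off k ≡ off l → k ≡ l
  off-injective = Fin.combine-injectiveʳ {2} zero _ zero _

  on-injective : ∀ {k l} → on k ≡ on l → k ≡ l
  on-injective = Fin.combine-injectiveʳ {2} (suc zero) _ (suc zero) _

  off∈crossEdge : ∀ k l → off k Subset.∈ crossEdge n k l
  off∈crossEdge k l = Subset.x∈p∪q⁺ (inj₁ (Subset.x∈⁅x⁆ (off k)))

  on∈crossEdge : ∀ k l → on l Subset.∈ crossEdge n k l
  on∈crossEdge k l = Subset.x∈p∪q⁺ (inj₂ (Subset.x∈⁅x⁆ (on l)))

  off∈crossEdge⁻ : ∀ {k k′ l′} → off k Subset.∈ crossEdge n k′ l′ → k ≡ k′
  off∈crossEdge⁻ k∈ with Subset.x∈p∪q⁻ _ _ k∈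
  ... | inj₁ k≡ = off-injective (Subset.x∈⁅y⁆⇒x≡y _ k≡)
  ... | inj₂ k≡ = contradiction (Subset.x∈⁅y⁆⇒x≡y _ k≡) off≢on

  on∈crossEdge⁻ : ∀ {l k′ l′} → on l Subset.∈ crossEdge n k′ l′ → l ≡ l′
  on∈crossEdge⁻ l∈ with Subset.x∈p∪q⁻ _ _ l∈
  ... | inj₁ l≡ = contradiction (sym (Subset.x∈⁅y⁆⇒x≡y _ l≡)) off≢on
  ... | inj₂ l≡ = on-injective (Subset.x∈⁅y⁆⇒x≡y _ l≡)

  crossEdge∈allEdges : ∀ k l → crossEdge n k l ∈ allEdges n
  crossEdge∈allEdges k l = Mem.∈-cartesianProductWith⁺ (crossEdge n) (Mem.∈-allFin k) (Mem.∈-allFin l)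

  cross : Graph (2 * (2 * n)) → Fin (2 * n) → Fin (2 * n) → Bool
  cross G l k = does (crossEdge n k l ∈ᴳ? G)

  edge-comm : ∀ k l → edge (on l) (off k) ≡ crossEdge n k l
  edge-comm k l = Subset.∪-comm ⁅ on l ⁆ ⁅ off k ⁆

  does-true : ∀ {P : Set} (P? : Dec P) → does P? ≡ true → P
  does-true (yes p) _ = p

  module _ {G : Graph (2 * (2 * n))} (G⊆ : G ⊆ allEdges n) where

    neighbour-off : ∀ {l w} → adjacent G (on l) w ≡ true → ∃ λ k → w ≡ off k
    neighbour-off {l} {w} a
      with Mem.∈-cartesianProductWith⁻ (crossEdge n) (allFin _) (allFin _)
             (G⊆ (does-true (edge (on l) w ∈ᴳ? G) a))
    ... | k , l′ , _ , _ , eq with Subset.x∈p∪q⁻ _ _ (subst (off k Subset.∈_) (sym eq) (off∈crossEdge k l′))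
    ...   | inj₁ k∈ = contradiction (Subset.x∈⁅y⁆⇒x≡y _ k∈) off≢on
    ...   | inj₂ k∈ = k , sym (Subset.x∈⁅y⁆⇒x≡y _ k∈)

    length-online-match-cross : ∀ π {σ} → σ ↭ allFin (2 * n) →
      length (online-match G (map on π) (map off σ)) ≡ length (matches (cross G) π σ)
    length-online-match-cross π {σ} σ↭ = begin
      length (online-match G (map on π) (map off σ))
        ≡⟨ OnlineMatch.length-online-match G
             (Unique.map⁺ off-injective (Unique-↭ (Perm.↭-sym σ↭) (Unique.allFin⁺ (2 * n))))
             (map on π) nbrs⊆σ disjoint ⟩
      length (matches (adjacent G) (map on π) (map off σ))
        ≡⟨ cong length (matches-map on off (adjacent G) (cross G) π σ λ {l} {k} _ _ →
             cong (λ e → does (e ∈ᴳ? G)) (edge-comm k l)) ⟩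
      length (map (λ (u , w) → on u , off w) (matches (cross G) π σ))
        ≡⟨ List.length-map _ (matches (cross G) π σ) ⟩
      length (matches (cross G) π σ) ∎
      where
      open ≡-Reasoning
      nbrs⊆σ : ∀ {u w} → u ∈ map on π → adjacent G u w ≡ true → w ∈ map off σ
      nbrs⊆σ u∈ a with Mem.∈-map⁻ on u∈
      ... | l , _ , refl with neighbour-off a
      ...   | k , refl = Mem.∈-map⁺ off (Perm.∈-resp-↭ (Perm.↭-sym σ↭) (Mem.∈-allFin k))
      disjoint : ∀ {u} → u ∈ map on π → u ∉ map off σ
      disjoint u∈ u∈′ with Mem.∈-map⁻ on u∈ | Mem.∈-map⁻ off u∈′
      ... | l , _ , refl | k , _ , eq = off≢on (sym eq)

    ∑-online-match : ∀ π → ∑ (perms (offline n)) (λ σ → length (online-match G (map on π) σ)) ≡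
                     ∑ (perms (allFin (2 * n))) (λ σ → length (matches (cross G) π σ))
    ∑-online-match π = trans (∑-perms-map off (allFin (2 * n)) _)
      (∑-cong-∈ (perms (allFin (2 * n))) λ σ∈ →
        length-online-match-cross π (All.lookup (perms-↭ (allFin (2 * n))) σ∈))

  total : Graph (2 * (2 * n)) → List (Vertex n) → ℕ
  total G π = ∑ (perms (offline n)) (λ σ → length (online-match G π σ))

  length-perms-allFin : length (perms (allFin (2 * n))) ≡ (2 * n) !
  length-perms-allFin = trans (length-perms (allFin (2 * n))) (cong _! (List.length-tabulate {n = 2 * n} id))

  total-lower-bound : ∀ {G π} → G ∈ Γ n → π ∈ Π n → let N = 2 * n in
    suc N ^ N * (n * N !) ≤ suc N ^ N * total G π + N ^ N * (n * N !)
  total-lower-bound {G} {π} G∈ π∈ with Mem.∈-filter⁻ (isMaximumMatching? (M n)) {xs = subsets (allEdges n)} G∈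
  ... | G∈subsets , _ , M⊆G , _ with Perm.↭-map-inv on (Perm.↭-sym π↭)
    where
    π↭ : π ↭ online n
    π↭ = All.lookup (perms-↭ (online n)) (subst (π ∈_) (toList-permutations (online n)) π∈)
  ...   | π′ , refl , π′↭ = subst Claim (sym (∑-online-match (subsets-⊆ (allEdges n) G∈subsets) π′))
    (subst₂ Bound (List.length-tabulate {n = N} id) |vs|*F LB.∑-size-lower-bound)
    where
    N = 2 * n
    -- The indices of `M n`; the summand n + 0 comes from 2 * n reducing to n + (n + 0).
    vs = map (_↑ˡ (n + 0)) (allFin n)
    Claim : ℕ → Set
    Claim S = suc N ^ N * (n * N !) ≤ suc N ^ N * S + N ^ N * (n * N !)
    Bound : ℕ → ℕ → Set
    Bound N H = suc N ^ N * H ≤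
      suc N ^ N * ∑ (perms (allFin (2 * n))) (λ σ → length (matches (cross G) π′ σ)) + N ^ N * H
    vs-matched : ∀ {v} → v ∈ vs → cross G v v ≡ true
    vs-matched v∈ with Mem.∈-map⁻ _ v∈
    ... | k , k∈ , refl = dec-true (_ ∈ᴳ? G) (M⊆G (Mem.∈-map⁺ (λ k → crossEdge n (k ↑ˡ _) (k ↑ˡ _)) k∈))
    module LB = LowerBound Fin._≟_ (cross G) π′ (allFin N) vs
      (Unique.map⁺ (Fin.↑ˡ-injective (n + 0) _ _) (Unique.allFin⁺ n))
      (λ {v} _ → Mem.∈-allFin v) (λ {v} _ → Perm.∈-resp-↭ π′↭ (Mem.∈-allFin v))
      vs-matched
    |vs|*F : length vs * length (perms (allFin N)) ≡ n * N !
    |vs|*F = cong₂ _*_ (trans (List.length-map _ (allFin n)) (List.length-tabulate {n = n} id)) length-perms-allFin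

  InTriangle : Fin (2 * n) × Fin (2 * n) → Set
  InTriangle (k , l) = toℕ k ≤ toℕ l × toℕ l ℕ.< n

  inTriangle? : ∀ kl → Dec (InTriangle kl)
  inTriangle? (k , l) = toℕ k ≤? toℕ l ×-dec toℕ l ℕ.<? n

  triangle : List (Subset (2 * (2 * n)))
  triangle = map (λ (k , l) → crossEdge n k l)
    (filter inTriangle? (cartesianProduct (allFin (2 * n)) (allFin (2 * n))))

  -- Filtered out of `allEdges`, because `Γ n` consists of sublists of `allEdges` in their given
  -- order.
  triangular : Graph (2 * (2 * n))
  triangular = filter (_∈ᴳ? triangle) (allEdges n)

  ∈-triangular⁺ : ∀ {k l} → InTriangle (k , l) → crossEdge n k l ∈ triangular
  ∈-triangular⁺ {k} {l} kl = Mem.∈-filter⁺ (_∈ᴳ? triangle) (crossEdge∈allEdges k l)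
    (Mem.∈-map⁺ _ (Mem.∈-filter⁺ inTriangle? (Mem.∈-cartesianProduct⁺ (Mem.∈-allFin k) (Mem.∈-allFin l)) kl))

  ∈-triangular⁻ : ∀ {e} → e ∈ triangular → ∃ λ k → ∃ λ l → e ≡ crossEdge n k l × InTriangle (k , l)
  ∈-triangular⁻ e∈
    with Mem.∈-map⁻ (λ (k , l) → crossEdge n k l) (proj₂ (Mem.∈-filter⁻ (_∈ᴳ? triangle) {xs = allEdges n} e∈))
  ... | (k , l) , kl∈ , refl = k , l , refl , proj₂ (Mem.∈-filter⁻ inTriangle? {xs = cartesianProduct (allFin (2 * n)) (allFin (2 * n))} kl∈)

  length-M : length (M n) ≡ n
  length-M = trans (List.length-map _ (allFin n)) (List.length-tabulate {n = n} id)

  triangular∈Γ : triangular ∈ Γ n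
  triangular∈Γ = Mem.∈-filter⁺ (isMaximumMatching? (M n)) (filter∈subsets (_∈ᴳ? triangle) (allEdges n))
    ( M-isMatching n
    , (λ e∈ → case Mem.∈-map⁻ _ e∈ of λ
        { (k , _ , refl) → ∈-triangular⁺ (≤-refl , subst (ℕ._< n) (sym (Fin.toℕ-↑ˡ k (n + 0))) (Fin.toℕ<n k)) })
    , λ M′ m′ M′⊆ → subst (length M′ ≤_) (sym length-M)
        (disjoint-length≤ M′ on (proj₂ m′) (All.tabulate λ e∈ → case ∈-triangular⁻ (M′⊆ e∈) of λ
          { (k , l , refl , _ , l<n) → l , l<n , on∈crossEdge k l })))

  π-reverse : List (Vertex n)
  π-reverse = map on (reverse (allFin (2 * n)))

  π-reverse∈Π : π-reverse ∈ Π n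
  π-reverse∈Π = subst₂ _∈_ (sym (List.reverse-map on (allFin (2 * n)))) (sym (toList-permutations (online n)))
    (reverse∈perms (online n))

  total-upper-bound : ∀ k .{{_ : NonZero k}} → suc k ^ k ≡ n → let F = (2 * n) ! in
    suc k * total triangular π-reverse + k * (k ^ k * F) ≤ suc k * (n * F)
  total-upper-bound k n≡ = subst₂ Claim total≡ F≡ (T.∑-size-upper-bound k n≡)
    where
    module T = Triangular n (2 * n) (ℕ.m≤m+n n (n + 0))
    N = 2 * n
    Claim : ℕ → ℕ → Set
    Claim S F = suc k * S + k * (k ^ k * F) ≤ suc k * (n * F)
    F≡ : length (perms (upTo N)) ≡ N !
    F≡ = trans (length-perms (upTo N)) (cong _! (List.length-upTo N))
    true-ext : ∀ {b c : Bool} → (b ≡ true → c ≡ true) → (c ≡ true → b ≡ true) → b ≡ c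
    true-ext {true}  {c}     f g = sym (f refl)
    true-ext {false} {true}  f g = g refl
    true-ext {false} {false} f g = refl
    adj≡cross : ∀ l k → T.adj (toℕ l) (toℕ k) ≡ cross triangular l k
    adj≡cross l k = true-ext
      (λ a → dec-true (crossEdge n k l ∈ᴳ? triangular) (∈-triangular⁺ (T.adj-sound a)))
      (λ c → case ∈-triangular⁻ (does-true (crossEdge n k l ∈ᴳ? triangular) c) of λ
        (k′ , l′ , eq , kl) → T.adj-complete (subst₂ (λ k l → InTriangle (k , l))
          (sym (off∈crossEdge⁻ (subst (off k Subset.∈_) eq (off∈crossEdge k l))))
          (sym (on∈crossEdge⁻ (subst (on l Subset.∈_) eq (on∈crossEdge k l)))) kl))
    total≡ : ∑ (perms (upTo N)) (λ σ → length (matches T.adj (downFrom N) σ)) ≡ total triangular π-reverse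
    total≡ = begin
      ∑ (perms (upTo N)) (λ σ → length (matches T.adj (downFrom N) σ))
        ≡⟨ cong (λ V → ∑ (perms V) (λ σ → length (matches T.adj (downFrom N) σ))) (map-toℕ-allFin N) ⟨
      ∑ (perms (map toℕ (allFin N))) (λ σ → length (matches T.adj (downFrom N) σ))
        ≡⟨ ∑-perms-map toℕ (allFin N) _ ⟩
      ∑ (perms (allFin N)) (λ σ → length (matches T.adj (downFrom N) (map toℕ σ)))
        ≡⟨ ∑-cong (perms (allFin N)) (λ σ → begin
             length (matches T.adj (downFrom N) (map toℕ σ))
               ≡⟨ cong (λ us → length (matches T.adj us (map toℕ σ))) reversed ⟨
             length (matches T.adj (map toℕ (reverse (allFin N))) (map toℕ σ))
               ≡⟨ cong length (matches-map toℕ toℕ T.adj (cross triangular) (reverse (allFin N)) σ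
                    λ {l} {k} _ _ → adj≡cross l k) ⟩
             length (map (λ (u , w) → toℕ u , toℕ w) (matches (cross triangular) (reverse (allFin N)) σ))
               ≡⟨ List.length-map _ (matches (cross triangular) (reverse (allFin N)) σ) ⟩
             length (matches (cross triangular) (reverse (allFin N)) σ) ∎) ⟩
      ∑ (perms (allFin N)) (λ σ → length (matches (cross triangular) (reverse (allFin N)) σ))
        ≡⟨ ∑-online-match (proj₁ ∘ Mem.∈-filter⁻ (_∈ᴳ? triangle)) (reverse (allFin N)) ⟨
      total triangular π-reverse ∎
      where
      open ≡-Reasoning
      reversed : map toℕ (reverse (allFin N)) ≡ downFrom N
      reversed = trans (List.reverse-map toℕ (allFin N))
        (trans (cong reverse (map-toℕ-allFin N)) (List.reverse-upTo N))

-- Partial sums of the exponential series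

-- `expSum N m a` is m! N ^ m ∑_{j ≤ m} (a / N) ^ j / j!.
expSum : ℕ → ℕ → ℕ → ℕ
expSum N zero    a = 1
expSum N (suc m) a = suc m * N * expSum N m a + a ^ suc m

suc-^-lower : ∀ a m → a ^ suc m + suc m * a ^ m ≤ suc a ^ suc m
suc-^-lower a zero    = ≤-reflexive (lemma a)
  where
  lemma : ∀ a → a * 1 + 1 ≡ suc (a * 1)
  lemma = solve-∀
suc-^-lower a (suc m) = begin
  a ^ suc (suc m) + suc (suc m) * a ^ suc m
    ≤⟨ ℕ.m≤m+n _ (suc m * a ^ m) ⟩
  a ^ suc (suc m) + suc (suc m) * a ^ suc m + suc m * a ^ m
    ≡⟨ lemma a (a ^ m) m ⟩
  suc a * (a ^ suc m + suc m * a ^ m)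
    ≤⟨ ℕ.*-monoʳ-≤ (suc a) (suc-^-lower a m) ⟩
  suc a ^ suc (suc m) ∎
  where
  open ℕ.≤-Reasoning
  lemma : ∀ a p m → a * (a * p) + (a * p + (a * p + m * (a * p))) + (p + m * p) ≡
          a * p + (p + m * p) + a * (a * p + (p + m * p))
  lemma = solve-∀

suc-^-upper : ∀ a m → suc a ^ suc m ≤ a ^ suc m + suc m * suc a ^ m
suc-^-upper a zero    = ≤-reflexive (lemma a)
  where
  lemma : ∀ a → suc (a * 1) ≡ a * 1 + 1
  lemma = solve-∀
suc-^-upper a (suc m) = begin
  suc a * suc a ^ suc m
    ≡⟨⟩
  suc a ^ suc m + a * suc a ^ suc m
    ≤⟨ +-monoʳ-≤ (suc a ^ suc m) (ℕ.*-monoʳ-≤ a (suc-^-upper a m)) ⟩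
  suc a ^ suc m + a * (a ^ suc m + suc m * suc a ^ m)
    ≤⟨ ℕ.m≤m+n _ (suc m * suc a ^ m) ⟩
  suc a ^ suc m + a * (a ^ suc m + suc m * suc a ^ m) + suc m * suc a ^ m
    ≡⟨ lemma a (a ^ suc m) (suc a ^ m) m ⟩
  a ^ suc (suc m) + suc (suc m) * suc a ^ suc m ∎
  where
  open ℕ.≤-Reasoning
  lemma : ∀ a p q m → (q + a * q) + a * (p + (q + m * q)) + (q + m * q) ≡
          a * p + ((q + a * q) + ((q + a * q) + m * (q + a * q)))
  lemma = solve-∀

-- Write S_m for the m-th partial sum and x = a / N. The derivative of S_(m+1) is S_m, which
-- increases for x ≥ 0, so a step of length 1 / N adds at least S_m(x) / N. `expSum-suc-upper` takes
-- the derivative at the right end instead.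
expSum-suc-lower : ∀ N m a → expSum N (suc m) a + suc m * expSum N m a ≤ expSum N (suc m) (suc a)
expSum-suc-lower N zero    a = ≤-reflexive (lemma N a)
  where
  lemma : ∀ N a → (N + 0) * 1 + a * 1 + 1 ≡ (N + 0) * 1 + suc (a * 1)
  lemma = solve-∀
expSum-suc-lower N (suc m) a = begin
  expSum N (suc (suc m)) a + suc (suc m) * expSum N (suc m) a
    ≡⟨ lemma N m (expSum N (suc m) a) (expSum N m a) (a ^ suc m) (a ^ suc (suc m)) ⟩
  suc (suc m) * N * (expSum N (suc m) a + suc m * expSum N m a) + (a ^ suc (suc m) + suc (suc m) * a ^ suc m)
    ≤⟨ +-mono-≤ (ℕ.*-monoʳ-≤ (suc (suc m) * N) (expSum-suc-lower N m a)) (suc-^-lower a (suc m)) ⟩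
  expSum N (suc (suc m)) (suc a) ∎
  where
  open ℕ.≤-Reasoning
  lemma : ∀ N m s s₀ p q → (2 + m) * N * s + q + (2 + m) * ((1 + m) * N * s₀ + p) ≡
          (2 + m) * N * (s + (1 + m) * s₀) + (q + (2 + m) * p)
  lemma = solve-∀

expSum-suc-upper : ∀ N m a → expSum N (suc m) (suc a) ≤ expSum N (suc m) a + suc m * expSum N m (suc a)
expSum-suc-upper N zero    a = ≤-reflexive (lemma N a)
  where
  lemma : ∀ N a → (N + 0) * 1 + suc (a * 1) ≡ (N + 0) * 1 + a * 1 + 1
  lemma = solve-∀
expSum-suc-upper N (suc m) a = begin
  expSum N (suc (suc m)) (suc a)
    ≤⟨ +-mono-≤ (ℕ.*-monoʳ-≤ (suc (suc m) * N) (expSum-suc-upper N m a)) (suc-^-upper a (suc m)) ⟩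
  suc (suc m) * N * (expSum N (suc m) a + suc m * expSum N m (suc a))
    + (a ^ suc (suc m) + suc (suc m) * suc a ^ suc m)
    ≡⟨ lemma N m (expSum N (suc m) a) (expSum N m (suc a)) (suc a ^ suc m) (a ^ suc (suc m)) ⟩
  expSum N (suc (suc m)) a + suc (suc m) * expSum N (suc m) (suc a) ∎
  where
  open ℕ.≤-Reasoning
  lemma : ∀ N m s s₀ p q → (2 + m) * N * (s + (1 + m) * s₀) + (q + (2 + m) * p) ≡
          (2 + m) * N * s + q + (2 + m) * ((1 + m) * N * s₀ + p)
  lemma = solve-∀

-- A step of length 1 / N, together with one further term of the series, multiplies the partial sum
-- by at least 1 + 1 / N. Hence (1 + 1 / N) ^ j ≤ S_j(j / N).
expSum-power : ∀ N j → suc N ^ j * j ! ≤ expSum N j j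
expSum-power N zero    = ≤-refl
expSum-power N (suc j) = begin
  suc N ^ suc j * suc j !
    ≡⟨ lemma₁ N (suc N ^ j) j (j !) ⟩
  suc j * suc N * (suc N ^ j * j !)
    ≤⟨ ℕ.*-monoʳ-≤ (suc j * suc N) (expSum-power N j) ⟩
  suc j * suc N * expSum N j j
    ≡⟨ lemma₂ (suc j) N (expSum N j j) ⟩
  suc j * N * expSum N j j + suc j * expSum N j j
    ≤⟨ +-monoˡ-≤ (suc j * expSum N j j) (ℕ.m≤m+n (suc j * N * expSum N j j) (j ^ suc j)) ⟩
  expSum N (suc j) j + suc j * expSum N j j
    ≤⟨ expSum-suc-lower N j j ⟩
  expSum N (suc j) (suc j) ∎
  where
  open ℕ.≤-Reasoning
  lemma₁ : ∀ N p j f → (1 + N) * p * ((1 + j) * f) ≡ (1 + j) * (1 + N) * (p * f)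
  lemma₁ = solve-∀
  lemma₂ : ∀ j N s → j * (1 + N) * s ≡ j * N * s + j * s
  lemma₂ = solve-∀

-- With M = N + 1 one has S_m(x + 1 / M) ≤ S_m(x) + S_m(x + 1 / M) / M, so a step of length 1 / M
-- multiplies the partial sum by at most M / (M - 1) = M / N.
expSum-shift : ∀ N m a → N * expSum (suc N) m (suc a) ≤ suc N * expSum (suc N) m a
expSum-shift N zero    a = ℕ.*-monoˡ-≤ 1 (ℕ.n≤1+n N)
expSum-shift N (suc m) a = ℕ.+-cancelʳ-≤ (S (suc a)) _ _ (begin
  N * S (suc a) + S (suc a)
    ≡⟨ +-comm (N * S (suc a)) (S (suc a)) ⟩
  suc N * S (suc a)
    ≤⟨ ℕ.*-monoʳ-≤ (suc N) (expSum-suc-upper (suc N) m a) ⟩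
  suc N * (S a + suc m * expSum (suc N) m (suc a))
    ≡⟨ lemma (suc N) (S a) (suc m) (expSum (suc N) m (suc a)) ⟩
  suc N * S a + suc m * suc N * expSum (suc N) m (suc a)
    ≤⟨ +-monoʳ-≤ (suc N * S a) (ℕ.m≤m+n _ (suc a ^ suc m)) ⟩
  suc N * S a + S (suc a) ∎)
  where
  open ℕ.≤-Reasoning
  S = expSum (suc N) (suc m)
  lemma : ∀ n s m t → n * (s + m * t) ≡ n * s + m * n * t
  lemma = solve-∀

expSum-zero : ∀ N m → expSum N m 0 ≡ N ^ m * m !
expSum-zero N zero    = refl
expSum-zero N (suc m) = trans (cong (λ s → suc m * N * s + 0) (expSum-zero N m)) (lemma N m (N ^ m) (m !))
  where
  lemma : ∀ N m p f → (1 + m) * N * (p * f) + 0 ≡ N * p * ((1 + m) * f)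
  lemma = solve-∀

expSum≤ : ∀ N m j → N ^ j * expSum (suc N) m j ≤ suc N ^ j * (suc N ^ m * m !)
expSum≤ N m zero    = ≤-reflexive (cong (_+ 0) (expSum-zero (suc N) m))
expSum≤ N m (suc j) = begin
  N * N ^ j * expSum (suc N) m (suc j)
    ≡⟨ lemma₁ N (N ^ j) (expSum (suc N) m (suc j)) ⟩
  N ^ j * (N * expSum (suc N) m (suc j))
    ≤⟨ ℕ.*-monoʳ-≤ (N ^ j) (expSum-shift N m j) ⟩
  N ^ j * (suc N * expSum (suc N) m j)
    ≡⟨ lemma₂ (suc N) (N ^ j) (expSum (suc N) m j) ⟩
  suc N * (N ^ j * expSum (suc N) m j)
    ≤⟨ ℕ.*-monoʳ-≤ (suc N) (expSum≤ N m j) ⟩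
  suc N * (suc N ^ j * (suc N ^ m * m !))
    ≡⟨ *-assoc (suc N) (suc N ^ j) (suc N ^ m * m !) ⟨
  suc N ^ suc j * (suc N ^ m * m !) ∎
  where
  open ℕ.≤-Reasoning
  lemma₁ : ∀ N p s → N * p * s ≡ p * (N * s)
  lemma₁ = solve-∀
  lemma₂ : ∀ N p s → p * (N * s) ≡ N * (p * s)
  lemma₂ = solve-∀

-- Natural numbers as rationals

ι : ℕ → ℚ
ι a = pos a / 1

toℚᵘ-ι : ∀ a → ℚ.toℚᵘ (ι a) ℚᵘ.≃ ℚᵘ.mkℚᵘ (pos a) 0
toℚᵘ-ι a = ℚ.toℚᵘ-fromℚᵘ (ℚᵘ.mkℚᵘ (pos a) 0)

ι-+ : ∀ a b → ι (a + b) ≡ ι a ℚ.+ ι b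
ι-+ a b = ℚ.toℚᵘ-injective (begin
  ℚ.toℚᵘ (ι (a + b))                       ≈⟨ toℚᵘ-ι (a + b) ⟩
  ℚᵘ.mkℚᵘ (pos (a + b)) 0                    ≈⟨ ℚᵘ.*≡* (cong (ℤ._* pos 1)
    (cong₂ ℤ._+_ (sym (ℤ.*-identityʳ (pos a))) (sym (ℤ.*-identityʳ (pos b))))) ⟩
  ℚᵘ.mkℚᵘ (pos a) 0 ℚᵘ.+ ℚᵘ.mkℚᵘ (pos b) 0     ≈⟨ ℚᵘ.+-cong (toℚᵘ-ι a) (toℚᵘ-ι b) ⟨
  ℚ.toℚᵘ (ι a) ℚᵘ.+ ℚ.toℚᵘ (ι b)           ≈⟨ ℚ.toℚᵘ-homo-+ (ι a) (ι b) ⟨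
  ℚ.toℚᵘ (ι a ℚ.+ ι b)                     ∎)
  where open ℚᵘ.≃-Reasoning

ι-* : ∀ a b → ι (a * b) ≡ ι a ℚ.* ι b
ι-* a b = ℚ.toℚᵘ-injective (begin
  ℚ.toℚᵘ (ι (a * b))                       ≈⟨ toℚᵘ-ι (a * b) ⟩
  ℚᵘ.mkℚᵘ (pos (a * b)) 0                    ≈⟨ ℚᵘ.*≡* (cong (ℤ._* pos 1) (ℤ.pos-* a b)) ⟩
  ℚᵘ.mkℚᵘ (pos a) 0 ℚᵘ.* ℚᵘ.mkℚᵘ (pos b) 0     ≈⟨ ℚᵘ.*-cong (toℚᵘ-ι a) (toℚᵘ-ι b) ⟨
  ℚ.toℚᵘ (ι a) ℚᵘ.* ℚ.toℚᵘ (ι b)           ≈⟨ ℚ.toℚᵘ-homo-* (ι a) (ι b) ⟨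
  ℚ.toℚᵘ (ι a ℚ.* ι b)                     ∎)
  where open ℚᵘ.≃-Reasoning

ι-mono : ∀ {a b} → a ≤ b → ι a ℚ.≤ ι b
ι-mono {a} {b} a≤b = ℚ.toℚᵘ-cancel-≤ (begin
  ℚ.toℚᵘ (ι a)       ≃⟨ toℚᵘ-ι a ⟩
  ℚᵘ.mkℚᵘ (pos a) 0    ≤⟨ ℚᵘ.*≤* (ℤ.*-monoʳ-≤-nonNeg (pos 1) (ℤ.+≤+ a≤b)) ⟩
  ℚᵘ.mkℚᵘ (pos b) 0    ≃⟨ toℚᵘ-ι b ⟨
  ℚ.toℚᵘ (ι b)       ∎)
  where open ℚᵘ.≤-Reasoning

ι-nonNeg : ∀ a → ℚ.NonNegative (ι a)
ι-nonNeg a = ℚ.normalize-nonNeg a 1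

ι-pos : ∀ a .{{_ : NonZero a}} → ℚ.Positive (ι a)
ι-pos a = ℚ.normalize-pos a 1

1/d*ιd : ∀ d .{{_ : NonZero d}} → (pos 1 / d) ℚ.* ι d ≡ 1ℚ
1/d*ιd d@(suc d-1) = ℚ.toℚᵘ-injective (begin
  ℚ.toℚᵘ ((pos 1 / d) ℚ.* ι d)                  ≈⟨ ℚ.toℚᵘ-homo-* (pos 1 / d) (ι d) ⟩
  ℚ.toℚᵘ (pos 1 / d) ℚᵘ.* ℚ.toℚᵘ (ι d)          ≈⟨ ℚᵘ.*-cong (ℚ.toℚᵘ-fromℚᵘ (ℚᵘ.mkℚᵘ (pos 1) d-1)) (toℚᵘ-ι d) ⟩
  ℚᵘ.mkℚᵘ (pos 1) d-1 ℚᵘ.* ℚᵘ.mkℚᵘ (pos d) 0      ≈⟨ ℚᵘ.*≡* (cong pos (lemma d)) ⟩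
  ℚᵘ.1ℚᵘ                                      ∎)
  where
  open ℚᵘ.≃-Reasoning
  lemma : ∀ d → 1 * d * 1 ≡ 1 * (d * 1)
  lemma = solve-∀

-- At a = N the argument a / N of the series is 1.
e-seq-expSum : ∀ N m → e-seq m ℚ.* (ι (N ^ m) ℚ.* ι (m !)) ≡ ι (expSum N m N)
e-seq-expSum N zero    = refl
e-seq-expSum N (suc m) = begin
  (e-seq m ℚ.+ inv! (suc m)) ℚ.* (ι (N ^ suc m) ℚ.* ι (suc m !))
    ≡⟨ cong₂ (λ p f → (e-seq m ℚ.+ inv! (suc m)) ℚ.* (p ℚ.* f)) (ι-* N (N ^ m)) (ι-* (suc m) (m !)) ⟩
  (e-seq m ℚ.+ inv! (suc m)) ℚ.* (ι N ℚ.* ι (N ^ m) ℚ.* (ι (suc m) ℚ.* ι (m !)))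
    ≡⟨ solve 6 (λ e i n p m f → (e :+ i) :* (n :* p :* (m :* f)) :=
         m :* n :* (e :* (p :* f)) :+ i :* (m :* f) :* (n :* p)) refl
         (e-seq m) (inv! (suc m)) (ι N) (ι (N ^ m)) (ι (suc m)) (ι (m !)) ⟩
  ι (suc m) ℚ.* ι N ℚ.* (e-seq m ℚ.* (ι (N ^ m) ℚ.* ι (m !)))
    ℚ.+ inv! (suc m) ℚ.* (ι (suc m) ℚ.* ι (m !)) ℚ.* (ι N ℚ.* ι (N ^ m))
    ≡⟨ cong₂ ℚ._+_
         (trans (cong₂ ℚ._*_ (sym (ι-* (suc m) N)) (e-seq-expSum N m)) (sym (ι-* (suc m * N) (expSum N m N))))
         (trans (cong₂ ℚ._*_ (trans (cong (inv! (suc m) ℚ.*_) (sym (ι-* (suc m) (m !))))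
           (1/d*ιd (suc m !) {{suc m ℕ.!≢0}})) (sym (ι-* N (N ^ m)))) (ℚ.*-identityˡ (ι (N ^ suc m)))) ⟩
  ι (suc m * N * expSum N m N) ℚ.+ ι (N ^ suc m)
    ≡⟨ ι-+ (suc m * N * expSum N m N) (N ^ suc m) ⟨
  ι (expSum N (suc m) N) ∎
  where
  open ≡-Reasoning
  open +-*-Solver

power≤e : ∀ N → ι (suc N ^ N) ℚ.≤ e-seq N ℚ.* ι (N ^ N)
power≤e N = ℚ.*-cancelʳ-≤-pos (ι (N !)) {{ι-pos (N !) {{N ℕ.!≢0}}}} (begin
  ι (suc N ^ N) ℚ.* ι (N !)                ≡⟨ ι-* (suc N ^ N) (N !) ⟨
  ι (suc N ^ N * N !)                      ≤⟨ ι-mono (expSum-power N N) ⟩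
  ι (expSum N N N)                         ≡⟨ e-seq-expSum N N ⟨
  e-seq N ℚ.* (ι (N ^ N) ℚ.* ι (N !))      ≡⟨ ℚ.*-assoc (e-seq N) (ι (N ^ N)) (ι (N !)) ⟨
  e-seq N ℚ.* ι (N ^ N) ℚ.* ι (N !)        ∎)
  where open ℚ.≤-Reasoning

e≤power : ∀ N m → e-seq m ℚ.* ι (N ^ suc N) ℚ.≤ ι (suc N ^ suc N)
e≤power N m = ℚ.*-cancelʳ-≤-pos (ι (suc N ^ m * m !)) {{ι-pos (suc N ^ m * m !) {{nonZero}}}} (begin
  e-seq m ℚ.* ι (N ^ suc N) ℚ.* ι (suc N ^ m * m !)
    ≡⟨ cong (e-seq m ℚ.* ι (N ^ suc N) ℚ.*_) (ι-* (suc N ^ m) (m !)) ⟩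
  e-seq m ℚ.* ι (N ^ suc N) ℚ.* (ι (suc N ^ m) ℚ.* ι (m !))
    ≡⟨ solve 3 (λ e p q → e :* p :* q := p :* (e :* q)) refl
         (e-seq m) (ι (N ^ suc N)) (ι (suc N ^ m) ℚ.* ι (m !)) ⟩
  ι (N ^ suc N) ℚ.* (e-seq m ℚ.* (ι (suc N ^ m) ℚ.* ι (m !)))
    ≡⟨ cong (ι (N ^ suc N) ℚ.*_) (e-seq-expSum (suc N) m) ⟩
  ι (N ^ suc N) ℚ.* ι (expSum (suc N) m (suc N))
    ≡⟨ ι-* (N ^ suc N) (expSum (suc N) m (suc N)) ⟨
  ι (N ^ suc N * expSum (suc N) m (suc N))
    ≤⟨ ι-mono (expSum≤ N m (suc N)) ⟩
  ι (suc N ^ suc N * (suc N ^ m * m !))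
    ≡⟨ ι-* (suc N ^ suc N) (suc N ^ m * m !) ⟩
  ι (suc N ^ suc N) ℚ.* ι (suc N ^ m * m !) ∎)
  where
  open ℚ.≤-Reasoning
  open +-*-Solver
  nonZero : NonZero (suc N ^ m * m !)
  nonZero = ℕ.m*n≢0 (suc N ^ m) (m !) {{ℕ.m^n≢0 (suc N) m}} {{m ℕ.!≢0}}

-- From totals in the natural numbers to bounds on `Q`.

minimum≤ : ∀ {q} qs (q∈ : q ∈ qs) {x} → x ∈ qs → minimum qs q∈ ℚ.≤ x
minimum≤ (q ∷ qs) _ x∈ = go qs x∈
  where
  go : ∀ qs {x} → x ∈ q ∷ qs → foldr _⊓_ q qs ℚ.≤ x
  go []       (here refl)         = ℚ.≤-refl
  go (p ∷ qs) (here refl)         = ℚ.≤-trans (ℚ.p⊓q≤q p _) (go qs (here refl))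
  go (p ∷ qs) (there (here refl)) = ℚ.p⊓q≤p p _
  go (p ∷ qs) (there (there x∈))  = ℚ.≤-trans (ℚ.p⊓q≤q p _) (go qs (there x∈))

minimum∈ : ∀ {q} qs (q∈ : q ∈ qs) → minimum qs q∈ ∈ qs
minimum∈ (q ∷ qs) _ = go qs
  where
  go : ∀ qs → foldr _⊓_ q qs ∈ q ∷ qs
  go []       = here refl
  go (p ∷ qs) with ℚ.⊓-sel p (foldr _⊓_ q qs)
  ... | inj₁ eq = there (here eq)
  ... | inj₂ eq with go qs
  ...   | here eq′   = here (trans eq eq′)
  ...   | there mem  = there (there (subst (_∈ qs) (sym eq) mem))

∈-map-cartesianProduct⁻ : ∀ {A B C : Set} (P : C → Set) (f : A → B → C) xs ys →
  (∀ {x y} → x ∈ xs → y ∈ ys → P (f x y)) → ∀ {q} → q ∈ map (uncurry f) (cartesianProduct xs ys) → P q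
∈-map-cartesianProduct⁻ P f xs ys h q∈ with Mem.∈-map⁻ (uncurry f) q∈
... | (x , y) , xy∈ , refl with Mem.∈-cartesianProduct⁻ xs ys xy∈
...   | x∈ , y∈ = h x∈ y∈

Q-induct : ∀ n .{{_ : NonZero n}} (P : ℚ → Set) →
           (∀ {G π} → G ∈ Γ n → π ∈ Π n → P (ratio n G π)) → P (Q n)
Q-induct n P h = ∈-map-cartesianProduct⁻ P (ratio n) (Γ n) (Π n) h
  (minimum∈ (map (uncurry (ratio n)) (cartesianProduct (Γ n) (Π n))) _)

Q≤ratio : ∀ n .{{_ : NonZero n}} {G π} → G ∈ Γ n → π ∈ Π n → Q n ℚ.≤ ratio n G π
Q≤ratio n G∈ π∈ = minimum≤ (map (uncurry (ratio n)) (cartesianProduct (Γ n) (Π n))) _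
  (Mem.∈-map⁺ (uncurry (ratio n)) (Mem.∈-cartesianProduct⁺ G∈ π∈))

𝔼-cleared : ∀ {A : Set} (d : Distribution A) (f : A → ℕ) →
            𝔼 d (ι ∘ f) ℚ.* ι (length (toList d)) ≡ ι (∑ (toList d) f)
𝔼-cleared d f = begin
  foldr ℚ._+_ 0ℚ (map (ι ∘ f) (toList d)) ℚ.* (pos 1 / List⁺.length d) ℚ.* ι (length (toList d))
    ≡⟨ ℚ.*-assoc (foldr ℚ._+_ 0ℚ (map (ι ∘ f) (toList d))) (pos 1 / List⁺.length d) (ι (length (toList d))) ⟩
  foldr ℚ._+_ 0ℚ (map (ι ∘ f) (toList d)) ℚ.* ((pos 1 / List⁺.length d) ℚ.* ι (List⁺.length d))
    ≡⟨ cong₂ ℚ._*_ (sum-ι (toList d)) (1/d*ιd (List⁺.length d)) ⟩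
  ι (∑ (toList d) f) ℚ.* 1ℚ
    ≡⟨ ℚ.*-identityʳ (ι (∑ (toList d) f)) ⟩
  ι (∑ (toList d) f) ∎
  where
  open ≡-Reasoning
  sum-ι : ∀ xs → foldr ℚ._+_ 0ℚ (map (ι ∘ f) xs) ≡ ι (∑ xs f)
  sum-ι []       = refl
  sum-ι (x ∷ xs) = trans (cong (ι (f x) ℚ.+_) (sum-ι xs)) (sym (ι-+ (f x) (∑ xs f)))

ι-suc : ∀ k → ι (suc k) ≡ 1ℚ ℚ.+ ι k
ι-suc k = ι-+ 1 k

ratio-cleared : ∀ m G π → let n = suc m in
  ratio n G π ℚ.* (ι n ℚ.* ι ((2 * n) !)) ≡ ι (Crossing.total n G π)
ratio-cleared m G π = begin
  E ℚ.* 1/|M| ℚ.* (ι n ℚ.* ι ((2 * n) !))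
    ≡⟨ solve 4 (λ E r n F → E :* r :* (n :* F) := E :* F :* (r :* n)) refl E 1/|M| (ι n) (ι ((2 * n) !)) ⟩
  E ℚ.* ι ((2 * n) !) ℚ.* (1/|M| ℚ.* ι n)
    ≡⟨ cong₂ (λ F k → E ℚ.* ι F ℚ.* (1/|M| ℚ.* ι k)) (sym length-outcomes) (sym (Crossing.length-M n)) ⟩
  E ℚ.* ι (length (toList outcomes)) ℚ.* (1/|M| ℚ.* ι (length (M n)))
    ≡⟨ cong₂ ℚ._*_ (𝔼-cleared outcomes length) (1/d*ιd (length (M n))) ⟩
  ι (∑ (toList outcomes) length) ℚ.* 1ℚ
    ≡⟨ ℚ.*-identityʳ (ι (∑ (toList outcomes) length)) ⟩
  ι (∑ (toList outcomes) length)
    ≡⟨ cong ι (trans (∑-map (online-match G π) (toList (permutations (offline n))) length)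
         (cong (λ σs → ∑ σs (λ σ → length (online-match G π σ))) (toList-permutations (offline n)))) ⟩
  ι (Crossing.total n G π) ∎
  where
  open ≡-Reasoning
  open +-*-Solver
  n = suc m
  outcomes = RANKING (offline n) G π
  E = 𝔼 outcomes (ι ∘ length)
  1/|M| = pos 1 / length (M n)
  length-outcomes : length (toList outcomes) ≡ (2 * n) !
  length-outcomes = begin
    length (toList outcomes)
      ≡⟨ List.length-map (online-match G π) (toList (permutations (offline n))) ⟩
    length (toList (permutations (offline n)))
      ≡⟨ cong length (toList-permutations (offline n)) ⟩
    length (perms (offline n))
      ≡⟨ length-perms (offline n) ⟩
    length (offline n) !
      ≡⟨ cong _! (trans (List.length-map (vertex n zero) (List.allFin (2 * n))) (List.length-tabulate {n = 2 * n} id)) ⟩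
    (2 * n) ! ∎

-- ρ is an approximation of 1 / e and ε an error term. The estimates are made for each approximation
-- separately, so that they stay within the rationals.
module _ {ρ ε : ℚ} (i : ℕ) (0≤ρ : 0ℚ ℚ.≤ ρ) (ρ≤1 : ρ ℚ.≤ 1ℚ) (ρ*e : ρ ℚ.* e-seq i ≡ 1ℚ) where

  ρ-nonNeg : ℚ.NonNegative ρ
  ρ-nonNeg = ℚ.nonNegative 0≤ρ

  -- The loss (N / (N + 1)) ^ N is at most ρ (N + 1) / N, because e_i ≤ ((N + 1) / N) ^ (N + 1). It
  -- exceeds ρ by at most ρ / N ≤ ε.
  ratio-lower-bound : ∀ m {G π} → G ∈ Γ (suc m) → π ∈ Π (suc m) → 1ℚ ℚ.≤ ι (2 * suc m) ℚ.* ε →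
                      1ℚ ℚ.≤ ratio (suc m) G π ℚ.+ ρ ℚ.+ ε
  ratio-lower-bound m {G} {π} G∈ π∈ 1≤Nε = ℚ.*-cancelˡ-≤-pos (ι N) {{ι-pos N}} (ℚ.*-cancelˡ-≤-pos X {{X-pos}} (begin
    X ℚ.* (ι N ℚ.* 1ℚ)
      ≡⟨ solve 2 (λ X N → X :* (N :* con 1ℚ) := N :* X) refl X (ι N) ⟩
    ι N ℚ.* X
      ≤⟨ ℚ.*-monoˡ-≤-nonNeg (ι N) {{ι-nonNeg N}} X≤ ⟩
    ι N ℚ.* (X ℚ.* q ℚ.+ Y)
      ≡⟨ solve 4 (λ N X q Y → N :* (X :* q :+ Y) := X :* (N :* q) :+ con 1ℚ :* (N :* Y)) refl (ι N) X q Y ⟩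
    X ℚ.* (ι N ℚ.* q) ℚ.+ 1ℚ ℚ.* (ι N ℚ.* Y)
      ≡⟨ cong (λ u → X ℚ.* (ι N ℚ.* q) ℚ.+ u ℚ.* (ι N ℚ.* Y)) ρ*e ⟨
    X ℚ.* (ι N ℚ.* q) ℚ.+ ρ ℚ.* e-seq i ℚ.* (ι N ℚ.* Y)
      ≡⟨ cong (X ℚ.* (ι N ℚ.* q) ℚ.+_) (ℚ.*-assoc ρ (e-seq i) (ι N ℚ.* Y)) ⟩
    X ℚ.* (ι N ℚ.* q) ℚ.+ ρ ℚ.* (e-seq i ℚ.* (ι N ℚ.* Y))
      ≤⟨ ℚ.+-monoʳ-≤ (X ℚ.* (ι N ℚ.* q)) (ℚ.*-monoˡ-≤-nonNeg ρ {{ρ-nonNeg}} e≤) ⟩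
    X ℚ.* (ι N ℚ.* q) ℚ.+ ρ ℚ.* ((1ℚ ℚ.+ ι N) ℚ.* X)
      ≡⟨ solve 4 (λ N X q ρ → X :* (N :* q) :+ ρ :* ((con 1ℚ :+ N) :* X) := X :* (N :* (q :+ ρ) :+ ρ))
           refl (ι N) X q ρ ⟩
    X ℚ.* (ι N ℚ.* (q ℚ.+ ρ) ℚ.+ ρ)
      ≤⟨ ℚ.*-monoˡ-≤-nonNeg X {{ℚ.pos⇒nonNeg X {{X-pos}}}} (ℚ.+-monoʳ-≤ (ι N ℚ.* (q ℚ.+ ρ)) (ℚ.≤-trans ρ≤1 1≤Nε)) ⟩
    X ℚ.* (ι N ℚ.* (q ℚ.+ ρ) ℚ.+ ι N ℚ.* ε)
      ≡⟨ cong (X ℚ.*_) (ℚ.*-distribˡ-+ (ι N) (q ℚ.+ ρ) ε) ⟨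
    X ℚ.* (ι N ℚ.* (q ℚ.+ ρ ℚ.+ ε)) ∎))
    where
    open ℚ.≤-Reasoning
    open +-*-Solver
    n = suc m
    N = 2 * n
    q = ratio n G π
    X = ι (suc N ^ N)
    Y = ι (N ^ N)
    W = ι (n * N !)
    X-pos : ℚ.Positive X
    X-pos = ι-pos (suc N ^ N) {{ℕ.m^n≢0 (suc N) N}}
    e≤ : e-seq i ℚ.* (ι N ℚ.* Y) ℚ.≤ (1ℚ ℚ.+ ι N) ℚ.* X
    e≤ = subst₂ ℚ._≤_ (cong (e-seq i ℚ.*_) (ι-* N (N ^ N)))
      (trans (ι-* (suc N) (suc N ^ N)) (cong (ℚ._* X) (ι-suc N))) (e≤power N i)
    X≤ : X ℚ.≤ X ℚ.* q ℚ.+ Y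
    X≤ = ℚ.*-cancelʳ-≤-pos W {{ι-pos (n * N !) {{ℕ.m*n≢0 n (N !) {{_}} {{N ℕ.!≢0}}}}}} (begin
      X ℚ.* W
        ≡⟨ ι-* (suc N ^ N) (n * N !) ⟨
      ι (suc N ^ N * (n * N !))
        ≤⟨ ι-mono (Crossing.total-lower-bound n G∈ π∈) ⟩
      ι (suc N ^ N * Crossing.total n G π + N ^ N * (n * N !))
        ≡⟨ trans (ι-+ (suc N ^ N * Crossing.total n G π) (N ^ N * (n * N !)))
             (cong₂ ℚ._+_ (ι-* (suc N ^ N) (Crossing.total n G π)) (ι-* (N ^ N) (n * N !))) ⟩
      X ℚ.* ι (Crossing.total n G π) ℚ.+ Y ℚ.* W
        ≡⟨ cong (λ S → X ℚ.* S ℚ.+ Y ℚ.* W)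
             (trans (sym (ratio-cleared m G π)) (cong (q ℚ.*_) (sym (ι-* n (N !))))) ⟩
      X ℚ.* (q ℚ.* W) ℚ.+ Y ℚ.* W
        ≡⟨ solve 4 (λ X q Y W → X :* (q :* W) :+ Y :* W := (X :* q :+ Y) :* W) refl X q Y W ⟩
      (X ℚ.* q ℚ.+ Y) ℚ.* W ∎)

  -- From k ≤ i follows ((k + 1) / k) ^ k ≤ e_k ≤ e_i, hence ρ ≤ (k / (k + 1)) ^ k. The one further
  -- factor k / (k + 1) costs ρ / (k + 1) ≤ ε.
  ratio-upper-bound : ∀ m k .{{_ : NonZero k}} → suc k ^ k ≡ suc m → k ≤ i → 1ℚ ℚ.≤ ι (suc k) ℚ.* ε →
    ratio (suc m) (Crossing.triangular (suc m)) (Crossing.π-reverse (suc m)) ℚ.+ ρ ℚ.≤ 1ℚ ℚ.+ ε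
  ratio-upper-bound m k n≡ k≤i 1≤kε = ℚ.*-cancelˡ-≤-pos (ι (suc k)) {{ι-pos (suc k)}} (begin
    ι (suc k) ℚ.* (q ℚ.+ ρ)
      ≡⟨ cong (ℚ._* (q ℚ.+ ρ)) (ι-suc k) ⟩
    (1ℚ ℚ.+ ι k) ℚ.* (q ℚ.+ ρ)
      ≡⟨ solve 3 (λ k q ρ → (con 1ℚ :+ k) :* (q :+ ρ) := (con 1ℚ :+ k) :* q :+ k :* ρ :+ ρ) refl (ι k) q ρ ⟩
    (1ℚ ℚ.+ ι k) ℚ.* q ℚ.+ ι k ℚ.* ρ ℚ.+ ρ
      ≤⟨ ℚ.+-mono-≤ without-X (ℚ.≤-trans ρ≤1 1≤kε) ⟩
    1ℚ ℚ.+ ι k ℚ.+ ι (suc k) ℚ.* ε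
      ≡⟨ cong (ℚ._+ ι (suc k) ℚ.* ε) (trans (sym (ι-suc k)) (sym (ℚ.*-identityʳ (ι (suc k))))) ⟩
    ι (suc k) ℚ.* 1ℚ ℚ.+ ι (suc k) ℚ.* ε
      ≡⟨ ℚ.*-distribˡ-+ (ι (suc k)) 1ℚ ε ⟨
    ι (suc k) ℚ.* (1ℚ ℚ.+ ε) ∎)
    where
    open ℚ.≤-Reasoning
    open +-*-Solver
    n = suc m
    q = ratio n (Crossing.triangular n) (Crossing.π-reverse n)
    S = Crossing.total n (Crossing.triangular n) (Crossing.π-reverse n)
    F! = (2 * n) !
    X = ι n
    Y = ι (k ^ k)
    F = ι F!
    ρX≤Y : ρ ℚ.* X ℚ.≤ Y
    ρX≤Y = begin
      ρ ℚ.* X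
        ≡⟨ cong (λ n → ρ ℚ.* ι n) n≡ ⟨
      ρ ℚ.* ι (suc k ^ k)
        ≤⟨ ℚ.*-monoˡ-≤-nonNeg ρ {{ρ-nonNeg}} (power≤e k) ⟩
      ρ ℚ.* (e-seq k ℚ.* Y)
        ≤⟨ ℚ.*-monoˡ-≤-nonNeg ρ {{ρ-nonNeg}} (ℚ.*-monoʳ-≤-nonNeg Y {{ι-nonNeg (k ^ k)}} (proj₁ (e-seq-range k i (ℕ.>-nonZero⁻¹ k) k≤i))) ⟩
      ρ ℚ.* (e-seq i ℚ.* Y)
        ≡⟨ ℚ.*-assoc ρ (e-seq i) Y ⟨
      ρ ℚ.* e-seq i ℚ.* Y
        ≡⟨ trans (cong (ℚ._* Y) ρ*e) (ℚ.*-identityˡ Y) ⟩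
      Y ∎
    without-F : (1ℚ ℚ.+ ι k) ℚ.* (q ℚ.* X) ℚ.+ ι k ℚ.* Y ℚ.≤ (1ℚ ℚ.+ ι k) ℚ.* X
    without-F = ℚ.*-cancelʳ-≤-pos F {{ι-pos F! {{(2 * n) ℕ.!≢0}}}} (begin
      ((1ℚ ℚ.+ ι k) ℚ.* (q ℚ.* X) ℚ.+ ι k ℚ.* Y) ℚ.* F
        ≡⟨ solve 5 (λ k q X Y F → ((con 1ℚ :+ k) :* (q :* X) :+ k :* Y) :* F :=
             (con 1ℚ :+ k) :* (q :* (X :* F)) :+ k :* (Y :* F)) refl (ι k) q X Y F ⟩
      (1ℚ ℚ.+ ι k) ℚ.* (q ℚ.* (X ℚ.* F)) ℚ.+ ι k ℚ.* (Y ℚ.* F)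
        ≡⟨ cong₂ (λ s t → s ℚ.+ ι k ℚ.* t)
             (cong₂ ℚ._*_ (sym (ι-suc k)) (ratio-cleared m (Crossing.triangular n) (Crossing.π-reverse n)))
             (sym (ι-* (k ^ k) F!)) ⟩
      ι (suc k) ℚ.* ι S ℚ.+ ι k ℚ.* ι (k ^ k * F!)
        ≡⟨ trans (ι-+ (suc k * S) (k * (k ^ k * F!))) (cong₂ ℚ._+_ (ι-* (suc k) S) (ι-* k (k ^ k * F!))) ⟨
      ι (suc k * S + k * (k ^ k * F!))
        ≤⟨ ι-mono (Crossing.total-upper-bound n k n≡) ⟩
      ι (suc k * (n * F!))
        ≡⟨ trans (ι-* (suc k) (n * F!)) (cong₂ ℚ._*_ (ι-suc k) (ι-* n F!)) ⟩
      (1ℚ ℚ.+ ι k) ℚ.* (X ℚ.* F)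
        ≡⟨ ℚ.*-assoc (1ℚ ℚ.+ ι k) X F ⟨
      (1ℚ ℚ.+ ι k) ℚ.* X ℚ.* F ∎)
    without-X : (1ℚ ℚ.+ ι k) ℚ.* q ℚ.+ ι k ℚ.* ρ ℚ.≤ 1ℚ ℚ.+ ι k
    without-X = ℚ.*-cancelʳ-≤-pos X {{ι-pos n}} (begin
      ((1ℚ ℚ.+ ι k) ℚ.* q ℚ.+ ι k ℚ.* ρ) ℚ.* X
        ≡⟨ solve 4 (λ k q ρ X → ((con 1ℚ :+ k) :* q :+ k :* ρ) :* X :=
             (con 1ℚ :+ k) :* (q :* X) :+ k :* (ρ :* X)) refl (ι k) q ρ X ⟩
      (1ℚ ℚ.+ ι k) ℚ.* (q ℚ.* X) ℚ.+ ι k ℚ.* (ρ ℚ.* X)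
        ≤⟨ ℚ.+-monoʳ-≤ ((1ℚ ℚ.+ ι k) ℚ.* (q ℚ.* X)) (ℚ.*-monoˡ-≤-nonNeg (ι k) {{ι-nonNeg k}} ρX≤Y) ⟩
      (1ℚ ℚ.+ ι k) ℚ.* (q ℚ.* X) ℚ.+ ι k ℚ.* Y
        ≤⟨ without-F ⟩
      (1ℚ ℚ.+ ι k) ℚ.* X ∎)

  Q-lower-bound : ∀ m → 1ℚ ℚ.≤ ι (2 * suc m) ℚ.* ε → 1ℚ ℚ.≤ Q (suc m) ℚ.+ ρ ℚ.+ ε
  Q-lower-bound m 1≤Nε = Q-induct (suc m) (λ q → 1ℚ ℚ.≤ q ℚ.+ ρ ℚ.+ ε)
    (λ G∈ π∈ → ratio-lower-bound m G∈ π∈ 1≤Nε)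

  Q-upper-bound : ∀ m k .{{_ : NonZero k}} → suc k ^ k ≡ suc m → k ≤ i → 1ℚ ℚ.≤ ι (suc k) ℚ.* ε →
                  Q (suc m) ℚ.+ ρ ℚ.≤ 1ℚ ℚ.+ ε
  Q-upper-bound m k n≡ k≤i 1≤kε = ℚ.≤-trans
    (ℚ.+-monoˡ-≤ ρ (Q≤ratio (suc m) (Crossing.triangular∈Γ (suc m)) (Crossing.π-reverse∈Π (suc m))))
    (ratio-upper-bound m k n≡ k≤i 1≤kε)

-- The limit

1/e : ℕ → ℚ
1/e = ℝ.seq (reciprocal e 0<e)

1≤e-seq : ∀ i → 1ℚ ℚ.≤ e-seq i
1≤e-seq i = proj₂ (proj₂ (proj₂ 0<e)) i z≤n

1/e*e : ∀ i → 1/e i ℚ.* e-seq i ≡ 1ℚ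
-- `reciprocal` inverts the maximum of e_i and the bound 1 supplied by `0<e`; since 1 ≤ e_i, this
-- maximum is e_i.
1/e*e i = trans (cong (1/e i ℚ.*_) (sym (ℚ.p≥q⇒p⊔q≡p (1≤e-seq i))))
  (ℚ.*-inverseˡ (e-seq i ⊔ 1ℚ) {{ℚ.pos⇒nonZero (e-seq i ⊔ 1ℚ) {{positive}}}})
  where
  positive : ℚ.Positive (e-seq i ⊔ 1ℚ)
  positive = ℚ.positive (ℚ.<-≤-trans (ℚ.positive⁻¹ 1ℚ) (ℚ.p≤q⊔p (e-seq i) 1ℚ))

0≤1/e : ∀ i → 0ℚ ℚ.≤ 1/e i
0≤1/e i = ℚ.*-cancelʳ-≤-pos (e-seq i) {{ℚ.positive (ℚ.<-≤-trans (ℚ.positive⁻¹ 1ℚ) (1≤e-seq i))}}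
  (subst₂ ℚ._≤_ (sym (ℚ.*-zeroˡ (e-seq i))) (sym (1/e*e i)) (ℚ.nonNegative⁻¹ 1ℚ))

1/e≤1 : ∀ i → 1/e i ℚ.≤ 1ℚ
1/e≤1 i = subst₂ ℚ._≤_ (ℚ.*-identityʳ (1/e i)) (1/e*e i)
  (ℚ.*-monoˡ-≤-nonNeg (1/e i) {{ℚ.nonNegative (0≤1/e i)}} (1≤e-seq i))

archimedean : ∀ ε → 0ℚ ℚ.< ε → ∃ λ A → ∀ {B} → A ≤ B → 1ℚ ℚ.≤ ι B ℚ.* ε
archimedean ε 0<ε with 1/!<ε ε 0<ε
... | K , _ , 1/K!<ε = K ! , λ {B} K!≤B → begin
  1ℚ                       ≡⟨ 1/d*ιd (K !) {{K ℕ.!≢0}} ⟨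
  inv! K ℚ.* ι (K !)       ≤⟨ ℚ.*-monoʳ-≤-nonNeg (ι (K !)) {{ι-nonNeg (K !)}} (ℚ.<⇒≤ 1/K!<ε) ⟩
  ε ℚ.* ι (K !)            ≤⟨ ℚ.*-monoˡ-≤-nonNeg ε {{ℚ.nonNegative (ℚ.<⇒≤ 0<ε)}} (ι-mono K!≤B) ⟩
  ε ℚ.* ι B                ≡⟨ ℚ.*-comm ε (ι B) ⟩
  ι B ℚ.* ε                ∎
  where open ℚ.≤-Reasoning

-- The limit x is not known, so two terms are compared with each other: by the triangle inequality
-- through the approximation of x at index I ⊔ J, where both estimates are in force.
⟶-cauchy : ∀ {a x} → a ⟶ x → ∀ η → 0ℚ ℚ.< η → ∃ λ K → ∀ m n → K ≤ m → K ≤ n → a m ℚ.≤ a n ℚ.+ (η ℚ.+ η)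
⟶-cauchy {a} {x} a⟶x η 0<η with a⟶x η 0<η
... | K , near = K , λ m n K≤m K≤n → case (near m K≤m , near n K≤n) of λ
  { ((δ , 0<δ , I , am) , (δ′ , 0<δ′ , J , an)) → close {a m} {a n} (drop-δ 0<δ (am (I ℕ.⊔ J) (ℕ.m≤m⊔n I J)))
                                                        (drop-δ 0<δ′ (an (I ℕ.⊔ J) (ℕ.m≤n⊔m I J))) }
  where
  open ℚ.≤-Reasoning
  drop-δ : ∀ {p δ} → 0ℚ ℚ.< δ → p ℚ.+ δ ℚ.≤ η → p ℚ.≤ η
  drop-δ {p} {δ} 0<δ p+δ≤η = begin
    p          ≡⟨ ℚ.+-identityʳ p ⟨
    p ℚ.+ 0ℚ   ≤⟨ ℚ.+-monoʳ-≤ p (ℚ.<⇒≤ 0<δ) ⟩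
    p ℚ.+ δ    ≤⟨ p+δ≤η ⟩
    η          ∎
  close : ∀ {p q r} → ℚ.∣ p ℚ.- r ∣ ℚ.≤ η → ℚ.∣ q ℚ.- r ∣ ℚ.≤ η → p ℚ.≤ q ℚ.+ (η ℚ.+ η)
  close {p} {q} {r} pr qr = begin
    p                                                      ≤⟨ p≤q+∣p-q∣ p r ⟩
    r ℚ.+ ℚ.∣ p ℚ.- r ∣                                    ≤⟨ ℚ.+-mono-≤ (q≤p+∣p-q∣ q r) pr ⟩
    q ℚ.+ ℚ.∣ q ℚ.- r ∣ ℚ.+ η                              ≤⟨ ℚ.+-monoˡ-≤ η (ℚ.+-monoʳ-≤ q qr) ⟩
    q ℚ.+ η ℚ.+ η                                          ≡⟨ ℚ.+-assoc q η η ⟩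
    q ℚ.+ (η ℚ.+ η)                                        ∎

∣q-[1-ρ]∣≤ : ∀ {q q′ ρ η} → 0ℚ ℚ.≤ η → q ℚ.≤ q′ ℚ.+ (η ℚ.+ η) → q′ ℚ.+ ρ ℚ.≤ 1ℚ ℚ.+ η →
  1ℚ ℚ.≤ q ℚ.+ ρ ℚ.+ η → ℚ.∣ q ℚ.- (1ℚ ℚ.- ρ) ∣ ℚ.≤ η ℚ.+ η ℚ.+ η
∣q-[1-ρ]∣≤ {q} {q′} {ρ} {η} 0≤η close upper lower = ∣p-q∣≤r
  (begin
    q                                   ≤⟨ close ⟩
    q′ ℚ.+ (η ℚ.+ η)                    ≡⟨ solve 3 (λ q ρ η → q :+ (η :+ η) := q :+ ρ :+ (η :+ η :- ρ)) refl q′ ρ η ⟩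
    q′ ℚ.+ ρ ℚ.+ (η ℚ.+ η ℚ.- ρ)        ≤⟨ ℚ.+-monoˡ-≤ (η ℚ.+ η ℚ.- ρ) upper ⟩
    1ℚ ℚ.+ η ℚ.+ (η ℚ.+ η ℚ.- ρ)        ≡⟨ solve 2 (λ ρ η → con 1ℚ :+ η :+ (η :+ η :- ρ) :=
                                             con 1ℚ :- ρ :+ (η :+ η :+ η)) refl ρ η ⟩
    1ℚ ℚ.- ρ ℚ.+ (η ℚ.+ η ℚ.+ η)        ∎)
  (begin
    1ℚ ℚ.- ρ                            ≤⟨ ℚ.+-monoˡ-≤ (ℚ.- ρ) lower ⟩
    q ℚ.+ ρ ℚ.+ η ℚ.- ρ                 ≡⟨ solve 3 (λ q ρ η → q :+ ρ :+ η :- ρ := q :+ (con 0ℚ :+ con 0ℚ :+ η))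
                                             refl q ρ η ⟩
    q ℚ.+ (0ℚ ℚ.+ 0ℚ ℚ.+ η)             ≤⟨ ℚ.+-monoʳ-≤ q (ℚ.+-monoˡ-≤ η (ℚ.+-mono-≤ 0≤η 0≤η)) ⟩
    q ℚ.+ (η ℚ.+ η ℚ.+ η)               ∎)
  where
  open ℚ.≤-Reasoning
  open +-*-Solver

-- With k = K + 1 the upper bound is available at index m, as the term at m is `Q (suc m)`; K ≤ m
-- puts m in the range of the Cauchy estimate.
power-index : ∀ K → ∃ λ m → suc (suc K) ^ suc K ≡ suc m × K ≤ m
power-index K = ℕ.pred p , sym (ℕ.suc-pred p) , ℕ.s≤s⁻¹ (begin
  suc K                   ≤⟨ ℕ.n≤1+n (suc K) ⟩
  suc (suc K)             ≡⟨ ℕ.^-identityʳ (suc (suc K)) ⟨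
  suc (suc K) ^ 1         ≤⟨ ℕ.^-monoʳ-≤ (suc (suc K)) {1} {suc K} (s≤s z≤n) ⟩
  p                       ≡⟨ ℕ.suc-pred p ⟨
  suc (ℕ.pred p)          ∎)
  where
  open ℕ.≤-Reasoning
  p = suc (suc K) ^ suc K
  instance
    p-nonZero : NonZero p
    p-nonZero = ℕ.m^n≢0 (suc (suc K)) (suc K)

-- The upper bound along m + 1 = (k + 1) ^ k suffices, as the sequence converges.
module SubsequenceLimit (a : ℕ → ℚ)
  (lower : ∀ {η} i m → 1ℚ ℚ.≤ ι (2 * suc m) ℚ.* η → 1ℚ ℚ.≤ a m ℚ.+ 1/e i ℚ.+ η)
  (upper : ∀ {η} i m k .{{_ : NonZero k}} → suc k ^ k ≡ suc m → k ≤ i → 1ℚ ℚ.≤ ι (suc k) ℚ.* η →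
           a m ℚ.+ 1/e i ℚ.≤ 1ℚ ℚ.+ η)
  where

  -- Of the three η, two come from comparing the terms at n and m, and one from the upper bound at
  -- m; the lower bound holds at n itself. The index i of the approximation of 1 / e must reach the
  -- k of the upper bound.
  estimate : ∀ {η} → 0ℚ ℚ.< η →
    (∃ λ K → ∀ m n → K ≤ m → K ≤ n → a m ℚ.≤ a n ℚ.+ (η ℚ.+ η)) →
    (∃ λ A → ∀ {B} → A ≤ B → 1ℚ ℚ.≤ ι B ℚ.* η) →
    ∃ λ K → ∀ n → K ≤ n → ∃ λ k → ∀ i → k ≤ i →
    ℚ.∣ a n ℚ.- (1ℚ ℚ.- 1/e i) ∣ ℚ.≤ η ℚ.+ η ℚ.+ η
  estimate 0<η (K , cauchy) (A , large) = K ℕ.⊔ A , λ n K⊔A≤n → suc (K ℕ.⊔ A) , λ i k≤i →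
    let m , p≡ , K⊔A≤m = power-index (K ℕ.⊔ A) in
    ∣q-[1-ρ]∣≤ {a n} {a m} (ℚ.<⇒≤ 0<η)
      (cauchy n m (ℕ.m⊔n≤o⇒m≤o K A K⊔A≤n) (ℕ.m⊔n≤o⇒m≤o K A K⊔A≤m))
      (upper i m (suc (K ℕ.⊔ A)) p≡ k≤i (large (ℕ.m≤n⇒m≤1+n (ℕ.m≤n⇒m≤1+n (ℕ.m≤n⊔m K A)))))
      (lower i n (large (≤-trans (ℕ.m⊔n≤o⇒n≤o K A K⊔A≤n) (≤-trans (ℕ.n≤1+n n) (ℕ.m≤m+n (suc n) (suc n + 0))))))

  limit : Convergent a → a ⟶ 1ℝ - reciprocal e 0<e
  limit (x , a⟶x) ε 0<ε =
    -- A quarter of ε: three go into `estimate`, and the fourth is the gap δ that the strict order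
    -- on `ℝ` demands.
    let η = ½ ℚ.* (½ ℚ.* ε)
        0<η = 0<½ε (0<½ε 0<ε)
        K , close = estimate 0<η (⟶-cauchy {a} {x} a⟶x η 0<η) (archimedean η 0<η)
    in K , λ n K≤n → let k , close-n = close n K≤n in
      η , 0<η , k , λ i k≤i → subst (ℚ.∣ a n ℚ.- (1ℚ ℚ.- 1/e i) ∣ ℚ.+ η ℚ.≤_) (quarters ε) (ℚ.+-monoˡ-≤ η (close-n i k≤i))
    where
    quarters : ∀ ε → let η = ½ ℚ.* (½ ℚ.* ε) in η ℚ.+ η ℚ.+ η ℚ.+ η ≡ ε
    quarters ε = begin
      η ℚ.+ η ℚ.+ η ℚ.+ η          ≡⟨ ℚ.+-assoc (η ℚ.+ η) η η ⟩
      η ℚ.+ η ℚ.+ (η ℚ.+ η)        ≡⟨ cong (λ d → d ℚ.+ d) (halves (½ ℚ.* ε)) ⟩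
      ½ ℚ.* ε ℚ.+ ½ ℚ.* ε          ≡⟨ halves ε ⟩
      ε                            ∎
      where
      open ≡-Reasoning
      η = ½ ℚ.* (½ ℚ.* ε)

theorem4 : Convergent (λ m → Q (suc m)) → (λ m → Q (suc m)) ⟶ 1ℝ - reciprocal e 0<e
theorem4 = SubsequenceLimit.limit (λ m → Q (suc m))
  (λ i → Q-lower-bound i (0≤1/e i) (1/e≤1 i) (1/e*e i))
  (λ i → Q-upper-bound i (0≤1/e i) (1/e≤1 i) (1/e*e i))
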